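{- Let $n\ge 2$, let $A$ be an $n\times n$ matrix with all entries in $\{ -1,1\}$, and let $\operatorname{rk} A = r+1$ with $0\le r\le n-1$. Then: (1) If $(n,r)\neq(4,3)$ (that is, in all cases except that of a nonsingular matrix of order $4$), then $|\operatorname{per} A|\le \operatorname{per} D_{(n,r)}$. (2) If $(n,r)=(4,3)$, then the inequality $|\operatorname{per} A|\le \operatorname{per} D_{(4,3)}$ fails if and only if $A$ can be obtained from $D_{(4,4)}$ by standard transformations (so $D_{(4,4)}$ is, up to standard transformations, the unique exception). (3) The equality $|\operatorname{per} A|=\operatorname{per} D_{(n,r)}$ holds if and only if $A$ can be obtained from $D_{(n,r)}$ by standard transformations. In particular, for $n\ge 5$, every $A\in M_n(\pm1)$ with $\operatorname{rk}A=r+1$ satisfies $|\operatorname{per} A|\le \operatorname{per} D_{(n,r)}$, with equality if and only if $A$ can be obtained from $D_{(n,r)}$ by standard transformations.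
   Context: $M_n(\pm1)$ is the set of $n\times n$ matrices with entries in $\{ -1,1\}$, regarded over a field of characteristic zero; rank is over this field. The permanent is $\operatorname{per}A=\sum_{\sigma\in S_n}a_{1\sigma(1)}\cdots a_{n\sigma(n)}$. For $0\le l\le n$, $D_{(n,l)}=(d_{ij})\in M_n(\pm1)$ is the matrix with $d_{ii}=-1$ for $1\le i\le l$ and all other entries equal to $1$. Standard transformations are: multiplication of rows or columns by $-1$, permutation of rows, permutation of columns, transposition, and their compositions. -}

module Defs where

open import Level using (Level; _⊔_; 0ℓ)
open import Algebra.Apartness.Bundles using (HeytingField; module HeytingCommutativeRing)
open import Algebra.Bundles using (CommutativeRing)
import Algebra.Definitions.RawMonoid as RawMonoidDefs
open import Data.Bool.Base using (if_then_else_; _∧_)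
open import Data.Fin.Base using (Fin; zero; suc; toℕ; punchIn)
open import Data.Fin.Permutation using (Permutation′; _⟨$⟩ʳ_; insert; remove; insert-remove; insert-punchIn)
import Data.Fin.Permutation as Perm
open import Data.Fin.Properties using (_≟_; punchIn-injective)
open import Data.Integer.Base using (ℤ; +_; -[1+_]; -_; 0ℤ; 1ℤ; -1ℤ)
import Data.Integer.Base as ℤ
open import Data.List.Base using (List; []; _∷_; map; concat; allFin)
import Data.List.Base as List
open import Data.List.Membership.Propositional.Properties using (∈-allFin)
open import Data.List.Relation.Unary.All using (All; []; _∷_)
import Data.List.Relation.Unary.All as All
import Data.List.Relation.Unary.All.Properties as All
open import Data.List.Relation.Unary.AllPairs using (AllPairs; []; _∷_)
import Data.List.Relation.Unary.AllPairs as AllPairs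
import Data.List.Relation.Unary.AllPairs.Properties as AllPairs
open import Data.List.Relation.Unary.Any using (Any; here)
import Data.List.Relation.Unary.Any as Any
import Data.List.Relation.Unary.Any.Properties as Any
import Data.List.Relation.Unary.Unique.Propositional.Properties as Unique
open import Data.Nat.Base using (ℕ; zero; suc; _≤_)
open import Data.Nat.Properties using (_<?_)
open import Data.Product.Base using (_×_; _,_; ∃-syntax)
open import Data.Sum.Base using (_⊎_)
import Data.Vec.Functional as Vector
open import Relation.Binary.Construct.Closure.ReflexiveTransitive using (Star)
open import Relation.Binary.PropositionalEquality using (_≡_; _≢_; refl; sym; trans)
open import Relation.Nullary.Decidable.Core using (does)
open import Relation.Nullary.Negation.Core using (¬_)

private
  variable
    c ℓ₁ ℓ₂ : Level
    n : ℕ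

-- The entries that occur are ±1, so permanents are integers and are compared
-- in ℤ; the ground field enters only through the rank.

Matrix : ℕ → Set
Matrix n = Fin n → Fin n → ℤ

IsSignMatrix : Matrix n → Set
IsSignMatrix A = ∀ i j → A i j ≡ 1ℤ ⊎ A i j ≡ -1ℤ

-- Indices start from 0, so "1 ≤ i ≤ l" reads "toℕ i < l".

D : (n l : ℕ) → Matrix n
D n l i j = if does (i ≟ j) ∧ does (toℕ i <? l) then -1ℤ else 1ℤ

allPermutations : ∀ n → List (Permutation′ n)
allPermutations zero    = Perm.id ∷ []
allPermutations (suc n) =
  concat (map (λ j → map (insert zero j) (allPermutations n)) (allFin (suc n)))

permanent : Matrix n → ℤ
permanent {n} A = List.foldr ℤ._+_ 0ℤ (map term (allPermutations n))
  where
  term : Permutation′ n → ℤ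
  term σ = Vector.foldr ℤ._*_ 1ℤ (λ i → A i (σ ⟨$⟩ʳ i))

-- Sanity check on the index set of the permanent: every permutation occurs in
-- the list, and no two positions hold the same permutation.

allPermutations-complete : ∀ n (π : Permutation′ n) → Any (Perm._≈ π) (allPermutations n)
allPermutations-complete zero    π = here (λ ())
allPermutations-complete (suc n) π =
  Any.concat⁺ (Any.map⁺ (Any.map block (∈-allFin (π ⟨$⟩ʳ zero))))
  where
  insert-≈ : ∀ {ρ} → ρ Perm.≈ remove zero π → insert zero (π ⟨$⟩ʳ zero) ρ Perm.≈ π
  insert-≈ {ρ} ρ≈ zero    = refl
  insert-≈ {ρ} ρ≈ (suc i) rewrite sym (insert-remove zero π (suc i)) | ρ≈ i = refl

  block : ∀ {j} → π ⟨$⟩ʳ zero ≡ j →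
          Any (Perm._≈ π) (map (insert zero j) (allPermutations n))
  block refl = Any.map⁺ (Any.map insert-≈ (allPermutations-complete n (remove zero π)))

allPermutations-unique : ∀ n → AllPairs (λ π ρ → ¬ π Perm.≈ ρ) (allPermutations n)
allPermutations-unique zero    = [] ∷ []
allPermutations-unique (suc n) = AllPairs.concat⁺
  (All.map⁺ (All.universal within (allFin (suc n))))
  (AllPairs.map⁺ (AllPairs.map across (Unique.allFin⁺ (suc n))))
  where
  within : ∀ j → AllPairs (λ π ρ → ¬ π Perm.≈ ρ) (map (insert zero j) (allPermutations n))
  within j = AllPairs.map⁺ (AllPairs.map
    (λ {π} {ρ} π≉ρ eq → π≉ρ (λ i → punchIn-injective j _ _ (eq (suc i))))
    (allPermutations-unique n))

  across : ∀ {j k} → j ≢ k →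
           All (λ π → All (λ ρ → ¬ π Perm.≈ ρ) (map (insert zero k) (allPermutations n)))
               (map (insert zero j) (allPermutations n))
  across j≢k = All.map⁺ (All.universal
    (λ π → All.map⁺ (All.universal (λ ρ eq → j≢k (eq zero)) _)) _)

-- One elementary step from A to B. Matrices are functions, so B is specified
-- entrywise; in particular permuting by the identity makes reachability insensitive
-- to replacing a matrix by a pointwise equal one.

data Transformation {n} (A B : Matrix n) : Set where
  negateRow      : ∀ i → (∀ p q → B p q ≡ (if does (p ≟ i) then - A p q else A p q)) →
                   Transformation A B
  negateColumn   : ∀ j → (∀ p q → B p q ≡ (if does (q ≟ j) then - A p q else A p q)) →
                   Transformation A B
  permuteRows    : ∀ (π : Permutation′ n) → (∀ p q → B p q ≡ A (π ⟨$⟩ʳ p) q) →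
                   Transformation A B
  permuteColumns : ∀ (π : Permutation′ n) → (∀ p q → B p q ≡ A p (π ⟨$⟩ʳ q)) →
                   Transformation A B
  transpose      : (∀ p q → B p q ≡ A q p) → Transformation A B

ObtainableFrom : Matrix n → Matrix n → Set
ObtainableFrom A B = Star Transformation B A

-- Fields are Heyting fields: there x # y holds exactly when x - y is invertible,
-- and apartness is tight, so classically this is the usual notion of field.

module _ (K : HeytingField c ℓ₁ ℓ₂) where
  open CommutativeRing
    (HeytingCommutativeRing.commutativeRing (HeytingField.heytingCommutativeRing K))
    renaming (_+_ to _+ᴷ_; _*_ to _*ᴷ_; -_ to -ᴷ_)
  open RawMonoidDefs +-rawMonoid using (sum) renaming (_×_ to _×ᴷ_)

  CharacteristicZero : Set ℓ₁
  CharacteristicZero = ∀ m → ¬ (suc m ×ᴷ 1#) ≈ 0#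

  fromℤ : ℤ → Carrier
  fromℤ (+ m)    = m ×ᴷ 1#
  fromℤ -[1+ m ] = -ᴷ (suc m ×ᴷ 1#)

  LinearlyIndependent : ∀ {m n} → (Fin m → Fin n → Carrier) → Set (c ⊔ ℓ₁)
  LinearlyIndependent {m} v =
    ∀ (a : Fin m → Carrier) →
    (∀ j → sum (λ i → a i *ᴷ v i j) ≈ 0#) → ∀ i → a i ≈ 0#

  IndependentRows : ∀ {m} → Matrix n → (Fin m → Fin n) → Set (c ⊔ ℓ₁)
  IndependentRows A s = LinearlyIndependent (λ i j → fromℤ (A (s i) j))

  -- The rank over K is k: the largest number of linearly independent rows is k.
  -- A selection with repeated rows is never independent, so injectivity of the
  -- selection need not be demanded.

  HasRank : Matrix n → ℕ → Set (c ⊔ ℓ₁)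
  HasRank {n} A k =
    (∃[ s ] IndependentRows {m = k} A s) ×
    (∀ {m} (s : Fin m → Fin n) → IndependentRows A s → m ≤ k)

{-# OPTIONS --safe #-}
module Submission where

-- Each of two columns deleted from `n - 2` independent rows costs at most one row, so the minors in
-- the two-row expansion keep `n - 4` independent rows; hence the bound `f(n-2,n-5)`. The threshold
-- 7 is forced by arithmetic: for `n = 7` the estimate is 18 · 48 = 864 against `f(7,6)` = 880, for
-- `n = 6` it is 12 · 12 = 144 against `f(6,5)` = 128. Two sign vectors that differ in `l` places up
-- to sign have inner product `n - 2l` up to sign, which determines `l` only up to exchanging `l`
-- and `n - l`. At order 5 three places cannot be told from two, at order 6 four cannot be told from
-- two. So order 5 searches when some rows differ in one place, and order 6 estimates again when all
-- rows differ in two. The permanents of `D(3,3)`, `D(4,3)`, `D(4,4)` are -2, 4, 8. As 8 exceeds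
-- `f(4,3)` but not `f(4,2)`, the bound for rank at least 3 survives at order 4, and the exception
-- disturbs the induction only at `n = 5`, `r = 3`, where the regular minors are nonsingular of
-- order 4.

-- Write f(n,r) = per D(n,r). Independence of integer rows over a field of characteristic zero is independence
-- over ℤ, so only integer linear algebra is needed. Two matrices that differ by signed row and column
-- permutations are called equivalent (≅); transposition is never needed, since D(n,r) is symmetric.
--
-- If r + 1 < n, delete a row outside some r + 1 independent rows. At most r columns are critical, in the sense
-- that removing them destroys the independence of these rows: otherwise the coefficients of the corresponding
-- relations would be r + 1 independent vectors orthogonal to a further column. Expanding along the deleted row,
-- |per A| ≤ r f(n-1,r-1) + (n-r) f(n-1,r) = f(n,r). If equality holds, some minor is equivalent to D(n-1,r), so A
-- is equivalent to D(n-1,r) with a row and a column added; as, outside a few small orders, all minors of D(n-1,r)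
-- have positive permanent, the added row and column consist of ones up to signs, which gives D(n,r).
--
-- If A is nonsingular and two of its rows agree in U and differ in W places, the Laplace expansion along these
-- two rows has U(U-1) + W(W-1) terms, each at most f(n-2,n-5). For n ≥ 7 and U, W ≥ 3 this is less than
-- f(n,n-1). Otherwise any two rows differ, up to sign, in one or two places, and then either all rows
-- differ in at most one place from one of them, giving D(n,n-1), or all differ in exactly one place from some sign
-- vector, giving D(n,n), whose permanent is smaller. Orders 5 and 6 need refinements of this argument, and for
-- orders at most 5 some cases are decided by exhaustive search.

open import Defs
import Algebra.Properties.Ring as RingProperties
import Algebra.Properties.Semiring.Mult as SemiringMult
import Algebra.Properties.Semiring.Sum as SemiringSum
import Algebra.Solver.Ring.NaturalCoefficients.Default as NaturalSolver
open import Algebra.Apartness.Bundles using (HeytingField; module HeytingCommutativeRing)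
open import Algebra.Bundles using (CommutativeRing)
open import Data.Bool.Base using (Bool; true; false; if_then_else_; _∧_; _∨_; not)
import Data.Bool.Properties as 𝔹ₚ
open import Data.Empty using (⊥; ⊥-elim)
open import Data.Fin.Base using (Fin; zero; suc; toℕ; punchIn; punchOut; fromℕ; fromℕ<)
open import Data.Fin.Permutation using (Permutation′; _⟨$⟩ʳ_; _⟨$⟩ˡ_; insert; remove; lift₀; flip; _∘ₚ_)
import Data.Fin.Permutation as Perm
open import Data.Fin.Properties using
  ( _≟_; any?; all?; pigeonhole; injective⇒≤; suc-injective; toℕ-injective; toℕ-fromℕ; toℕ-fromℕ<; toℕ<n
  ; punchIn-injective; punchInᵢ≢i; punchIn-punchOut; punchOut-injective; punchOut-punchIn; punchOut-cong )
open import Data.Integer.Base using (ℤ; -[1+_]; -_; 0ℤ; 1ℤ; -1ℤ; _+_; _*_; _-_; ∣_∣; _⊖_) renaming (_≤_ to _≤ℤ_; _<_ to _<ℤ_)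
import Data.Integer.Base as ℤ
import Data.Integer.Properties as ℤₚ
import Data.Integer.Tactic.RingSolver as ℤ-Solver
open import Data.List.Base using (List; []; _∷_; map; concat; allFin; _++_; length)
import Data.List.Base as List
import Data.List.Properties as Listₚ
open import Data.List.Relation.Unary.All using (All; []; _∷_)
open import Data.List.Relation.Unary.AllPairs using (AllPairs; []; _∷_)
open import Data.Nat.Base using (ℕ; zero; suc; _∸_; _≤_; _<_; z≤n; s≤s) renaming (_+_ to _+ℕ_; _*_ to _*ℕ_)
import Data.Nat.Base as ℕ
import Data.Nat.Properties as ℕₚ
import Data.Nat.Tactic.RingSolver as ℕ-Solver
open import Data.Product.Base using (∃; _×_; _,_; proj₁; proj₂)
open import Data.Sum.Base using (_⊎_; inj₁; inj₂; [_,_]′)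
open import Data.Unit.Base using (⊤; tt)
open import Data.Vec.Base using (Vec; []; _∷_; lookup; tabulate)
import Data.Vec.Functional as Vector
open import Data.Vec.Properties using (lookup∘tabulate; tabulate-cong)
open import Function.Base using (_∘_; id; case_of_)
open import Function.Bundles using (_⇔_; mk⇔)
open import Relation.Binary.Construct.Closure.ReflexiveTransitive using (Star; ε; _◅_; _◅◅_)
open import Relation.Binary.PropositionalEquality using
  (_≡_; _≢_; _≗_; refl; sym; trans; cong; cong₂; subst; subst₂; module ≡-Reasoning)
open import Relation.Nullary.Decidable using (Dec; yes; no; does; ¬?; _×-dec_; _⊎-dec_; map′; dec-true; dec-false)
open import Relation.Nullary.Negation using (¬_; contradiction)
open import Algebra.Properties.Semiring.Sum ℤₚ.+-*-semiring using
  (sum; sum-cong-≗; *-distribˡ-sum; *-distribʳ-sum; ∑-distrib-+; ∑-comm; sum-remove; sum-permute)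
open import Algebra.Properties.Semiring.Sum ℕₚ.+-*-semiring using () renaming (sum to sumℕ; sum-cong-≗ to sumℕ-cong)

private
  variable
    k m n r : ℕ

sum-scale : (k : ℤ) (f : Fin n → ℤ) → sum (λ j → k * f j) ≡ k * sum f
sum-scale k f = sym (*-distribˡ-sum k f)

-- Permanents by Laplace expansion

minor : Fin (suc n) → Fin (suc n) → Matrix (suc n) → Matrix n
minor i j A a b = A (punchIn i a) (punchIn j b)

infixl 10 _ᵀ
_ᵀ : Matrix n → Matrix n
(A ᵀ) i j = A j i

opaque
  -- Expansion along the first row replaces the sum over permutations, so that facts about
  -- permanents follow by induction on the order. It is opaque, and unfolded only where an expansion
  -- or a finite computation is wanted.
  per : Matrix n → ℤ
  per {zero}  A = 1ℤ
  per {suc n} A = sum (λ j → A zero j * per (minor zero j A))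

opaque
  unfolding per

  per-cong : {A B : Matrix n} → (∀ i j → A i j ≡ B i j) → per A ≡ per B
  per-cong {zero}  A≗B = refl
  per-cong {suc n} A≗B = sum-cong-≗ λ j → cong₂ _*_ (A≗B zero j) (per-cong λ a b → A≗B (suc a) (punchIn j b))

foldr-++ : ∀ xs ys → List.foldr _+_ 0ℤ (xs ++ ys) ≡ List.foldr _+_ 0ℤ xs + List.foldr _+_ 0ℤ ys
foldr-++ []       ys = sym (ℤₚ.+-identityˡ _)
foldr-++ (x ∷ xs) ys = trans (cong (x +_) (foldr-++ xs ys)) (sym (ℤₚ.+-assoc x _ _))

foldr-concat-tabulate : ∀ {a} {X : Set a} (w : X → ℤ) (f : Fin n → List X) →
  List.foldr _+_ 0ℤ (map w (concat (List.tabulate f))) ≡ sum (λ j → List.foldr _+_ 0ℤ (map w (f j)))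
foldr-concat-tabulate {zero}  w f = refl
foldr-concat-tabulate {suc n} w f = begin
  List.foldr _+_ 0ℤ (map w (f zero ++ rest))
    ≡⟨ cong (List.foldr _+_ 0ℤ) (Listₚ.map-++ w (f zero) rest) ⟩
  List.foldr _+_ 0ℤ (map w (f zero) ++ map w rest)
    ≡⟨ foldr-++ (map w (f zero)) (map w rest) ⟩
  List.foldr _+_ 0ℤ (map w (f zero)) + List.foldr _+_ 0ℤ (map w rest)
    ≡⟨ cong (List.foldr _+_ 0ℤ (map w (f zero)) +_) (foldr-concat-tabulate w (f ∘ suc)) ⟩
  sum (λ j → List.foldr _+_ 0ℤ (map w (f j))) ∎
  where
  open ≡-Reasoning
  rest = concat (List.tabulate (f ∘ suc))

foldr-map-scale : ∀ {a} {X : Set a} (k : ℤ) (v w : X → ℤ) → (∀ x → v x ≡ k * w x) → ∀ xs →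
  List.foldr _+_ 0ℤ (map v xs) ≡ k * List.foldr _+_ 0ℤ (map w xs)
foldr-map-scale k v w v≡kw []       = sym (ℤₚ.*-zeroʳ k)
foldr-map-scale k v w v≡kw (x ∷ xs) =
  trans (cong₂ _+_ (v≡kw x) (foldr-map-scale k v w v≡kw xs)) (sym (ℤₚ.*-distribˡ-+ k (w x) _))

opaque
  unfolding per

  -- `allPermutations` groups the permutations by the image `j` of the first index, so the block of
  -- `j` is the term of column `j` in the expansion.
  permanent≡per : (A : Matrix n) → permanent A ≡ per A
  permanent≡per {zero}  A = refl
  permanent≡per {suc n} A = begin
    List.foldr _+_ 0ℤ (map w (concat (map f (allFin (suc n)))))
      ≡⟨ cong (λ l → List.foldr _+_ 0ℤ (map w (concat l))) (Listₚ.map-tabulate id f) ⟩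
    List.foldr _+_ 0ℤ (map w (concat (List.tabulate f)))
      ≡⟨ foldr-concat-tabulate w f ⟩
    sum (λ j → List.foldr _+_ 0ℤ (map w (f j)))
      ≡⟨ sum-cong-≗ block ⟩
    per A ∎
    where
    open ≡-Reasoning
    w : Permutation′ (suc n) → ℤ
    w σ = Vector.foldr _*_ 1ℤ (λ i → A i (σ ⟨$⟩ʳ i))
    f : Fin (suc n) → List (Permutation′ (suc n))
    f j = map (insert zero j) (allPermutations n)
    block : ∀ j → List.foldr _+_ 0ℤ (map w (f j)) ≡ A zero j * per (minor zero j A)
    block j = begin
      List.foldr _+_ 0ℤ (map w (f j))
        ≡⟨ cong (List.foldr _+_ 0ℤ) (sym (Listₚ.map-∘ (allPermutations n))) ⟩
      List.foldr _+_ 0ℤ (map (w ∘ insert zero j) (allPermutations n))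
        ≡⟨ foldr-map-scale (A zero j) (w ∘ insert zero j) _ (λ _ → refl) (allPermutations n) ⟩
      A zero j * permanent (minor zero j A)
        ≡⟨ cong (A zero j *_) (permanent≡per (minor zero j A)) ⟩
      A zero j * per (minor zero j A) ∎

  per-permuteColumns : (A : Matrix n) (π : Permutation′ n) → per (λ i j → A i (π ⟨$⟩ʳ j)) ≡ per A
  per-permuteColumns {zero}  A π = refl
  per-permuteColumns {suc n} A π = begin
    sum (λ j → A zero (π ⟨$⟩ʳ j) * per (λ a b → A (suc a) (π ⟨$⟩ʳ punchIn j b)))
      ≡⟨ sum-cong-≗ (λ j → cong (A zero (π ⟨$⟩ʳ j) *_)
           (trans (per-cong (λ a b → cong (A (suc a)) (Perm.punchIn-permute π j b)))
                  (per-permuteColumns (minor zero (π ⟨$⟩ʳ j) A) (remove j π)))) ⟩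
    sum (λ j → A zero (π ⟨$⟩ʳ j) * per (minor zero (π ⟨$⟩ʳ j) A))
      ≡⟨ sum-permute (λ j → A zero j * per (minor zero j A)) π ⟨
    per A ∎
    where open ≡-Reasoning

  -- The corner term is common to both expansions. Expanding the other minors of the first row along
  -- their first column gives a double sum over the minors without two rows and two columns, and
  -- exchanging the summations turns it into the other expansion.
  per-firstColumn : (A : Matrix (suc n)) → per A ≡ sum (λ i → A i zero * per (minor i zero A))
  per-firstColumn {zero}  A = refl
  per-firstColumn {suc n} A = cong (A zero zero * per (minor zero zero A) +_) (begin
    sum (λ j → A zero (suc j) * per (minor zero (suc j) A))
      ≡⟨ sum-cong-≗ (λ j → trans (cong (A zero (suc j) *_) (per-firstColumn (minor zero (suc j) A)))
           (*-distribˡ-sum (A zero (suc j)) (λ i → A (suc i) zero * M i j))) ⟩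
    sum (λ j → sum (λ i → A zero (suc j) * (A (suc i) zero * M i j)))
      ≡⟨ ∑-comm (λ j i → A zero (suc j) * (A (suc i) zero * M i j)) ⟩
    sum (λ i → sum (λ j → A zero (suc j) * (A (suc i) zero * M i j)))
      ≡⟨ sum-cong-≗ (λ i → trans (sum-cong-≗ (λ j → exchange (A zero (suc j)) (A (suc i) zero) (M i j)))
           (sum-scale (A (suc i) zero) (λ j → A zero (suc j) * M i j))) ⟩
    sum (λ i → A (suc i) zero * per (minor (suc i) zero A)) ∎)
    where
    open ≡-Reasoning
    M : Fin (suc n) → Fin (suc n) → ℤ
    M i j = per (λ a b → A (suc (punchIn i a)) (suc (punchIn j b)))
    exchange : ∀ x y z → x * (y * z) ≡ y * (x * z)
    exchange = ℤ-Solver.solve-∀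

  per-transpose : (A : Matrix n) → per (A ᵀ) ≡ per A
  per-transpose {zero}  A = refl
  per-transpose {suc n} A = trans
    (sum-cong-≗ λ i → cong (A i zero *_) (per-transpose (minor i zero A)))
    (sym (per-firstColumn A))

per-permuteRows : (A : Matrix n) (π : Permutation′ n) → per (λ i j → A (π ⟨$⟩ʳ i) j) ≡ per A
per-permuteRows A π = begin
  per (λ i j → A (π ⟨$⟩ʳ i) j)   ≡⟨ per-transpose (λ i j → A (π ⟨$⟩ʳ i) j) ⟨
  per (λ i j → A (π ⟨$⟩ʳ j) i)   ≡⟨ per-permuteColumns (A ᵀ) π ⟩
  per (A ᵀ)                      ≡⟨ per-transpose A ⟩
  per A                          ∎
  where open ≡-Reasoning

opaque
  unfolding per

  per-expandRow : (A : Matrix (suc n)) (i : Fin (suc n)) → per A ≡ sum (λ j → A i j * per (minor i j A))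
  -- This permutation brings row `i` to the front and keeps the order of the other rows, so the
  -- expansion of the permuted matrix along its first row is definitionally the claimed sum.
  per-expandRow A i = sym (per-permuteRows A (insert zero i Perm.id))

-- Linear independence over ℤ

Rows : ℕ → ℕ → Set
Rows m n = Fin m → Fin n → ℤ

combination : (Fin m → ℤ) → Rows m n → Fin n → ℤ
combination a v j = sum (λ i → a i * v i j)

Independent : Rows m n → Set
Independent v = ∀ a → (∀ j → combination a v j ≡ 0ℤ) → ∀ i → a i ≡ 0ℤ

Relation : Rows m n → Set
Relation {m} v = ∃ λ (a : Fin m → ℤ) → (∃ λ i → a i ≢ 0ℤ) × (∀ j → combination a v j ≡ 0ℤ)

sum-zero : (f : Fin n → ℤ) → (∀ i → f i ≡ 0ℤ) → sum f ≡ 0ℤ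
sum-zero {zero}  f f≡0 = refl
sum-zero {suc n} f f≡0 = cong₂ _+_ (f≡0 zero) (sum-zero (f ∘ suc) (f≡0 ∘ suc))

sum-single : (f : Fin n → ℤ) (i : Fin n) → (∀ j → j ≢ i → f j ≡ 0ℤ) → sum f ≡ f i
sum-single {suc n} f i f≡0 = begin
  sum f                                 ≡⟨ sum-remove {i = i} f ⟩
  f i + sum (λ j → f (punchIn i j))     ≡⟨ cong (f i +_) (sum-zero (λ j → f (punchIn i j)) (λ j → f≡0 _ (punchInᵢ≢i i j))) ⟩
  f i + 0ℤ                              ≡⟨ ℤₚ.+-identityʳ (f i) ⟩
  f i                                   ∎
  where open ≡-Reasoning

*-nonzero : (x y : ℤ) → x * y ≡ 0ℤ → x ≢ 0ℤ → y ≡ 0ℤ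
*-nonzero x y xy≡0 x≢0 with ℤₚ.i*j≡0⇒i≡0∨j≡0 x xy≡0
... | inj₁ x≡0 = contradiction x≡0 x≢0
... | inj₂ y≡0 = y≡0

-- One step of fraction-free elimination, with pivot in row 0 and column j.

reduce : Fin n → Rows (suc m) n → Rows m n
reduce j v i k = v zero j * v (suc i) k - v (suc i) j * v zero k

lift-combination : Fin n → Rows (suc m) n → (Fin m → ℤ) → Fin (suc m) → ℤ
lift-combination j v b zero    = - combination b (v ∘ suc) j
lift-combination j v b (suc i) = v zero j * b i

combination-tail-scale : (x : ℤ) (b : Fin m → ℤ) (v : Rows m n) (k : Fin n) →
  combination (λ i → x * b i) v k ≡ x * combination b v k
combination-tail-scale x b v k = trans
  (sum-cong-≗ λ i → ℤₚ.*-assoc x (b i) (v i k))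
  (sum-scale x (λ i → b i * v i k))

combination-reduce : (j : Fin n) (v : Rows (suc m) n) (b : Fin m → ℤ) (k : Fin n) →
  combination b (reduce j v) k ≡ v zero j * combination b (v ∘ suc) k - combination b (v ∘ suc) j * v zero k
combination-reduce {m = zero}  j v b k = ring (v zero j) (v zero k)
  where
  ring : ∀ x y → 0ℤ ≡ x * 0ℤ - 0ℤ * y
  ring = ℤ-Solver.solve-∀
combination-reduce {m = suc m} j v b k = trans
  (cong (b zero * reduce j v zero k +_) (combination-reduce j w (b ∘ suc) k))
  (ring (b zero) (v zero j) (v (suc zero) k) (v (suc zero) j) (v zero k)
        (combination (b ∘ suc) (w ∘ suc) k) (combination (b ∘ suc) (w ∘ suc) j))
  where
  -- The induction removes the row just below the pivot row and keeps the pivot row.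
  w : Rows (suc m) _
  w zero    = v zero
  w (suc i) = v (suc (suc i))
  ring : ∀ b x p q y s t → b * (x * p - q * y) + (x * s - t * y) ≡ x * (b * p + s) - (b * q + t) * y
  ring = ℤ-Solver.solve-∀

combination-lift : (j : Fin n) (v : Rows (suc m) n) (b : Fin m → ℤ) (k : Fin n) →
  combination (lift-combination j v b) v k ≡ combination b (reduce j v) k
combination-lift j v b k = begin
  - cj * v zero k + combination (λ i → v zero j * b i) (v ∘ suc) k
    ≡⟨ cong (- cj * v zero k +_) (combination-tail-scale (v zero j) b (v ∘ suc) k) ⟩
  - cj * v zero k + v zero j * combination b (v ∘ suc) k
    ≡⟨ ring cj (v zero k) (v zero j) (combination b (v ∘ suc) k) ⟩
  v zero j * combination b (v ∘ suc) k - cj * v zero k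
    ≡⟨ combination-reduce j v b k ⟨
  combination b (reduce j v) k ∎
  where
  open ≡-Reasoning
  cj = combination b (v ∘ suc) j
  ring : ∀ c y x s → - c * y + x * s ≡ x * s - c * y
  ring = ℤ-Solver.solve-∀

reduce-independent : (j : Fin n) (v : Rows (suc m) n) → v zero j ≢ 0ℤ → Independent v → Independent (reduce j v)
reduce-independent j v v≢0 ind b b·≡0 i =
  *-nonzero (v zero j) (b i) (ind (lift-combination j v b) (λ k → trans (combination-lift j v b k) (b·≡0 k)) (suc i)) v≢0

reduce-independent⁻¹ : (j : Fin n) (v : Rows (suc m) n) → v zero j ≢ 0ℤ → Independent (reduce j v) → Independent v
reduce-independent⁻¹ {m = m} j v v≢0 ind a a·≡0 = λ where
    zero    → *-nonzero (v zero j) (a zero) (trans (ℤₚ.*-comm (v zero j) (a zero)) a₀v≡0) v≢0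
    (suc i) → tail≡0 i
  where
  b = a ∘ suc
  ring : ∀ x y s t p → p * y + s ≡ 0ℤ → p * x + t ≡ 0ℤ → x * s - t * y ≡ 0ℤ
  ring x y s t p e₁ e₂ = trans (identity x y s t p) (trans (cong₂ (λ u w → x * u - w * y) e₁ e₂) (zeros x y))
    where
    identity : ∀ x y s t p → x * s - t * y ≡ x * (p * y + s) - (p * x + t) * y
    identity = ℤ-Solver.solve-∀
    zeros : ∀ x y → x * 0ℤ - 0ℤ * y ≡ 0ℤ
    zeros = ℤ-Solver.solve-∀
  tail≡0 : ∀ i → b i ≡ 0ℤ
  tail≡0 = ind b λ k → trans (combination-reduce j v b k)
    (ring (v zero j) (v zero k) (combination b (v ∘ suc) k) (combination b (v ∘ suc) j) (a zero) (a·≡0 k) (a·≡0 j))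
  a₀v≡0 : a zero * v zero j ≡ 0ℤ
  a₀v≡0 = begin
    a zero * v zero j
      ≡⟨ ℤₚ.+-identityʳ _ ⟨
    a zero * v zero j + 0ℤ
      ≡⟨ cong (a zero * v zero j +_) (sym (sum-zero (λ i → b i * v (suc i) j)
           (λ i → trans (cong (_* v (suc i) j) (tail≡0 i)) (ℤₚ.*-zeroˡ (v (suc i) j))))) ⟩
    combination a v j
      ≡⟨ a·≡0 j ⟩
    0ℤ ∎
    where open ≡-Reasoning

basisVector : Fin (suc m) → ℤ
basisVector zero    = 1ℤ
basisVector (suc _) = 0ℤ

combination-basisVector : (v : Rows (suc m) n) (j : Fin n) → combination basisVector v j ≡ v zero j
combination-basisVector v j = trans
  (cong₂ _+_ (ℤₚ.*-identityˡ (v zero j)) (sum-zero (λ i → 0ℤ * v (suc i) j) (λ i → ℤₚ.*-zeroˡ (v (suc i) j))))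
  (ℤₚ.+-identityʳ (v zero j))

pivot? : (v : Rows (suc m) n) → Dec (∃ λ j → v zero j ≢ 0ℤ)
pivot? v = any? (λ j → ¬? (v zero j ℤₚ.≟ 0ℤ))

noPivot : (v : Rows (suc m) n) → ¬ (∃ λ j → v zero j ≢ 0ℤ) → ∀ j → v zero j ≡ 0ℤ
noPivot v none j with v zero j ℤₚ.≟ 0ℤ
... | yes v≡0 = v≡0
... | no  v≢0 = contradiction (j , v≢0) none

-- Elimination either finds a pivot for every row or meets a zero row, whose relation is carried
-- back to the original rows. This makes independence decidable, hence also available to the
-- searches.
independent⊎relation : (v : Rows m n) → Independent v ⊎ Relation v
independent⊎relation {zero}  v = inj₁ (λ _ _ ())
independent⊎relation {suc m} v with pivot? v
... | no none = inj₂ (basisVector , (zero , λ ()) , λ j → trans (combination-basisVector v j) (noPivot v none j))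
... | yes (j , v≢0) with independent⊎relation (reduce j v)
...   | inj₁ ind = inj₁ (reduce-independent⁻¹ j v v≢0 ind)
...   | inj₂ (b , (i , b≢0) , b·≡0) = inj₂ (lift-combination j v b ,
          (suc i , λ xb≡0 → b≢0 (*-nonzero (v zero j) (b i) xb≡0 v≢0)) ,
          λ k → trans (combination-lift j v b k) (b·≡0 k))

independent? : (v : Rows m n) → Dec (Independent v)
independent? v with independent⊎relation v
... | inj₁ ind                   = yes ind
... | inj₂ (a , (i , a≢0) , a·≡0) = no λ ind → a≢0 (ind a a·≡0 i)

dependent⇒relation : (v : Rows m n) → ¬ Independent v → Relation v
dependent⇒relation v dep with independent⊎relation v
... | inj₁ ind = contradiction ind dep
... | inj₂ rel = rel

pivot : (v : Rows (suc m) n) → Independent v → ∃ λ j → v zero j ≢ 0ℤ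
pivot v ind with pivot? v
... | yes p   = p
... | no none = contradiction (ind basisVector (λ j → trans (combination-basisVector v j) (noPivot v none j)) zero) λ ()

independent-cong : {v w : Rows m n} → (∀ i j → v i j ≡ w i j) → Independent v → Independent w
independent-cong v≗w ind a a·w≡0 = ind a λ j → trans (sum-cong-≗ λ i → cong (a i *_) (v≗w i j)) (a·w≡0 j)

dropColumn : Fin (suc n) → Rows m (suc n) → Rows m n
dropColumn j v i k = v i (punchIn j k)

dropColumn-independent⁻¹ : (j : Fin (suc n)) (v : Rows m (suc n)) → Independent (dropColumn j v) → Independent v
dropColumn-independent⁻¹ j v ind a a·≡0 = ind a λ k → a·≡0 (punchIn j k)

off-or-at : {P : Fin (suc n) → Set} (j : Fin (suc n)) → P j → (∀ k → P (punchIn j k)) → ∀ k → P k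
off-or-at {P = P} j at off k with j ≟ k
... | yes refl = at
... | no  j≢k  = subst P (punchIn-punchOut j≢k) (off (punchOut j≢k))

independent⇒≤ : (v : Rows m n) → Independent v → m ≤ n
independent⇒≤ {zero}              v ind = z≤n
independent⇒≤ {suc m} {zero}      v ind = case proj₁ (pivot v ind) of λ ()
independent⇒≤ {suc m} {n = suc n} v ind with pivot v ind
... | j , v≢0 = s≤s (independent⇒≤ (dropColumn j (reduce j v)) λ a a·≡0 →
        reduce-independent j v v≢0 ind a
          (off-or-at {P = λ k → combination a (reduce j v) k ≡ 0ℤ} j
            (sum-zero (λ i → a i * reduce j v i j) λ i → ring (a i) (v zero j) (v (suc i) j)) a·≡0))
  where
  ring : ∀ a x y → a * (x * y - y * x) ≡ 0ℤ
  ring = ℤ-Solver.solve-∀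

extendByZero : Fin (suc m) → (Fin m → ℤ) → Fin (suc m) → ℤ
extendByZero i a k with i ≟ k
... | yes _   = 0ℤ
... | no  i≢k = a (punchOut i≢k)

extendByZero-at : (i : Fin (suc m)) (a : Fin m → ℤ) → extendByZero i a i ≡ 0ℤ
extendByZero-at i a with i ≟ i
... | yes _   = refl
... | no  i≢i = contradiction refl i≢i

extendByZero-off : (i : Fin (suc m)) (a : Fin m → ℤ) (k : Fin m) → extendByZero i a (punchIn i k) ≡ a k
extendByZero-off i a k with i ≟ punchIn i k
... | yes i≡  = contradiction (sym i≡) (punchInᵢ≢i i k)
... | no  i≢  = cong a (trans (punchOut-cong i refl) (punchOut-punchIn i))

combination-extendByZero : (i : Fin (suc m)) (a : Fin m → ℤ) (v : Rows (suc m) n) (j : Fin n) →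
  combination (extendByZero i a) v j ≡ combination a (v ∘ punchIn i) j
combination-extendByZero i a v j = begin
  combination (extendByZero i a) v j
    ≡⟨ sum-remove {i = i} (λ k → extendByZero i a k * v k j) ⟩
  extendByZero i a i * v i j + sum (λ k → extendByZero i a (punchIn i k) * v (punchIn i k) j)
    ≡⟨ cong₂ _+_ (trans (cong (_* v i j) (extendByZero-at i a)) (ℤₚ.*-zeroˡ (v i j)))
         (sum-cong-≗ λ k → cong (_* v (punchIn i k) j) (extendByZero-off i a k)) ⟩
  0ℤ + combination a (v ∘ punchIn i) j
    ≡⟨ ℤₚ.+-identityˡ (combination a (v ∘ punchIn i) j) ⟩
  combination a (v ∘ punchIn i) j ∎
  where open ≡-Reasoning

dropRow-independent : (i : Fin (suc m)) (v : Rows (suc m) n) → Independent v → Independent (v ∘ punchIn i)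
dropRow-independent i v ind a a·≡0 k = trans (sym (extendByZero-off i a k))
  (ind (extendByZero i a) (λ j → trans (combination-extendByZero i a v j) (a·≡0 j)) (punchIn i k))

-- For independent rows this says that `j` is a coloop of the matroid of the columns: some multiple
-- of the unit vector at `j` lies in the row space.
Coloop : Fin (suc n) → Rows m (suc n) → Set
Coloop {n} {m} j v = ∃ λ (a : Fin m → ℤ) → (combination a v j ≢ 0ℤ) × (∀ k → combination a v (punchIn j k) ≡ 0ℤ)

coloop : (j : Fin (suc n)) (v : Rows m (suc n)) → Independent v → ¬ Independent (dropColumn j v) → Coloop j v
coloop j v ind dep with dependent⇒relation (dropColumn j v) dep
... | a , (i , a≢0) , a·≡0 = a , (λ at≡0 → a≢0 (ind a (off-or-at {P = λ k → combination a v k ≡ 0ℤ} j at≡0 a·≡0) i)) , a·≡0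

combination-scale-sub : (x y : ℤ) (a b : Fin m → ℤ) (v : Rows m n) (j : Fin n) →
  combination (λ i → x * b i - y * a i) v j ≡ x * combination b v j - y * combination a v j
combination-scale-sub {zero}  x y a b v j = ring x y
  where
  ring : ∀ x y → 0ℤ ≡ x * 0ℤ - y * 0ℤ
  ring = ℤ-Solver.solve-∀
combination-scale-sub {suc m} x y a b v j = trans
  (cong ((x * b zero - y * a zero) * v zero j +_) (combination-scale-sub x y (a ∘ suc) (b ∘ suc) (v ∘ suc) j))
  (ring x y (a zero) (b zero) (v zero j) (combination (b ∘ suc) (v ∘ suc) j) (combination (a ∘ suc) (v ∘ suc) j))
  where
  ring : ∀ x y a b v s t → (x * b - y * a) * v + (x * s - y * t) ≡ x * (b * v + s) - y * (a * v + t)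
  ring = ℤ-Solver.solve-∀

-- If dropping column `j` creates a relation `a`, any row `i` with nonzero coefficient in `a` can be
-- removed. Given a relation `b` of the other rows without column `j`, the combination of `b` and
-- `a` that also vanishes at `j` must be zero; its coefficient at `i` shows that `b` itself vanishes
-- at `j`, so `b` is a relation of the full rows.
dropColumn-dropRow : (j : Fin (suc n)) (v : Rows (suc m) (suc n)) → Independent v →
  ∃ λ i → Independent (dropColumn j (v ∘ punchIn i))
dropColumn-dropRow {m = m} j v ind with independent? (dropColumn j v)
... | yes ind′ = zero , dropRow-independent zero (dropColumn j v) ind′
... | no  dep with dependent⇒relation (dropColumn j v) dep
...   | a , (i , a≢0) , a·≡0 = i , λ b b·≡0 k → let
          b⁺ = extendByZero i b
          b⁺· : ∀ l → combination b⁺ v l ≡ combination b (v ∘ punchIn i) l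
          b⁺· l = combination-extendByZero i b v l
          d = combination a v j
          d′ = combination b⁺ v j
          c : Fin (suc m) → ℤ
          c l = d * b⁺ l - d′ * a l
          c·≡0 : ∀ l → combination c v l ≡ 0ℤ
          c·≡0 = off-or-at {P = λ l → combination c v l ≡ 0ℤ} j
            (trans (combination-scale-sub d d′ a b⁺ v j) (cancel d d′))
            (λ l → trans (combination-scale-sub d d′ a b⁺ v (punchIn j l))
              (trans (cong₂ (λ s t → d * s - d′ * t) (trans (b⁺· (punchIn j l)) (b·≡0 l)) (a·≡0 l)) (zeros d d′)))
          c≡0 = ind c c·≡0
          d′a≡0 : d′ * a i ≡ 0ℤ
          d′a≡0 = trans (at-i d d′ (a i)) (cong -_ (trans (cong (λ s → d * s - d′ * a i) (sym (extendByZero-at i b))) (c≡0 i)))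
          d′≡0 = *-nonzero (a i) d′ (trans (ℤₚ.*-comm (a i) d′) d′a≡0) a≢0
          in dropRow-independent i v ind b
               (λ l → trans (sym (b⁺· l)) (off-or-at {P = λ l → combination b⁺ v l ≡ 0ℤ} j d′≡0
                  (λ l → trans (b⁺· (punchIn j l)) (b·≡0 l)) l)) k
  where
  cancel : ∀ x y → x * y - y * x ≡ 0ℤ
  cancel = ℤ-Solver.solve-∀
  zeros : ∀ x y → x * 0ℤ - y * 0ℤ ≡ 0ℤ
  zeros = ℤ-Solver.solve-∀
  at-i : ∀ d e x → e * x ≡ - (d * 0ℤ - e * x)
  at-i = ℤ-Solver.solve-∀

combination-assoc : (b : Fin k → ℤ) (a : Rows k m) (v : Rows m n) (j : Fin n) →
  combination (combination b a) v j ≡ sum (λ l → b l * combination (a l) v j)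
combination-assoc b a v j = begin
  sum (λ i → sum (λ l → b l * a l i) * v i j)
    ≡⟨ sum-cong-≗ (λ i → *-distribʳ-sum (v i j) (λ l → b l * a l i)) ⟩
  sum (λ i → sum (λ l → b l * a l i * v i j))
    ≡⟨ ∑-comm (λ i l → b l * a l i * v i j) ⟩
  sum (λ l → sum (λ i → b l * a l i * v i j))
    ≡⟨ sum-cong-≗ (λ l → trans (sum-cong-≗ (λ i → ℤₚ.*-assoc (b l) (a l i) (v i j)))
         (sum-scale (b l) (λ i → a l i * v i j))) ⟩
  sum (λ l → b l * combination (a l) v j) ∎
  where open ≡-Reasoning

-- If m rows had m coloops, then the coefficient vectors of the coloops would be independent,
-- and orthogonal to the column c, hence determined by m - 1 of their coordinates.

coloops-few : (v : Rows (suc m) (suc n)) → Independent v → (t : Fin (suc m) → Fin (suc n)) →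
  (∀ {k l} → t k ≡ t l → k ≡ l) → (∀ k → Coloop (t k) v) →
  (c : Fin (suc n)) → (∀ k → t k ≢ c) → v zero c ≢ 0ℤ → ⊥
coloops-few {m} v ind t t-inj cl c t≢c v≢0 = ℕₚ.1+n≰n (independent⇒≤ (λ k i → a k (suc i)) indₐ)
  where
  a : Rows (suc m) (suc m)
  a k = proj₁ (cl k)
  a·off : ∀ k j → t k ≢ j → combination (a k) v j ≡ 0ℤ
  a·off k j t≢j = subst (λ l → combination (a k) v l ≡ 0ℤ) (punchIn-punchOut t≢j) (proj₂ (proj₂ (cl k)) (punchOut t≢j))
  indₐ : Independent (λ k i → a k (suc i))
  indₐ b b·≡0 k = *-nonzero (combination (a k) v (t k)) (b k)
    (trans (ℤₚ.*-comm (combination (a k) v (t k)) (b k)) bd≡0) (proj₁ (proj₂ (cl k)))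
    where
    g = combination b a
    g₀v≡0 : g zero * v zero c ≡ 0ℤ
    g₀v≡0 = trans (sym (sum-single (λ i → g i * v i c) zero λ where
        zero    i≢0 → contradiction refl i≢0
        (suc i) _   → trans (cong (_* v (suc i) c) (b·≡0 i)) (ℤₚ.*-zeroˡ (v (suc i) c))))
      (trans (combination-assoc b a v c)
        (sum-zero (λ l → b l * combination (a l) v c) λ l → trans (cong (b l *_) (a·off l c (t≢c l))) (ℤₚ.*-zeroʳ (b l))))
    g≡0 : ∀ i → g i ≡ 0ℤ
    g≡0 zero    = *-nonzero (v zero c) (g zero) (trans (ℤₚ.*-comm (v zero c) (g zero)) g₀v≡0) v≢0
    g≡0 (suc i) = b·≡0 i
    bd≡0 : b k * combination (a k) v (t k) ≡ 0ℤ
    bd≡0 = trans (sym (sum-single (λ l → b l * combination (a l) v (t k)) k λ l l≢k →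
        trans (cong (b l *_) (a·off l (t k) (λ e → l≢k (t-inj e)))) (ℤₚ.*-zeroʳ (b l))))
      (trans (sym (combination-assoc b a v (t k)))
        (sum-zero (λ i → g i * v i (t k)) λ i → trans (cong (_* v i (t k)) (g≡0 i)) (ℤₚ.*-zeroˡ (v i (t k)))))

-- Independence over ℤ and over a field of characteristic zero

module _ {c ℓ₁ ℓ₂} (K : HeytingField c ℓ₁ ℓ₂) (char0 : CharacteristicZero K) where
  private
    R : CommutativeRing c ℓ₁
    R = HeytingCommutativeRing.commutativeRing (HeytingField.heytingCommutativeRing K)
    module F = HeytingField K
  open CommutativeRing R using (Carrier; _≈_; 0#; 1#; rawRing)
    renaming (_+_ to _⊕_; _*_ to _⊗_; -_ to ⊖_; _-_ to _⊝_; refl to ≈-refl; sym to ≈-sym; trans to ≈-trans; reflexive to ≈-reflexive; setoid to ≈-setoid)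
  private
    module CR = CommutativeRing R
    module RP = RingProperties CR.ring
    module M = SemiringMult CR.semiring
    module S = SemiringSum CR.semiring
    open import Relation.Binary.Reasoning.Setoid ≈-setoid
    open NaturalSolver CR.commutativeSemiring using (solve; _:+_; _:*_; _:=_)

    φ : ℤ → Carrier
    φ = fromℤ K

  fromℤ-⊖ : ∀ m n → φ (m ⊖ n) ≈ (m M.× 1#) ⊕ (⊖ (n M.× 1#))
  fromℤ-⊖ m       zero    = ≈-sym (≈-trans (CR.+-congˡ RP.-0#≈0#) (CR.+-identityʳ _))
  fromℤ-⊖ zero    (suc n) = ≈-sym (CR.+-identityˡ _)
  fromℤ-⊖ (suc m) (suc n) = begin
    φ (suc m ⊖ suc n)                            ≡⟨ cong φ (ℤₚ.[1+m]⊖[1+n]≡m⊖n m n) ⟩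
    φ (m ⊖ n)                                    ≈⟨ fromℤ-⊖ m n ⟩
    (m M.× 1#) ⊕ (⊖ (n M.× 1#))                  ≈⟨ shift (m M.× 1#) (n M.× 1#) 1# ⟩
    (1# ⊕ m M.× 1#) ⊕ (⊖ (1# ⊕ n M.× 1#))        ∎
    where
    shift : ∀ x y z → x ⊕ (⊖ y) ≈ (z ⊕ x) ⊕ (⊖ (z ⊕ y))
    shift x y z = begin
      x ⊕ (⊖ y)                       ≈⟨ CR.+-identityʳ _ ⟨
      (x ⊕ (⊖ y)) ⊕ 0#                ≈⟨ CR.+-congˡ (CR.-‿inverseʳ z) ⟨
      (x ⊕ (⊖ y)) ⊕ (z ⊕ (⊖ z))       ≈⟨ solve 4 (λ x y z w → (x :+ y) :+ (z :+ w) := (z :+ x) :+ (w :+ y)) ≈-refl x (⊖ y) z (⊖ z) ⟩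
      (z ⊕ x) ⊕ ((⊖ z) ⊕ (⊖ y))       ≈⟨ CR.+-congˡ (RP.-‿+-comm z y) ⟩
      (z ⊕ x) ⊕ (⊖ (z ⊕ y))           ∎

  fromℤ-+ : ∀ x y → φ (x + y) ≈ φ x ⊕ φ y
  fromℤ-+ (ℤ.+ m)    (ℤ.+ n)    = M.×-homo-+ 1# m n
  fromℤ-+ (ℤ.+ m)    -[1+ n ]   = fromℤ-⊖ m (suc n)
  fromℤ-+ -[1+ m ]   (ℤ.+ n)    = ≈-trans (fromℤ-⊖ n (suc m)) (CR.+-comm _ _)
  fromℤ-+ -[1+ m ]   -[1+ n ]   = begin
    ⊖ ((suc (suc (m +ℕ n))) M.× 1#)              ≡⟨ cong (λ l → ⊖ (suc l M.× 1#)) (sym (ℕₚ.+-suc m n)) ⟩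
    ⊖ ((suc m +ℕ suc n) M.× 1#)                  ≈⟨ CR.-‿cong (M.×-homo-+ 1# (suc m) (suc n)) ⟩
    ⊖ ((suc m M.× 1#) ⊕ (suc n M.× 1#))          ≈⟨ RP.-‿+-comm (suc m M.× 1#) (suc n M.× 1#) ⟨
    (⊖ (suc m M.× 1#)) ⊕ (⊖ (suc n M.× 1#))      ∎

  fromℤ-neg : ∀ x → φ (- x) ≈ ⊖ (φ x)
  fromℤ-neg (ℤ.+ zero)  = ≈-sym RP.-0#≈0#
  fromℤ-neg (ℤ.+ suc n) = ≈-refl
  fromℤ-neg -[1+ n ]    = ≈-sym (RP.-‿involutive (suc n M.× 1#))

  fromℤ-pos* : ∀ m x → φ (ℤ.+ m * x) ≈ (m M.× 1#) ⊗ φ x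
  fromℤ-pos* zero    x = begin
    φ (0ℤ * x)    ≡⟨ cong φ (ℤₚ.*-zeroˡ x) ⟩
    0#            ≈⟨ CR.zeroˡ (φ x) ⟨
    0# ⊗ φ x      ∎
  fromℤ-pos* (suc m) x = begin
    φ (ℤ.+ suc m * x)                  ≡⟨ cong φ (ℤₚ.suc-* (ℤ.+ m) x) ⟩
    φ (x + ℤ.+ m * x)                  ≈⟨ fromℤ-+ x (ℤ.+ m * x) ⟩
    φ x ⊕ φ (ℤ.+ m * x)                ≈⟨ CR.+-cong (≈-sym (CR.*-identityˡ (φ x))) (fromℤ-pos* m x) ⟩
    (1# ⊗ φ x) ⊕ ((m M.× 1#) ⊗ φ x)    ≈⟨ CR.distribʳ (φ x) 1# (m M.× 1#) ⟨
    (suc m M.× 1#) ⊗ φ x               ∎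

  fromℤ-* : ∀ x y → φ (x * y) ≈ φ x ⊗ φ y
  fromℤ-* (ℤ.+ m)  y = fromℤ-pos* m y
  fromℤ-* -[1+ m ] y = begin
    φ (-[1+ m ] * y)                ≡⟨ cong φ (sym (ℤₚ.neg-distribˡ-* (ℤ.+ suc m) y)) ⟩
    φ (- (ℤ.+ suc m * y))           ≈⟨ fromℤ-neg (ℤ.+ suc m * y) ⟩
    ⊖ φ (ℤ.+ suc m * y)             ≈⟨ CR.-‿cong (fromℤ-pos* (suc m) y) ⟩
    ⊖ ((suc m M.× 1#) ⊗ φ y)        ≈⟨ RP.-‿distribˡ-* (suc m M.× 1#) (φ y) ⟩
    (⊖ (suc m M.× 1#)) ⊗ φ y        ∎

  fromℤ-nonzero : ∀ x → φ x ≈ 0# → x ≡ 0ℤ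
  fromℤ-nonzero (ℤ.+ zero)  _   = refl
  fromℤ-nonzero (ℤ.+ suc m) φ≈0 = contradiction φ≈0 (char0 m)
  fromℤ-nonzero -[1+ m ]    φ≈0 = contradiction
    (≈-trans (≈-sym (RP.-‿involutive (suc m M.× 1#))) (≈-trans (CR.-‿cong φ≈0) RP.-0#≈0#)) (char0 m)

  -- Equality in a Heyting field need not be decidable. Tightness reduces the claim to refuting
  -- `y # 0#`, and then `y` has an inverse.
  cancel-fromℤ : ∀ x y → x ≢ 0ℤ → φ x ⊗ y ≈ 0# → y ≈ 0#
  cancel-fromℤ x y x≢0 xy≈0 = proj₁ (F.tight y 0#) λ y#0 →
    let (y⁻¹ , _ , yy⁻¹≈1) = F.#⇒invertible y#0 in
    x≢0 (fromℤ-nonzero x (begin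
      φ x                                 ≈⟨ CR.*-identityʳ (φ x) ⟨
      φ x ⊗ 1#                            ≈⟨ CR.*-congˡ yy⁻¹≈1 ⟨
      φ x ⊗ ((y ⊝ 0#) ⊗ y⁻¹)              ≈⟨ CR.*-congˡ (CR.*-congʳ (≈-trans (CR.+-congˡ RP.-0#≈0#) (CR.+-identityʳ y))) ⟩
      φ x ⊗ (y ⊗ y⁻¹)                     ≈⟨ CR.*-assoc (φ x) y y⁻¹ ⟨
      (φ x ⊗ y) ⊗ y⁻¹                     ≈⟨ CR.*-congʳ xy≈0 ⟩
      0# ⊗ y⁻¹                            ≈⟨ CR.zeroˡ y⁻¹ ⟩
      0#                                  ∎))

  IndependentOver : ∀ {m n} → Rows m n → Set _
  IndependentOver v = LinearlyIndependent K (λ i j → fromℤ K (v i j))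

  fromℤ-sum : ∀ {m} (f : Fin m → ℤ) → φ (sum f) ≈ S.sum (φ ∘ f)
  fromℤ-sum {zero}  f = ≈-refl
  fromℤ-sum {suc m} f = ≈-trans (fromℤ-+ (f zero) (sum (f ∘ suc))) (CR.+-congˡ (fromℤ-sum (f ∘ suc)))

  independentOver⇒independent : ∀ {m n} (v : Rows m n) → IndependentOver v → Independent v
  independentOver⇒independent v ind a a·≡0 i = fromℤ-nonzero (a i) (ind (φ ∘ a) (λ j → begin
      S.sum (λ i → φ (a i) ⊗ φ (v i j))   ≈⟨ S.sum-cong-≋ (λ i → ≈-sym (fromℤ-* (a i) (v i j))) ⟩
      S.sum (λ i → φ (a i * v i j))       ≈⟨ fromℤ-sum (λ i → a i * v i j) ⟨
      φ (combination a v j)               ≡⟨ cong φ (a·≡0 j) ⟩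
      0#                                  ∎) i)

  private
    combinationᴷ : ∀ {m n} → (Fin m → Carrier) → Rows m n → Fin n → Carrier
    combinationᴷ a v j = S.sum (λ i → a i ⊗ φ (v i j))

    -- The subtracted product stands on the other side, so that the remaining calculations are
    -- identities of commutative semirings.
    fromℤ-reduce : ∀ x p q y → φ (x * p - q * y) ⊕ (φ q ⊗ φ y) ≈ φ x ⊗ φ p
    fromℤ-reduce x p q y = begin
      φ (x * p - q * y) ⊕ (φ q ⊗ φ y)    ≈⟨ CR.+-congˡ (fromℤ-* q y) ⟨
      φ (x * p - q * y) ⊕ φ (q * y)      ≈⟨ fromℤ-+ (x * p - q * y) (q * y) ⟨
      φ (x * p - q * y + q * y)          ≡⟨ cong φ (ring (x * p) (q * y)) ⟩
      φ (x * p)                          ≈⟨ fromℤ-* x p ⟩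
      φ x ⊗ φ p                          ∎
      where
      ring : ∀ u w → u - w + w ≡ u
      ring = ℤ-Solver.solve-∀

    combinationᴷ-reduce : ∀ {m n} (j : Fin n) (v : Rows (suc m) n) (b : Fin m → Carrier) (k : Fin n) →
      combinationᴷ b (reduce j v) k ⊕ (combinationᴷ b (v ∘ suc) j ⊗ φ (v zero k)) ≈ φ (v zero j) ⊗ combinationᴷ b (v ∘ suc) k
    combinationᴷ-reduce {zero}  j v b k =
      ≈-trans (CR.+-identityˡ _) (≈-trans (CR.zeroˡ (φ (v zero k))) (≈-sym (CR.zeroʳ (φ (v zero j)))))
    combinationᴷ-reduce {suc m} j v b k = begin
      ((b zero ⊗ e) ⊕ S) ⊕ (((b zero ⊗ φ q) ⊕ t) ⊗ φ y)
        ≈⟨ solve 6 (λ b r S q t y → ((b :* r) :+ S) :+ (((b :* q) :+ t) :* y) := (b :* (r :+ (q :* y))) :+ (S :+ (t :* y)))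
             ≈-refl (b zero) e S (φ q) t (φ y) ⟩
      (b zero ⊗ (e ⊕ (φ q ⊗ φ y))) ⊕ (S ⊕ (t ⊗ φ y))
        ≈⟨ CR.+-cong (CR.*-congˡ (fromℤ-reduce x p q y)) (combinationᴷ-reduce j w (b ∘ suc) k) ⟩
      (b zero ⊗ (φ x ⊗ φ p)) ⊕ (φ x ⊗ s)
        ≈⟨ solve 4 (λ b x p s → (b :* (x :* p)) :+ (x :* s) := x :* ((b :* p) :+ s)) ≈-refl (b zero) (φ x) (φ p) s ⟩
      φ x ⊗ ((b zero ⊗ φ p) ⊕ s) ∎
      where
      w : Rows (suc m) _
      w zero    = v zero
      w (suc i) = v (suc (suc i))
      x = v zero j
      p = v (suc zero) k
      q = v (suc zero) j
      y = v zero k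
      e = φ (x * p - q * y)
      S = combinationᴷ (b ∘ suc) (reduce j w) k
      s = combinationᴷ (b ∘ suc) (w ∘ suc) k
      t = combinationᴷ (b ∘ suc) (w ∘ suc) j

    sum-zeroᴷ : ∀ {m} (f : Fin m → Carrier) → (∀ i → f i ≈ 0#) → S.sum f ≈ 0#
    sum-zeroᴷ {zero}  f f≈0 = ≈-refl
    sum-zeroᴷ {suc m} f f≈0 = ≈-trans (CR.+-cong (f≈0 zero) (sum-zeroᴷ (f ∘ suc) (f≈0 ∘ suc))) (CR.+-identityˡ 0#)

  -- The same elimination, now with coefficients in the field. All pivots are nonzero integers,
  -- hence cancellable in characteristic zero, so no case distinction on field elements is made.
  independent⇒independentOver : ∀ {m n} (v : Rows m n) → Independent v → IndependentOver v
  independent⇒independentOver {zero}  v ind a _ ()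
  independent⇒independentOver {suc m} v ind a a·≈0 with pivot v ind
  ... | j , v≢0 = λ where
      zero    → cancel-fromℤ (v zero j) (a zero) v≢0 (≈-trans (CR.*-comm (φ (v zero j)) (a zero)) a₀v≈0)
      (suc i) → tail≈0 i
    where
    b = a ∘ suc
    tail≈0 : ∀ i → b i ≈ 0#
    tail≈0 = independent⇒independentOver (reduce j v) (reduce-independent j v v≢0 ind) b λ k →
      let S = combinationᴷ b (reduce j v) k
          s = combinationᴷ b (v ∘ suc) k
          t = combinationᴷ b (v ∘ suc) j
          x = φ (v zero j)
          y = φ (v zero k)
          p = a zero
      in begin
      S                                    ≈⟨ CR.+-identityʳ S ⟨
      S ⊕ 0#                               ≈⟨ CR.+-congˡ (≈-trans (CR.*-congʳ (a·≈0 j)) (CR.zeroˡ y)) ⟨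
      S ⊕ (((p ⊗ x) ⊕ t) ⊗ y)              ≈⟨ solve 5 (λ S p x t y → S :+ (((p :* x) :+ t) :* y) := (S :+ (t :* y)) :+ (x :* (p :* y)))
                                                ≈-refl S p x t y ⟩
      (S ⊕ (t ⊗ y)) ⊕ (x ⊗ (p ⊗ y))        ≈⟨ CR.+-congʳ (combinationᴷ-reduce j v b k) ⟩
      (x ⊗ s) ⊕ (x ⊗ (p ⊗ y))              ≈⟨ solve 4 (λ x s p y → (x :* s) :+ (x :* (p :* y)) := x :* ((p :* y) :+ s)) ≈-refl x s p y ⟩
      x ⊗ ((p ⊗ y) ⊕ s)                    ≈⟨ CR.*-congˡ (a·≈0 k) ⟩
      x ⊗ 0#                               ≈⟨ CR.zeroʳ x ⟩
      0#                                   ∎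
    a₀v≈0 : a zero ⊗ φ (v zero j) ≈ 0#
    a₀v≈0 = begin
      a zero ⊗ φ (v zero j)             ≈⟨ CR.+-identityʳ _ ⟨
      (a zero ⊗ φ (v zero j)) ⊕ 0#      ≈⟨ CR.+-congˡ (sum-zeroᴷ (λ i → b i ⊗ φ (v (suc i) j))
                                             (λ i → ≈-trans (CR.*-congʳ (tail≈0 i)) (CR.zeroˡ _))) ⟨
      combinationᴷ a v j                ≈⟨ a·≈0 j ⟩
      0#                                ∎

-- Signs and signed permutation equivalence

IsSign : ℤ → Set
IsSign x = x ≡ 1ℤ ⊎ x ≡ -1ℤ

sign-* : ∀ {x y} → IsSign x → IsSign y → IsSign (x * y)
sign-* (inj₁ refl) (inj₁ refl) = inj₁ refl
sign-* (inj₁ refl) (inj₂ refl) = inj₂ refl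
sign-* (inj₂ refl) (inj₁ refl) = inj₂ refl
sign-* (inj₂ refl) (inj₂ refl) = inj₁ refl

sign-square : ∀ {x} → IsSign x → x * x ≡ 1ℤ
sign-square (inj₁ refl) = refl
sign-square (inj₂ refl) = refl

sign-abs : ∀ {x} → IsSign x → ∣ x ∣ ≡ 1
sign-abs (inj₁ refl) = refl
sign-abs (inj₂ refl) = refl

sign-≢0 : ∀ {x} → IsSign x → x ≢ 0ℤ
sign-≢0 (inj₁ refl) ()
sign-≢0 (inj₂ refl) ()

sign-cancel : ∀ {x} → IsSign x → ∀ y → x * (x * y) ≡ y
sign-cancel {x} s y = trans (sym (ℤₚ.*-assoc x x y)) (trans (cong (_* y) (sign-square s)) (ℤₚ.*-identityˡ y))

abs-sign* : ∀ {x} → IsSign x → ∀ y → ∣ x * y ∣ ≡ ∣ y ∣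
abs-sign* {x} s y = trans (ℤₚ.abs-* x y) (trans (cong (_*ℕ ∣ y ∣) (sign-abs s)) (ℕₚ.*-identityˡ ∣ y ∣))

SignVector : (Fin n → ℤ) → Set
SignVector x = ∀ i → IsSign (x i)

product : (Fin n → ℤ) → ℤ
product {zero}  x = 1ℤ
product {suc n} x = x zero * product (x ∘ suc)

product-sign : (x : Fin n → ℤ) → SignVector x → IsSign (product x)
product-sign {zero}  x s = inj₁ refl
product-sign {suc n} x s = sign-* (s zero) (product-sign (x ∘ suc) (s ∘ suc))

opaque
  unfolding per

  per-scaleRows : (x : Fin n → ℤ) (A : Matrix n) → per (λ i j → x i * A i j) ≡ product x * per A
  per-scaleRows {zero}  x A = refl
  per-scaleRows {suc n} x A = trans
    (sum-cong-≗ λ j → trans (cong (x zero * A zero j *_) (per-scaleRows (x ∘ suc) (minor zero j A)))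
      (ring (x zero) (A zero j) (product (x ∘ suc)) (per (minor zero j A))))
    (sum-scale (x zero * product (x ∘ suc)) (λ j → A zero j * per (minor zero j A)))
    where
    ring : ∀ x a p q → x * a * (p * q) ≡ x * p * (a * q)
    ring = ℤ-Solver.solve-∀

per-scaleColumns : (y : Fin n → ℤ) (A : Matrix n) → per (λ i j → y j * A i j) ≡ product y * per A
per-scaleColumns y A = trans (sym (per-transpose (λ i j → y j * A i j)))
  (trans (per-scaleRows y (A ᵀ)) (cong (product y *_) (per-transpose A)))

infix 4 _≅_
record _≅_ (A B : Matrix n) : Set where
  constructor mk≅
  field
    π σ    : Permutation′ n
    x y    : Fin n → ℤ
    x-sign : SignVector x
    y-sign : SignVector y
    entry  : ∀ i j → A i j ≡ x i * (y j * B (π ⟨$⟩ʳ i) (σ ⟨$⟩ʳ j))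

permuted≅ : {A B : Matrix n} (π σ : Permutation′ n) → (∀ i j → A i j ≡ B (π ⟨$⟩ʳ i) (σ ⟨$⟩ʳ j)) → A ≅ B
permuted≅ π σ e = mk≅ π σ (λ _ → 1ℤ) (λ _ → 1ℤ) (λ _ → inj₁ refl) (λ _ → inj₁ refl)
  λ i j → trans (e i j) (sym (trans (ℤₚ.*-identityˡ _) (ℤₚ.*-identityˡ _)))

≗⇒≅ : {A B : Matrix n} → (∀ i j → A i j ≡ B i j) → A ≅ B
≗⇒≅ = permuted≅ Perm.id Perm.id

≅-trans : {A B C : Matrix n} → A ≅ B → B ≅ C → A ≅ C
≅-trans {A = A} {B} {C} (mk≅ π σ x y xs ys e) (mk≅ π′ σ′ x′ y′ xs′ ys′ e′) =
  mk≅ (π ∘ₚ π′) (σ ∘ₚ σ′) (λ i → x i * x′ (π ⟨$⟩ʳ i)) (λ j → y j * y′ (σ ⟨$⟩ʳ j))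
    (λ i → sign-* (xs i) (xs′ _)) (λ j → sign-* (ys j) (ys′ _))
    λ i j → trans (e i j) (trans (cong (λ z → x i * (y j * z)) (e′ (π ⟨$⟩ʳ i) (σ ⟨$⟩ʳ j)))
      (ring (x i) (y j) (x′ (π ⟨$⟩ʳ i)) (y′ (σ ⟨$⟩ʳ j)) (C (π′ ⟨$⟩ʳ (π ⟨$⟩ʳ i)) (σ′ ⟨$⟩ʳ (σ ⟨$⟩ʳ j)))))
  where
  ring : ∀ a b c d z → a * (b * (c * (d * z))) ≡ a * c * (b * d * z)
  ring = ℤ-Solver.solve-∀

≅-sym : {A B : Matrix n} → A ≅ B → B ≅ A
≅-sym {A = A} {B} (mk≅ π σ x y xs ys e) =
  mk≅ (flip π) (flip σ) (λ i → x (π ⟨$⟩ˡ i)) (λ j → y (σ ⟨$⟩ˡ j)) (λ i → xs _) (λ j → ys _)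
    λ i j → sym (trans (cong (λ z → x (π ⟨$⟩ˡ i) * (y (σ ⟨$⟩ˡ j) * z)) (e (π ⟨$⟩ˡ i) (σ ⟨$⟩ˡ j)))
      (trans (ring (x (π ⟨$⟩ˡ i)) (y (σ ⟨$⟩ˡ j)) (B (π ⟨$⟩ʳ (π ⟨$⟩ˡ i)) (σ ⟨$⟩ʳ (σ ⟨$⟩ˡ j))))
      (trans (sign-cancel (xs (π ⟨$⟩ˡ i)) _) (trans (sign-cancel (ys (σ ⟨$⟩ˡ j)) _)
        (cong₂ B (Perm.inverseʳ π) (Perm.inverseʳ σ))))))
  where
  ring : ∀ x y z → x * (y * (x * (y * z))) ≡ x * (x * (y * (y * z)))
  ring = ℤ-Solver.solve-∀

permuteRows≅ : (A : Matrix n) (π : Permutation′ n) → A ≅ (λ i j → A (π ⟨$⟩ʳ i) j)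
permuteRows≅ A π = ≅-sym (permuted≅ π Perm.id λ _ _ → refl)

permuteColumns≅ : (A : Matrix n) (π : Permutation′ n) → A ≅ (λ i j → A i (π ⟨$⟩ʳ j))
permuteColumns≅ A π = ≅-sym (permuted≅ Perm.id π λ _ _ → refl)

≅-per : {A B : Matrix n} → A ≅ B → ∣ per A ∣ ≡ ∣ per B ∣
≅-per {A = A} {B} (mk≅ π σ x y xs ys e) = begin
  ∣ per A ∣
    ≡⟨ cong ∣_∣ (per-cong e) ⟩
  ∣ per (λ i j → x i * (y j * B (π ⟨$⟩ʳ i) (σ ⟨$⟩ʳ j))) ∣
    ≡⟨ cong ∣_∣ (per-scaleRows x (λ i j → y j * B (π ⟨$⟩ʳ i) (σ ⟨$⟩ʳ j))) ⟩
  ∣ product x * per (λ i j → y j * B (π ⟨$⟩ʳ i) (σ ⟨$⟩ʳ j)) ∣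
    ≡⟨ abs-sign* (product-sign x xs) (per (λ i j → y j * B (π ⟨$⟩ʳ i) (σ ⟨$⟩ʳ j))) ⟩
  ∣ per (λ i j → y j * B (π ⟨$⟩ʳ i) (σ ⟨$⟩ʳ j)) ∣
    ≡⟨ cong ∣_∣ (per-scaleColumns y (λ i j → B (π ⟨$⟩ʳ i) (σ ⟨$⟩ʳ j))) ⟩
  ∣ product y * per (λ i j → B (π ⟨$⟩ʳ i) (σ ⟨$⟩ʳ j)) ∣
    ≡⟨ abs-sign* (product-sign y ys) (per (λ i j → B (π ⟨$⟩ʳ i) (σ ⟨$⟩ʳ j))) ⟩
  ∣ per (λ i j → B (π ⟨$⟩ʳ i) (σ ⟨$⟩ʳ j)) ∣
    ≡⟨ cong ∣_∣ (per-permuteRows (λ i j → B i (σ ⟨$⟩ʳ j)) π) ⟩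
  ∣ per (λ i j → B i (σ ⟨$⟩ʳ j)) ∣
    ≡⟨ cong ∣_∣ (per-permuteColumns B σ) ⟩
  ∣ per B ∣ ∎
  where open ≡-Reasoning

≅-independent : {A B : Matrix n} → A ≅ B → Independent A → Independent B
≅-independent {A = A} {B} (mk≅ π σ x y xs ys e) ind a a·≡0 i = begin
  a i                                              ≡⟨ cong a (Perm.inverseʳ π) ⟨
  a (π ⟨$⟩ʳ i′)                                    ≡⟨ sign-cancel (xs i′) (a (π ⟨$⟩ʳ i′)) ⟨
  x i′ * (x i′ * a (π ⟨$⟩ʳ i′))                    ≡⟨ cong (x i′ *_) (ind b b·≡0 i′) ⟩
  x i′ * 0ℤ                                        ≡⟨ ℤₚ.*-zeroʳ (x i′) ⟩
  0ℤ                                               ∎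
  where
  open ≡-Reasoning
  i′ = π ⟨$⟩ˡ i
  b : Fin _ → ℤ
  b k = x k * a (π ⟨$⟩ʳ k)
  ring : ∀ x a y z → x * a * (x * (y * z)) ≡ y * (x * (x * (a * z)))
  ring = ℤ-Solver.solve-∀
  b·≡0 : ∀ j → combination b A j ≡ 0ℤ
  b·≡0 j = begin
    sum (λ k → x k * a (π ⟨$⟩ʳ k) * A k j)
      ≡⟨ sum-cong-≗ (λ k → trans (cong (b k *_) (e k j)) (trans (ring (x k) (a (π ⟨$⟩ʳ k)) (y j) (B (π ⟨$⟩ʳ k) (σ ⟨$⟩ʳ j)))
           (cong (y j *_) (sign-cancel (xs k) (a (π ⟨$⟩ʳ k) * B (π ⟨$⟩ʳ k) (σ ⟨$⟩ʳ j)))))) ⟩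
    sum (λ k → y j * (a (π ⟨$⟩ʳ k) * B (π ⟨$⟩ʳ k) (σ ⟨$⟩ʳ j)))
      ≡⟨ sum-scale (y j) (λ k → a (π ⟨$⟩ʳ k) * B (π ⟨$⟩ʳ k) (σ ⟨$⟩ʳ j)) ⟩
    y j * sum (λ k → a (π ⟨$⟩ʳ k) * B (π ⟨$⟩ʳ k) (σ ⟨$⟩ʳ j))
      ≡⟨ cong (y j *_) (sum-permute (λ k → a k * B k (σ ⟨$⟩ʳ j)) π) ⟨
    y j * combination a B (σ ⟨$⟩ʳ j)
      ≡⟨ cong (y j *_) (a·≡0 (σ ⟨$⟩ʳ j)) ⟩
    y j * 0ℤ
      ≡⟨ ℤₚ.*-zeroʳ (y j) ⟩
    0ℤ ∎

-- From signed permutation equivalence to chains of elementary transformations, and back to permanents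

sequence : {A : Matrix n} (C : ℕ → Matrix n) (k : ℕ) → (∀ i j → C 0 i j ≡ A i j) →
  (∀ l → l < k → Transformation (C l) (C (suc l))) → Star Transformation A (C k)
sequence C zero    C₀≗A step = permuteRows Perm.id C₀≗A ◅ ε
sequence C (suc k) C₀≗A step = sequence C k C₀≗A (λ l l<k → step l (ℕₚ.m≤n⇒m≤1+n l<k)) ◅◅ (step k (ℕₚ.n<1+n k) ◅ ε)

-- Interpolates between no scaling and scaling by `x`. Consecutive stages differ in a single row, so
-- each step is a negation of that row or changes nothing.
partialScale : (Fin n → ℤ) → ℕ → Fin n → ℤ
partialScale x l i = if does (toℕ i ℕₚ.<? l) then x i else 1ℤ

partialScale-suc : (x : Fin n) (s : Fin n → ℤ) → SignVector s → ∀ i →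
  partialScale s (suc (toℕ x)) i ≡ (if does (i ≟ x) then s x * partialScale s (toℕ x) i else partialScale s (toℕ x) i)
partialScale-suc x s ss i with i ≟ x
... | yes refl rewrite dec-true (toℕ i ℕₚ.<? suc (toℕ i)) (ℕₚ.n<1+n (toℕ i))
                     | dec-false (toℕ i ℕₚ.<? toℕ i) (ℕₚ.<-irrefl refl) = sym (ℤₚ.*-identityʳ (s i))
... | no i≢x with toℕ i ℕₚ.<? toℕ x
...   | yes i<x rewrite dec-true (toℕ i ℕₚ.<? suc (toℕ x)) (ℕₚ.m≤n⇒m≤1+n i<x)
                            | dec-true (toℕ i ℕₚ.<? toℕ x) i<x = refl
...   | no  i≮x rewrite dec-false (toℕ i ℕₚ.<? suc (toℕ x))
                          (λ i<1+x → i≢x (toℕ-injective (ℕₚ.≤-antisym (ℕ.s≤s⁻¹ i<1+x) (ℕₚ.≮⇒≥ i≮x))))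
                            | dec-false (toℕ i ℕₚ.<? toℕ x) i≮x = refl

scaleRows-star : (A : Matrix n) (x : Fin n → ℤ) → SignVector x → Star Transformation A (λ i j → x i * A i j)
scaleRows-star {n} A x xs = sequence C n (λ i j → ℤₚ.*-identityˡ (A i j)) step ◅◅ (permuteRows Perm.id last ◅ ε)
  where
  C : ℕ → Matrix n
  C l i j = partialScale x l i * A i j
  last : ∀ i j → x i * A i j ≡ C n i j
  last i j rewrite dec-true (toℕ i ℕₚ.<? n) (toℕ<n i) = refl
  step′ : ∀ p → Transformation (C (toℕ p)) (C (suc (toℕ p)))
  step′ p with xs p
  ... | inj₁ x≡1 = permuteRows Perm.id λ i j → cong (_* A i j) (trans (partialScale-suc p x xs i) (same i))
    where
    same : ∀ i → (if does (i ≟ p) then x p * partialScale x (toℕ p) i else partialScale x (toℕ p) i) ≡ partialScale x (toℕ p) i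
    same i with i ≟ p
    ... | yes _ = trans (cong (_* partialScale x (toℕ p) i) x≡1) (ℤₚ.*-identityˡ (partialScale x (toℕ p) i))
    ... | no  _ = refl
  ... | inj₂ x≡-1 = negateRow p λ i j → trans (cong (_* A i j) (partialScale-suc p x xs i)) (flipped i j)
    where
    flipped : ∀ i j → (if does (i ≟ p) then x p * partialScale x (toℕ p) i else partialScale x (toℕ p) i) * A i j ≡
                      (if does (i ≟ p) then - C (toℕ p) i j else C (toℕ p) i j)
    flipped i j with i ≟ p
    ... | yes _ = trans (cong (λ z → z * partialScale x (toℕ p) i * A i j) x≡-1) (ring (partialScale x (toℕ p) i) (A i j))
      where
      ring : ∀ a b → -1ℤ * a * b ≡ - (a * b)
      ring = ℤ-Solver.solve-∀
    ... | no  _ = refl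
  step : ∀ l → l < n → Transformation (C l) (C (suc l))
  step l l<n = subst (λ k → Transformation (C k) (C (suc k))) (toℕ-fromℕ< l<n) (step′ (fromℕ< l<n))

≅⇒obtainable : {A B : Matrix n} → A ≅ B → ObtainableFrom A B
≅⇒obtainable {A = A} {B} (mk≅ π σ x y xs ys e) =
  -- Columns are scaled as the rows of the transpose, between two transpositions.
  permuteRows π (λ _ _ → refl) ◅ permuteColumns σ (λ _ _ → refl) ◅ transpose (λ _ _ → refl) ◅
  scaleRows-star C y ys ◅◅ (transpose (λ _ _ → refl) ◅
  scaleRows-star (λ i j → y j * C j i) x xs ◅◅ (permuteRows Perm.id e ◅ ε))
  where
  C : Matrix _
  C j i = B (π ⟨$⟩ʳ i) (σ ⟨$⟩ʳ j)

flipSign : Fin n → Fin n → ℤ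
flipSign i p = if does (p ≟ i) then -1ℤ else 1ℤ

flipSign-sign : (i : Fin n) → SignVector (flipSign i)
flipSign-sign i p with p ≟ i
... | yes _ = inj₂ refl
... | no  _ = inj₁ refl

flipSign-* : (i p : Fin n) (z : ℤ) → (if does (p ≟ i) then - z else z) ≡ flipSign i p * z
flipSign-* i p z with p ≟ i
... | yes _ = sym (ℤₚ.-1*i≡-i z)
... | no  _ = sym (ℤₚ.*-identityˡ z)

transformation-per : {A B : Matrix n} → Transformation A B → ∣ per B ∣ ≡ ∣ per A ∣
transformation-per {A = A} (negateRow i e) = trans
  (cong ∣_∣ (trans (per-cong λ p q → trans (e p q) (flipSign-* i p (A p q))) (per-scaleRows (flipSign i) A)))
  (abs-sign* (product-sign _ (flipSign-sign i)) (per A))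
transformation-per {A = A} (negateColumn i e) = trans
  (cong ∣_∣ (trans (per-cong λ p q → trans (e p q) (flipSign-* i q (A p q))) (per-scaleColumns (flipSign i) A)))
  (abs-sign* (product-sign _ (flipSign-sign i)) (per A))
transformation-per {A = A} (permuteRows π e)    = cong ∣_∣ (trans (per-cong e) (per-permuteRows A π))
transformation-per {A = A} (permuteColumns π e) = cong ∣_∣ (trans (per-cong e) (per-permuteColumns A π))
transformation-per {A = A} (transpose e)        = cong ∣_∣ (trans (per-cong e) (per-transpose A))

obtainable-per : {A B : Matrix n} → ObtainableFrom A B → ∣ per A ∣ ≡ ∣ per B ∣
obtainable-per ε        = refl
obtainable-per (t ◅ ts) = trans (obtainable-per ts) (transformation-per t)

-- The numbers per D(n,l)

-- N m l is the permanent of D(m+1+l, l). The recursion is the Laplace expansion along a row of ones,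
-- which has no negative terms; N-rel is D(n,l) versus D(n,l+1).

N : ℕ → ℕ → ℕ
N m       zero          = suc m ℕ.!
N zero    (suc zero)    = 0
-- A row of ones would leave the minor `D(l+2,l+2)`, outside the range of `N`. Along a row with an
-- entry -1, the minor at this entry and the minor at the unmarked column are both `D(l+2,l+1)` up
-- to permutations and cancel; the other `l + 1` minors are `D(l+2,l)`.
N zero    (suc (suc l)) = suc l *ℕ N 1 l
N (suc m) (suc l)       = suc l *ℕ N (suc m) l +ℕ suc (suc m) *ℕ N m (suc l)

N-rel : ∀ m l → N (suc m) l ≡ N m (suc l) +ℕ 2 *ℕ N m l
N-rel zero    zero    = refl
N-rel zero    (suc l) = refl
N-rel (suc m) zero    = begin
  suc (suc (suc m)) *ℕ N (suc m) 0
    ≡⟨ ring m (N (suc m) 0) ⟩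
  1 *ℕ N (suc m) 0 +ℕ suc (suc m) *ℕ N (suc m) 0
    ≡⟨ cong (λ z → 1 *ℕ N (suc m) 0 +ℕ suc (suc m) *ℕ z) (N-rel m zero) ⟩
  1 *ℕ N (suc m) 0 +ℕ suc (suc m) *ℕ (N m 1 +ℕ 2 *ℕ N m 0)
    ≡⟨ ring′ m (N m 1) (N m 0) (1 *ℕ N (suc m) 0) ⟩
  1 *ℕ N (suc m) 0 +ℕ suc (suc m) *ℕ N m 1 +ℕ 2 *ℕ N (suc m) 0 ∎
  where
  open ≡-Reasoning
  ring : ∀ m x → (3 +ℕ m) *ℕ x ≡ 1 *ℕ x +ℕ (2 +ℕ m) *ℕ x
  ring = ℕ-Solver.solve-∀
  ring′ : ∀ m y z x → x +ℕ (2 +ℕ m) *ℕ (y +ℕ 2 *ℕ z) ≡ x +ℕ (2 +ℕ m) *ℕ y +ℕ 2 *ℕ ((2 +ℕ m) *ℕ z)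
  ring′ = ℕ-Solver.solve-∀
N-rel (suc m) (suc l) = begin
  suc l *ℕ N (suc (suc m)) l +ℕ suc (suc (suc m)) *ℕ N (suc m) (suc l)
    ≡⟨ cong (λ z → suc l *ℕ z +ℕ suc (suc (suc m)) *ℕ N (suc m) (suc l)) (N-rel (suc m) l) ⟩
  suc l *ℕ (b +ℕ 2 *ℕ a) +ℕ suc (suc (suc m)) *ℕ b
    ≡⟨ ring l m a b ⟩
  suc (suc l) *ℕ b +ℕ suc (suc m) *ℕ b +ℕ 2 *ℕ (suc l *ℕ a)
    ≡⟨ cong (λ z → suc (suc l) *ℕ b +ℕ suc (suc m) *ℕ z +ℕ 2 *ℕ (suc l *ℕ a)) (N-rel m (suc l)) ⟩
  suc (suc l) *ℕ b +ℕ suc (suc m) *ℕ (N m (suc (suc l)) +ℕ 2 *ℕ N m (suc l)) +ℕ 2 *ℕ (suc l *ℕ a)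
    ≡⟨ ring′ (suc (suc l) *ℕ b) m (N m (suc (suc l))) (N m (suc l)) (suc l *ℕ a) ⟩
  suc (suc l) *ℕ b +ℕ suc (suc m) *ℕ N m (suc (suc l)) +ℕ 2 *ℕ (suc l *ℕ a +ℕ suc (suc m) *ℕ N m (suc l)) ∎
  where
  open ≡-Reasoning
  a = N (suc m) l
  b = N (suc m) (suc l)
  ring : ∀ l m a b → (1 +ℕ l) *ℕ (b +ℕ 2 *ℕ a) +ℕ (3 +ℕ m) *ℕ b ≡ (2 +ℕ l) *ℕ b +ℕ (2 +ℕ m) *ℕ b +ℕ 2 *ℕ ((1 +ℕ l) *ℕ a)
  ring = ℕ-Solver.solve-∀
  ring′ : ∀ x m c d e → x +ℕ (2 +ℕ m) *ℕ (c +ℕ 2 *ℕ d) +ℕ 2 *ℕ e ≡ x +ℕ (2 +ℕ m) *ℕ c +ℕ 2 *ℕ (e +ℕ (2 +ℕ m) *ℕ d)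
  ring′ = ℕ-Solver.solve-∀

N-mono : ∀ m l → N m (suc l) ≤ N (suc m) l
N-mono m l = subst (N m (suc l) ≤_) (sym (N-rel m l)) (ℕₚ.m≤m+n (N m (suc l)) (2 *ℕ N m l))

N-pos : ∀ m l → 0 < N (suc m) l
N-pos m       zero    = ℕₚ.1≤n! (suc (suc m))
N-pos zero    (suc l) = ℕₚ.≤-trans (N-pos zero l) (ℕₚ.≤-trans (ℕₚ.m≤m+n (N 1 l) (l *ℕ N 1 l)) (ℕₚ.m≤m+n (suc l *ℕ N 1 l) (2 *ℕ N 0 (suc l))))
N-pos (suc m) (suc l) = ℕₚ.≤-trans (N-pos (suc m) l) (ℕₚ.≤-trans (ℕₚ.m≤m+n (N (suc (suc m)) l) (l *ℕ N (suc (suc m)) l))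
  (ℕₚ.m≤m+n (suc l *ℕ N (suc (suc m)) l) (suc (suc (suc m)) *ℕ N (suc m) (suc l))))

N₀-pos : ∀ l → 0 < N 0 (suc (suc l))
N₀-pos l = ℕₚ.≤-trans (N-pos 0 l) (ℕₚ.m≤m+n (N 1 l) (l *ℕ N 1 l))

-- Matrices with arbitrarily marked diagonal entries, and the permanents of `D n l`

Δ : (Fin n → Bool) → Matrix n
Δ χ i j = if does (i ≟ j) ∧ χ i then -1ℤ else 1ℤ

Δ-diagonal : (χ : Fin n → Bool) (i : Fin n) → Δ χ i i ≡ (if χ i then -1ℤ else 1ℤ)
Δ-diagonal χ i rewrite dec-true (i ≟ i) refl = refl

Δ-off : (χ : Fin n → Bool) {i j : Fin n} → i ≢ j → Δ χ i j ≡ 1ℤ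
Δ-off χ {i} {j} i≢j rewrite dec-false (i ≟ j) i≢j = refl

if-sign : (b : Bool) → IsSign (if b then -1ℤ else 1ℤ)
if-sign true  = inj₂ refl
if-sign false = inj₁ refl

D-sign : ∀ n l → IsSignMatrix (D n l)
D-sign n l i j = if-sign _

bordered : ℤ → (Fin n → ℤ) → (Fin n → ℤ) → Matrix n → Matrix (suc n)
bordered x ρ γ B zero    zero    = x
bordered x ρ γ B zero    (suc j) = ρ j
bordered x ρ γ B (suc i) zero    = γ i
bordered x ρ γ B (suc i) (suc j) = B i j

onesBordered : Matrix n → Matrix (suc n)
onesBordered = bordered 1ℤ (λ _ → 1ℤ) (λ _ → 1ℤ)

opaque
  unfolding per

  -- Only the corner differs, and the minor at the corner is `D n l`: a new mark changes the
  -- permanent by -2 times this minor.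
  per-D-suc : ∀ n l → per (D (suc n) (suc l)) ≡ per (onesBordered (D n l)) - ℤ.+ 2 * per (D n l)
  per-D-suc n l = trans
    (cong (-1ℤ * per (D n l) +_) (sum-cong-≗ {n} λ j → cong (1ℤ *_) (per-cong λ a b → entries a (punchIn (suc j) b))))
    (ring (per (D n l)) (sum {n} λ j → 1ℤ * per (minor zero (suc j) (onesBordered (D n l)))))
    where
    entries : ∀ a b → D (suc n) (suc l) (suc a) b ≡ onesBordered (D n l) (suc a) b
    entries a zero    = refl
    entries a (suc b) = refl
    ring : ∀ p s → -1ℤ * p + s ≡ 1ℤ * p + s - ℤ.+ 2 * p
    ring = ℤ-Solver.solve-∀

toℕ-punchIn-last : (i : Fin n) → toℕ (punchIn (fromℕ n) i) ≡ toℕ i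
toℕ-punchIn-last zero    = refl
toℕ-punchIn-last (suc i) = cong suc (toℕ-punchIn-last i)

does-cong : ∀ {p q} {P : Set p} {Q : Set q} (P? : Dec P) (Q? : Dec Q) → (P → Q) → (Q → P) → does P? ≡ does Q?
does-cong P? (yes q) f g = dec-true P? (g q)
does-cong P? (no ¬q) f g = dec-false P? (¬q ∘ f)

-- The marks of `D` and the border of `bordered` both come first. The cyclic shift that sends the
-- last index to `zero` moves a border of ones behind the marks.
rotation : ∀ n → Permutation′ (suc n)
rotation n = insert (fromℕ n) zero Perm.id

insert-at : (i j : Fin (suc n)) (π : Permutation′ n) → insert i j π ⟨$⟩ʳ i ≡ j
insert-at i j π with i ≟ i
... | yes _   = refl
... | no  i≢i = contradiction refl i≢i

rotation-bordered : ∀ n l → l ≤ n → ∀ i j →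
  onesBordered (D n l) (rotation n ⟨$⟩ʳ i) (rotation n ⟨$⟩ʳ j) ≡ D (suc n) l i j
rotation-bordered n l l≤n = off-or-at {P = λ i → ∀ j → B (ρ i) (ρ j) ≡ D (suc n) l i j} last
  (off-or-at {P = λ j → B (ρ last) (ρ j) ≡ D (suc n) l last j} last
    (trans (cong₂ B ρ-last ρ-last) (sym (trans (Δ-diagonal χ last)
      (cong (λ b → if b then -1ℤ else 1ℤ) (dec-false (toℕ last ℕₚ.<? l)
        λ last<l → ℕₚ.<-irrefl refl (ℕₚ.≤-trans (subst (_< l) (toℕ-fromℕ n) last<l) l≤n))))))
    λ j → trans (cong₂ B ρ-last (ρ-off j)) (sym (Δ-off χ (λ e → punchInᵢ≢i last j (sym e)))))
  λ i → off-or-at {P = λ j → B (ρ (punchIn last i)) (ρ j) ≡ D (suc n) l (punchIn last i) j} last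
    (trans (cong₂ B (ρ-off i) ρ-last) (sym (Δ-off χ (punchInᵢ≢i last i))))
    λ j → trans (cong₂ B (ρ-off i) (ρ-off j)) (cong (λ b → if b then -1ℤ else 1ℤ)
      (cong₂ _∧_ (does-cong (i ≟ j) (punchIn last i ≟ punchIn last j) (cong (punchIn last)) (punchIn-injective last i j))
                 (cong (λ k → does (k ℕₚ.<? l)) (sym (toℕ-punchIn-last i)))))
  where
  χ : Fin (suc n) → Bool
  χ i = does (toℕ i ℕₚ.<? l)
  B = onesBordered (D n l)
  last = fromℕ n
  ρ = rotation n ⟨$⟩ʳ_
  ρ-last : ρ last ≡ zero
  ρ-last = insert-at last zero Perm.id
  ρ-off : ∀ i → ρ (punchIn last i) ≡ suc i
  ρ-off i = Perm.insert-punchIn last zero Perm.id i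

per-onesBordered : ∀ n l → l ≤ n → per (onesBordered (D n l)) ≡ per (D (suc n) l)
per-onesBordered n l l≤n = begin
  per B                                          ≡⟨ per-permuteColumns B (rotation n) ⟨
  per (λ i j → B i (ρ j))                        ≡⟨ per-permuteRows (λ i j → B i (ρ j)) (rotation n) ⟨
  per (λ i j → B (ρ i) (ρ j))                    ≡⟨ per-cong (rotation-bordered n l l≤n) ⟩
  per (D (suc n) l)                              ∎
  where
  open ≡-Reasoning
  B = onesBordered (D n l)
  ρ = rotation n ⟨$⟩ʳ_

onesBordered≅D : ∀ n l → l ≤ n → onesBordered (D n l) ≅ D (suc n) l
onesBordered≅D n l l≤n = ≅-sym (permuted≅ (rotation n) (rotation n) λ i j → sym (rotation-bordered n l l≤n i j))

sum-const : ∀ n (x : ℤ) → sum {n} (λ _ → x) ≡ ℤ.+ n * x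
sum-const zero    x = sym (ℤₚ.*-zeroˡ x)
sum-const (suc n) x = trans (cong (x +_) (sum-const n x)) (sym (ℤₚ.suc-* (ℤ.+ n) x))

opaque
  unfolding per

  per-ones : ∀ n (A : Matrix n) → (∀ i j → A i j ≡ 1ℤ) → per A ≡ ℤ.+ (n ℕ.!)
  per-ones zero    A A≡1 = refl
  per-ones (suc n) A A≡1 = trans
    (sum-cong-≗ λ j → trans (cong₂ _*_ (A≡1 zero j) (per-ones n (minor zero j A) (λ a b → A≡1 (suc a) (punchIn j b)))) (ℤₚ.*-identityˡ _))
    (trans (sum-const (suc n) (ℤ.+ (n ℕ.!))) (sym (ℤₚ.pos-* (suc n) (n ℕ.!))))

D-zero : ∀ n i j → D n 0 i j ≡ 1ℤ
D-zero n i j with does (i ≟ j)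
... | true  = refl
... | false = refl

-- Marks are added one at a time by `per-D-suc`, and `N-rel` is exactly what this requires of `N`.
per-D : ∀ m l n → n ≡ suc m +ℕ l → per (D n l) ≡ ℤ.+ N m l
per-D m zero    n refl = trans (per-ones n (D n 0) (D-zero n)) (cong (λ k → ℤ.+ (k ℕ.!)) (ℕₚ.+-identityʳ (suc m)))
per-D m (suc l) n n≡ with trans n≡ (ℕₚ.+-suc (suc m) l)
... | refl = begin
  per (D (suc (suc m +ℕ l)) (suc l))
    ≡⟨ per-D-suc (suc m +ℕ l) l ⟩
  per (onesBordered (D (suc m +ℕ l) l)) - ℤ.+ 2 * per (D (suc m +ℕ l) l)
    ≡⟨ cong₂ (λ x y → x - ℤ.+ 2 * y)
         (trans (per-onesBordered (suc m +ℕ l) l (ℕₚ.m≤n+m l (suc m))) (per-D (suc m) l (suc (suc m +ℕ l)) refl))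
         (per-D m l (suc m +ℕ l) refl) ⟩
  ℤ.+ N (suc m) l - ℤ.+ 2 * ℤ.+ N m l
    ≡⟨ cong₂ _-_ (trans (cong ℤ.+_ (N-rel m l)) (ℤₚ.pos-+ (N m (suc l)) (2 *ℕ N m l))) (sym (ℤₚ.pos-* 2 (N m l))) ⟩
  ℤ.+ N m (suc l) + ℤ.+ (2 *ℕ N m l) - ℤ.+ (2 *ℕ N m l)
    ≡⟨ ring (ℤ.+ N m (suc l)) (ℤ.+ (2 *ℕ N m l)) ⟩
  ℤ.+ N m (suc l) ∎
  where
  open ≡-Reasoning
  ring : ∀ x y → x + y - y ≡ x
  ring = ℤ-Solver.solve-∀

per-D-full : ∀ l → per (D (suc l) (suc l)) ≡ ℤ.+ N 0 l - ℤ.+ 2 * per (D l l)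
per-D-full l = trans (per-D-suc l l)
  (cong (λ z → z - ℤ.+ 2 * per (D l l)) (trans (per-onesBordered l l ℕₚ.≤-refl) (per-D 0 l (suc l) refl)))

N₀-double : ∀ l → 2 *ℕ N 0 (suc (suc l)) ≤ N 0 (suc (suc (suc l)))
N₀-double l = ℕₚ.*-mono-≤ {2} {suc (suc l)} (s≤s (s≤s z≤n)) (N-mono 0 (suc l))

FullBounds : ℕ → Set
FullBounds l = ∃ λ p → per (D (suc l) (suc l)) ≡ ℤ.+ p × 0 < p × p < N 0 l

opaque
  unfolding per

  per-D₅ : per (D 5 5) ≡ ℤ.+ 8
  per-D₅ = refl

-- By `per-D-full` the permanents of the fully marked matrices obey `p ↦ M - 2p`, where `M` is the
-- next value of `N 0`. If `M` is at least twice the previous value, `2p` stays below `M`, so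
-- positivity and the upper bound both persist.
fullBounds-suc : ∀ l → 2 *ℕ N 0 l ≤ N 0 (suc l) → FullBounds l → FullBounds (suc l)
fullBounds-suc l double (p , per≡p , 0<p , p<N) = M ∸ 2 *ℕ p , eq , ℕₚ.m<n⇒0<n∸m 2p<M , ℕₚ.∸-monoʳ-< (ℕₚ.*-monoʳ-< 2 0<p) (ℕₚ.<⇒≤ 2p<M)
  where
  M = N 0 (suc l)
  2p<M : 2 *ℕ p < M
  2p<M = ℕₚ.<-≤-trans (ℕₚ.*-monoʳ-< 2 p<N) double
  eq : per (D (suc (suc l)) (suc (suc l))) ≡ ℤ.+ (M ∸ 2 *ℕ p)
  eq = trans (per-D-full (suc l)) (trans (cong (λ z → ℤ.+ M - ℤ.+ 2 * z) per≡p)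
    (trans (cong (λ z → ℤ.+ M - z) (sym (ℤₚ.pos-* 2 p))) (trans (ℤₚ.m-n≡m⊖n M (2 *ℕ p)) (ℤₚ.⊖-≥ (ℕₚ.<⇒≤ 2p<M)))))

per-D-full-bounds : ∀ k → FullBounds (4 +ℕ k)
-- Order 5 is the earliest possible start, as `D 4 4` has permanent 8 while `N 0 3` is 4. Here the
-- claim is `8 < 24`.
per-D-full-bounds zero    = 8 , per-D₅ , s≤s z≤n , ℕₚ.m≤m+n 9 15
per-D-full-bounds (suc k) = fullBounds-suc (4 +ℕ k) (N₀-double (2 +ℕ k)) (per-D-full-bounds k)

count : (Fin n → Bool) → ℕ
count {zero}  χ = 0
count {suc n} χ = (if χ zero then 1 else 0) +ℕ count (χ ∘ suc)

count≤ : (χ : Fin n → Bool) → count χ ≤ n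
count≤ {zero}  χ = z≤n
count≤ {suc n} χ with χ zero
... | true  = s≤s (count≤ (χ ∘ suc))
... | false = ℕₚ.m≤n⇒m≤1+n (count≤ (χ ∘ suc))

count-not : (χ : Fin n → Bool) → count χ +ℕ count (not ∘ χ) ≡ n
count-not {zero}  χ = refl
count-not {suc n} χ with χ zero
... | true  = cong suc (count-not (χ ∘ suc))
... | false = trans (ℕₚ.+-suc (count (χ ∘ suc)) _) (cong suc (count-not (χ ∘ suc)))

-- A marked first index stays in front. An unmarked one is a border of ones and is rotated to the
-- end.
Δ-permuted : (χ : Fin n → Bool) → ∃ λ (π : Permutation′ n) → ∀ i j → Δ χ i j ≡ D n (count χ) (π ⟨$⟩ʳ i) (π ⟨$⟩ʳ j)
Δ-permuted {zero}  χ = Perm.id , λ ()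
Δ-permuted {suc n} χ with Δ-permuted (χ ∘ suc) | χ zero in χ₀
... | π , e | true  = lift₀ π , λ where
  zero    zero    → cong (λ b → if b then -1ℤ else 1ℤ) χ₀
  zero    (suc j) → refl
  (suc i) zero    → refl
  (suc i) (suc j) → e i j
... | π , e | false = lift₀ π ∘ₚ flip (rotation n) , λ i j → trans (entries i j)
    (trans (sym (cong₂ B (Perm.inverseʳ (rotation n) {lift₀ π ⟨$⟩ʳ i}) (Perm.inverseʳ (rotation n) {lift₀ π ⟨$⟩ʳ j})))
           (rotation-bordered n (count (χ ∘ suc)) (count≤ (χ ∘ suc)) (rotation n ⟨$⟩ˡ (lift₀ π ⟨$⟩ʳ i)) (rotation n ⟨$⟩ˡ (lift₀ π ⟨$⟩ʳ j))))
  where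
  B = onesBordered (D n (count (χ ∘ suc)))
  entries : ∀ i j → Δ χ i j ≡ B (lift₀ π ⟨$⟩ʳ i) (lift₀ π ⟨$⟩ʳ j)
  entries zero    zero    = cong (λ b → if b then -1ℤ else 1ℤ) χ₀
  entries zero    (suc j) = refl
  entries (suc i) zero    = refl
  entries (suc i) (suc j) = e i j

per-Δ : (χ : Fin n → Bool) → per (Δ χ) ≡ per (D n (count χ))
per-Δ {n} χ with Δ-permuted χ
... | π , e = trans (per-cong e) (trans (per-permuteRows (λ i j → D n (count χ) i (π ⟨$⟩ʳ j)) π) (per-permuteColumns (D n (count χ)) π))

Δ≅D : (χ : Fin n → Bool) → Δ χ ≅ D n (count χ)
Δ≅D χ with Δ-permuted χ
... | π , e = permuted≅ π π e

-- The bound for singular matrices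

missed-value : (t : Fin m → Fin n) → m < n → ∃ λ c → ∀ k → t k ≢ c
missed-value {m} t m<n with any? (λ c → all? (λ k → ¬? (t k ≟ c)))
... | yes found = found
... | no  none  = contradiction (pigeonhole m<n (proj₁ ∘ preimage)) λ where
    (c , c′ , c<c′ , e) → ℕₚ.<⇒≢ c<c′ (cong toℕ (trans (sym (proj₂ (preimage c))) (trans (cong t e) (proj₂ (preimage c′)))))
  where
  preimage : ∀ c → ∃ λ k → t k ≡ c
  preimage c with any? (λ k → t k ≟ c)
  ... | yes hit  = hit
  ... | no  miss = contradiction (c , λ k e → miss (k , e)) none

select : (χ : Fin n → Bool) (k : ℕ) → k ≤ count χ →
  ∃ λ (t : Fin k → Fin n) → (∀ {i j} → t i ≡ t j → i ≡ j) × (∀ i → χ (t i) ≡ true)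
select χ zero z≤n = (λ ()) , (λ {i} → case i of λ ()) , λ ()
select {suc n} χ (suc k) k<c with χ zero in χ₀
... | true with select (χ ∘ suc) k (ℕ.s≤s⁻¹ k<c)
...   | t , t-inj , t-true = t⁺ , (λ {i} {j} → t⁺-inj i j) , λ where
          zero    → χ₀
          (suc i) → t-true i
  where
  t⁺ : Fin (suc k) → Fin (suc n)
  t⁺ zero    = zero
  t⁺ (suc i) = suc (t i)
  t⁺-inj : ∀ i j → t⁺ i ≡ t⁺ j → i ≡ j
  t⁺-inj zero    zero    e = refl
  t⁺-inj (suc i) (suc j) e = cong suc (t-inj (suc-injective e))
select {suc n} χ (suc k) k<c | false with select (χ ∘ suc) (suc k) k<c
...   | t , t-inj , t-true = suc ∘ t , (λ e → t-inj (suc-injective e)) , t-true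

abs-sum : (f : Fin n → ℤ) → ∣ sum f ∣ ≤ sumℕ (λ j → ∣ f j ∣)
abs-sum {zero}  f = z≤n
abs-sum {suc n} f = ℕₚ.≤-trans (ℤₚ.∣i+j∣≤∣i∣+∣j∣ (f zero) (sum (f ∘ suc))) (ℕₚ.+-monoʳ-≤ ∣ f zero ∣ (abs-sum (f ∘ suc)))

sumℕ-mono : {f g : Fin n → ℕ} → (∀ j → f j ≤ g j) → sumℕ f ≤ sumℕ g
sumℕ-mono {zero}  f≤g = z≤n
sumℕ-mono {suc n} f≤g = ℕₚ.+-mono-≤ (f≤g zero) (sumℕ-mono (f≤g ∘ suc))

sumℕ-two-valued : (χ : Fin n → Bool) (P Q : ℕ) →
  sumℕ (λ j → if χ j then P else Q) +ℕ count χ *ℕ Q ≡ count χ *ℕ P +ℕ n *ℕ Q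
sumℕ-two-valued {zero}  χ P Q = refl
sumℕ-two-valued {suc n} χ P Q with χ zero
... | true  = trans (ring P (sumℕ (λ j → if χ (suc j) then P else Q)) Q (count (χ ∘ suc) *ℕ Q))
                (trans (cong (λ z → P +ℕ Q +ℕ z) (sumℕ-two-valued (χ ∘ suc) P Q)) (ring′ P Q (count (χ ∘ suc) *ℕ P) (n *ℕ Q)))
  where
  ring′ : ∀ p q c s → p +ℕ q +ℕ (c +ℕ s) ≡ p +ℕ c +ℕ (q +ℕ s)
  ring′ = ℕ-Solver.solve-∀
  ring : ∀ p s q c → p +ℕ s +ℕ (q +ℕ c) ≡ p +ℕ q +ℕ (s +ℕ c)
  ring = ℕ-Solver.solve-∀
... | false = trans (ℕₚ.+-assoc Q (sumℕ (λ j → if χ (suc j) then P else Q)) (count (χ ∘ suc) *ℕ Q)) (trans (cong (Q +ℕ_) (sumℕ-two-valued (χ ∘ suc) P Q))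
                (ring Q (count (χ ∘ suc) *ℕ P) (n *ℕ Q)))
  where
  ring : ∀ q c s → q +ℕ (c +ℕ s) ≡ c +ℕ (q +ℕ s)
  ring = ℕ-Solver.solve-∀

-- Raising the number of places with the larger value `P` from `count χ` to `r` can only increase
-- the sum; `d` is the shortfall.
sumℕ-two-valued-≤ : (χ : Fin n → Bool) {P Q : ℕ} (r k : ℕ) → n ≡ r +ℕ k → Q ≤ P → count χ ≤ r →
  sumℕ (λ j → if χ j then P else Q) ≤ r *ℕ P +ℕ k *ℕ Q
sumℕ-two-valued-≤ {n} χ {P} {Q} r k n≡ Q≤P c≤r = ℕₚ.+-cancelʳ-≤ (r *ℕ Q) S (r *ℕ P +ℕ k *ℕ Q) (begin
  S +ℕ r *ℕ Q                          ≡⟨ cong (λ z → S +ℕ z *ℕ Q) (sym c+d) ⟩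
  S +ℕ (c +ℕ d) *ℕ Q                   ≡⟨ ring S c d Q ⟩
  S +ℕ c *ℕ Q +ℕ d *ℕ Q                ≡⟨ cong (_+ℕ d *ℕ Q) (sumℕ-two-valued χ P Q) ⟩
  c *ℕ P +ℕ n *ℕ Q +ℕ d *ℕ Q           ≤⟨ ℕₚ.+-monoʳ-≤ (c *ℕ P +ℕ n *ℕ Q) (ℕₚ.*-monoʳ-≤ d Q≤P) ⟩
  c *ℕ P +ℕ n *ℕ Q +ℕ d *ℕ P           ≡⟨ cong (λ z → c *ℕ P +ℕ z *ℕ Q +ℕ d *ℕ P) n≡ ⟩
  c *ℕ P +ℕ (r +ℕ k) *ℕ Q +ℕ d *ℕ P    ≡⟨ ring′ c d P r k Q ⟩
  (c +ℕ d) *ℕ P +ℕ k *ℕ Q +ℕ r *ℕ Q    ≡⟨ cong (λ z → z *ℕ P +ℕ k *ℕ Q +ℕ r *ℕ Q) c+d ⟩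
  r *ℕ P +ℕ k *ℕ Q +ℕ r *ℕ Q           ∎)
  where
  open ℕₚ.≤-Reasoning
  S = sumℕ (λ j → if χ j then P else Q)
  c = count χ
  d = r ∸ c
  c+d : c +ℕ d ≡ r
  c+d = ℕₚ.m+[n∸m]≡n c≤r
  ring : ∀ s c d q → s +ℕ (c +ℕ d) *ℕ q ≡ s +ℕ c *ℕ q +ℕ d *ℕ q
  ring = ℕ-Solver.solve-∀
  ring′ : ∀ c d p r k q → c *ℕ p +ℕ (r +ℕ k) *ℕ q +ℕ d *ℕ p ≡ (c +ℕ d) *ℕ p +ℕ k *ℕ q +ℕ r *ℕ q
  ring′ = ℕ-Solver.solve-∀

opaque
  isCritical : Rows m (suc n) → Fin (suc n) → Bool
  isCritical v j = not (does (independent? (dropColumn j v)))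

  critical-dependent : (v : Rows m (suc n)) (j : Fin (suc n)) → isCritical v j ≡ true → ¬ Independent (dropColumn j v)
  critical-dependent v j e ind = case trans (sym e) (cong not (dec-true (independent? (dropColumn j v)) ind)) of λ ()

  regular-independent : (v : Rows m (suc n)) (j : Fin (suc n)) → isCritical v j ≡ false → Independent (dropColumn j v)
  regular-independent v j e with independent? (dropColumn j v)
  ... | yes ind = ind

record Splitting (A : Matrix (suc n)) (r : ℕ) : Set where
  field
    row         : Fin (suc n)
    rest        : Fin (suc r) → Fin n
    independent : Independent (λ k → A (punchIn row (rest k)))

  selected : Rows (suc r) (suc n)
  selected k = A (punchIn row (rest k))

  critical : Fin (suc n) → Bool
  critical = isCritical selected

splitting : (A : Matrix (suc n)) (s : Fin (suc r) → Fin (suc n)) → Independent (A ∘ s) → r < n → Splitting A r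
splitting A s ind r<n with missed-value s (s≤s r<n)
... | i , s≢i = record
  { row = i
  ; rest = λ k → punchOut {i = i} (s≢i k ∘ sym)
  ; independent = independent-cong (λ k j → cong (λ l → A l j) (sym (punchIn-punchOut (s≢i k ∘ sym)))) ind
  }

module _ (A : Matrix (suc n)) (A-sign : IsSignMatrix A) (S : Splitting A r) (r<n : r < n) where
  open Splitting S

  critical-count : count critical ≤ r
  critical-count = ℕₚ.≮⇒≥ λ r<c → case select critical (suc r) r<c of λ where
    (t , t-inj , t-critical) → case missed-value t (s≤s r<n) of λ where
      (c , t≢c) → coloops-few selected independent t t-inj
        -- The selected rows are nonzero in the missed column `c` because sign matrices have no zero
        -- entries.
        (λ k → coloop (t k) selected independent (critical-dependent selected (t k) (t-critical k))) c t≢c (sign-≢0 (A-sign _ c))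

  minor-independent : ∀ j → critical j ≡ false → Independent (minor row j A ∘ rest)
  minor-independent = regular-independent selected

minor-sign : (i j : Fin (suc n)) {A : Matrix (suc n)} → IsSignMatrix A → IsSignMatrix (minor i j A)
minor-sign i j A-sign a b = A-sign (punchIn i a) (punchIn j b)

laplace-≤ : (A : Matrix (suc n)) → IsSignMatrix A → (i : Fin (suc n)) →
  ∣ per A ∣ ≤ sumℕ (λ j → ∣ per (minor i j A) ∣)
laplace-≤ A A-sign i = begin
  ∣ per A ∣                                           ≡⟨ cong ∣_∣ (per-expandRow A i) ⟩
  ∣ sum (λ j → A i j * per (minor i j A)) ∣           ≤⟨ abs-sum (λ j → A i j * per (minor i j A)) ⟩
  sumℕ (λ j → ∣ A i j * per (minor i j A) ∣)          ≡⟨ sumℕ-cong (λ j → abs-sign* (A-sign i j) (per (minor i j A))) ⟩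
  sumℕ (λ j → ∣ per (minor i j A) ∣)                  ∎
  where open ℕₚ.≤-Reasoning

-- The rank is only bounded below: what is known of a minor is that a certain number of its rows
-- stay independent.
Bound : ℕ → ℕ → Set
Bound m r = ∀ {n} → n ≡ suc m +ℕ r → (A : Matrix n) → IsSignMatrix A →
  (s : Fin (suc r) → Fin n) → Independent (A ∘ s) → ∣ per A ∣ ≤ N m r

-- Vacuous in rank 1, where no column is critical.

SmallerBound : ℕ → ℕ → Set
SmallerBound m zero    = ⊤
SmallerBound m (suc r) = Bound m r

-- The bound for the minors of critical columns. In rank 1 there are none, and the value is chosen
-- so that `N-laplace` and `criticalValue-≥` hold uniformly.
criticalValue : ℕ → ℕ → ℕ
criticalValue m zero    = N m zero
criticalValue m (suc r) = N (suc m) r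

N-laplace : ∀ m r → r *ℕ criticalValue m r +ℕ suc (suc m) *ℕ N m r ≡ N (suc m) r
N-laplace m zero    = refl
N-laplace m (suc r) = refl

criticalValue-≥ : ∀ m r → N m r ≤ criticalValue m r
criticalValue-≥ m zero    = ℕₚ.≤-refl
criticalValue-≥ m (suc r) = N-mono m r

module _ (A : Matrix (suc n)) (A-sign : IsSignMatrix A) (m r : ℕ) (n≡ : n ≡ suc m +ℕ r) (S : Splitting A r)
         (smaller : SmallerBound (suc m) r) where
  open Splitting S

  private
    r<n : r < n
    r<n = subst (r <_) (sym n≡) (s≤s (ℕₚ.m≤n+m r m))

  -- A deleted column costs at most one row, so `r` of the `r + 1` rows stay independent in the
  -- minor and the bound with `r - 1` applies to it.
  critical-minor-≤ : ∀ j → critical j ≡ true → ∣ per (minor row j A) ∣ ≤ criticalValue m r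
  critical-minor-≤ j e = go r n≡ S smaller e (critical-count A A-sign S r<n)
    where
    go : ∀ r → n ≡ suc m +ℕ r → (S : Splitting A r) → SmallerBound (suc m) r → Splitting.critical S j ≡ true →
         count (Splitting.critical S) ≤ r → ∣ per (minor (Splitting.row S) j A) ∣ ≤ criticalValue m r
    go zero    n≡ S smaller e count≤0 = contradiction count≤0 (ℕₚ.<⇒≱ (count-pos (Splitting.critical S) j e))
      where
      count-pos : ∀ {n} (χ : Fin n → Bool) j → χ j ≡ true → 0 < count χ
      count-pos χ zero    e rewrite e = s≤s z≤n
      count-pos χ (suc j) e = ℕₚ.≤-trans (count-pos (χ ∘ suc) j e) (ℕₚ.m≤n+m (count (χ ∘ suc)) _)
    go (suc r) n≡ S smaller e _ with dropColumn-dropRow j (Splitting.selected S) (Splitting.independent S)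
    ... | i , ind = smaller (trans n≡ (ℕₚ.+-suc (suc m) r)) (minor (Splitting.row S) j A)
                      (minor-sign (Splitting.row S) j A-sign) (Splitting.rest S ∘ punchIn i) ind

  minor-sum-≤ : (Q : ℕ) → Q ≤ criticalValue m r → (∀ j → critical j ≡ false → ∣ per (minor row j A) ∣ ≤ Q) →
    ∣ per A ∣ ≤ r *ℕ criticalValue m r +ℕ suc (suc m) *ℕ Q
  minor-sum-≤ Q Q≤P regular = begin
    ∣ per A ∣                                                       ≤⟨ laplace-≤ A A-sign row ⟩
    sumℕ (λ j → ∣ per (minor row j A) ∣)                            ≤⟨ sumℕ-mono pointwise ⟩
    sumℕ (λ j → if critical j then criticalValue m r else Q)        ≤⟨ sumℕ-two-valued-≤ critical r (suc (suc m))
                                                                         (trans (cong suc n≡) (ℕₚ.+-comm (suc (suc m)) r)) Q≤P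
                                                                         (critical-count A A-sign S r<n) ⟩
    r *ℕ criticalValue m r +ℕ suc (suc m) *ℕ Q                      ∎
    where
    open ℕₚ.≤-Reasoning
    pointwise : ∀ j → ∣ per (minor row j A) ∣ ≤ (if critical j then criticalValue m r else Q)
    pointwise j with critical j in e
    ... | true  = critical-minor-≤ j e
    ... | false = regular j e

  regular-minor-≤ : Bound m r → ∀ j → critical j ≡ false → ∣ per (minor row j A) ∣ ≤ N m r
  regular-minor-≤ bound j e = bound n≡ (minor row j A) (minor-sign row j A-sign) rest (minor-independent A A-sign S r<n j e)

singular-bound : ∀ m r → Bound m r → SmallerBound (suc m) r → Bound (suc m) r
singular-bound m r bound smaller {suc n} n≡ A A-sign s ind = subst (∣ per A ∣ ≤_) (N-laplace m r)
  (minor-sum-≤ A A-sign m r n≡′ S smaller (N m r) (criticalValue-≥ m r) (regular-minor-≤ A A-sign m r n≡′ S smaller bound))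
  where
  n≡′ = ℕₚ.suc-injective n≡
  S = splitting A s ind (subst (r <_) (sym n≡′) (s≤s (ℕₚ.m≤n+m r m)))

-- The case of equality for singular matrices

opaque
  unfolding per

  per-bordered : (x : ℤ) (ρ γ : Fin (suc n) → ℤ) (B : Matrix (suc n)) →
    per (bordered x ρ γ B) ≡ x * per B + sum (λ j → sum (λ i → ρ j * (γ i * per (minor i j B))))
  per-bordered {n} x ρ γ B = cong (x * per B +_) (sum-cong-≗ λ j → trans
    (cong (ρ j *_) (per-firstColumn (minor zero (suc j) (bordered x ρ γ B))))
    (sym (sum-scale (ρ j) (λ i → γ i * per (minor i j B)))))

-- Row `i` and column `j` are moved to the front, and the equivalence of the minor is applied to the
-- other rows and columns. This only permutes and rescales the border, which therefore still
-- consists of signs.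
bordered≅ : (A : Matrix (suc n)) → IsSignMatrix A → (i j : Fin (suc n)) {B : Matrix n} → minor i j A ≅ B →
  ∃ λ x → ∃ λ ρ → ∃ λ γ → IsSign x × SignVector ρ × SignVector γ × A ≅ bordered x ρ γ B
bordered≅ {n} A A-sign i j {B} (mk≅ π σ x y xs ys e) =
  A i j , (λ b → y (σ ⟨$⟩ˡ b) * A i (punchIn j (σ ⟨$⟩ˡ b))) , (λ a → x (π ⟨$⟩ˡ a) * A (punchIn i (π ⟨$⟩ˡ a)) j) ,
  A-sign i j , (λ b → sign-* (ys _) (A-sign _ _)) , (λ a → sign-* (xs _) (A-sign _ _)) ,
  ≅-trans (≅-sym A′≅A) (mk≅ (lift₀ π) (lift₀ σ) X Y X-sign Y-sign λ where
    zero    zero    → sym (trans (ℤₚ.*-identityˡ _) (ℤₚ.*-identityˡ _))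
    zero    (suc b) → sym (trans (ℤₚ.*-identityˡ _) (trans (cong (λ k → y b * (y k * A i (punchIn j k))) (Perm.inverseˡ σ))
                        (sign-cancel (ys b) _)))
    (suc a) zero    → sym (trans (cong (x a *_) (ℤₚ.*-identityˡ _)) (trans (cong (λ k → x a * (x k * A (punchIn i k) j)) (Perm.inverseˡ π))
                        (sign-cancel (xs a) _)))
    (suc a) (suc b) → e a b)
  where
  A′ : Matrix (suc n)
  A′ a b = A (insert zero i Perm.id ⟨$⟩ʳ a) (insert zero j Perm.id ⟨$⟩ʳ b)
  A′≅A : A′ ≅ A
  A′≅A = permuted≅ (insert zero i Perm.id) (insert zero j Perm.id) λ _ _ → refl
  X Y : Fin (suc n) → ℤ
  X zero    = 1ℤ
  X (suc a) = x a
  Y zero    = 1ℤ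
  Y (suc b) = y b
  X-sign : SignVector X
  X-sign zero    = inj₁ refl
  X-sign (suc a) = xs a
  Y-sign : SignVector Y
  Y-sign zero    = inj₁ refl
  Y-sign (suc b) = ys b

sum-mono : {f g : Fin n → ℤ} → (∀ j → f j ≤ℤ g j) → sum f ≤ℤ sum g
sum-mono {zero}  f≤g = ℤₚ.≤-refl
sum-mono {suc n} f≤g = ℤₚ.+-mono-≤ (f≤g zero) (sum-mono (f≤g ∘ suc))

tight-+ : ∀ {a b c d} → a ≤ℤ c → b ≤ℤ d → a + b ≡ c + d → a ≡ c × b ≡ d
tight-+ {a} {b} {c} {d} a≤c b≤d e with a ℤₚ.≟ c | b ℤₚ.≟ d
... | yes a≡c | yes b≡d = a≡c , b≡d
... | no  a≢c | _       = contradiction e (ℤₚ.<⇒≢ (ℤₚ.+-mono-<-≤ (ℤₚ.≤∧≢⇒< a≤c a≢c) b≤d))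
... | yes _   | no b≢d  = contradiction e (ℤₚ.<⇒≢ (ℤₚ.+-mono-≤-< a≤c (ℤₚ.≤∧≢⇒< b≤d b≢d)))

tight-sum : {f g : Fin n → ℤ} → (∀ j → f j ≤ℤ g j) → sum f ≡ sum g → ∀ j → f j ≡ g j
tight-sum {suc n} f≤g e with tight-+ (f≤g zero) (sum-mono (f≤g ∘ suc)) e
... | e₀ , e′ = λ where
  zero    → e₀
  (suc j) → tight-sum (f≤g ∘ suc) e′ j

sign-*-≤ : ∀ {ε w} → IsSign ε → 0ℤ ≤ℤ w → ε * w ≤ℤ w
sign-*-≤ {w = w} (inj₁ refl) 0≤w = ℤₚ.≤-reflexive (ℤₚ.*-identityˡ w)
sign-*-≤ {w = w} (inj₂ refl) 0≤w = ℤₚ.≤-trans (ℤₚ.≤-reflexive (ℤₚ.-1*i≡-i w)) (ℤₚ.≤-trans (ℤₚ.neg-mono-≤ 0≤w) 0≤w)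

sign-*-≡ : ∀ {ε w} → IsSign ε → 0ℤ <ℤ w → ε * w ≡ w → ε ≡ 1ℤ
sign-*-≡ {w = w} (inj₁ refl) 0<w e = refl
sign-*-≡ {w = w} (inj₂ refl) 0<w e = contradiction (trans (sym (ℤₚ.-1*i≡-i w)) e)
  (ℤₚ.<⇒≢ (ℤₚ.<-trans (ℤₚ.neg-mono-< 0<w) 0<w))

abs-as-sign : ∀ z → ∃ λ s → IsSign s × s * z ≡ ℤ.+ ∣ z ∣
abs-as-sign z with ℤₚ.+∣i∣≡i⊎+∣i∣≡-i z
... | inj₁ e = 1ℤ  , inj₁ refl , trans (ℤₚ.*-identityˡ z) (sym e)
... | inj₂ e = -1ℤ , inj₂ refl , trans (ℤₚ.-1*i≡-i z) (sym e)

-- If all products `ρ j * γ i` coincide, `ρ` and `γ` are constant. Scaling the first row by the one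
-- value and the first column by the other gives a border of ones.
aligned≅onesBordered : ∀ {x : ℤ} {ρ γ : Fin (suc n) → ℤ} {B : Matrix (suc n)} →
  SignVector ρ → SignVector γ → (∀ i j → ρ j * γ i ≡ x) → bordered x ρ γ B ≅ onesBordered B
aligned≅onesBordered {n} {x} {ρ} {γ} {B} ρs γs aligned = mk≅ Perm.id Perm.id X Y
  (λ where zero → ρs zero ; (suc _) → inj₁ refl) (λ where zero → γs zero ; (suc _) → inj₁ refl) λ where
    zero    zero    → trans (sym (aligned zero zero)) (ring (ρ zero) (γ zero))
    zero    (suc j) → trans (ρ-const j) (ring (ρ zero) 1ℤ)
    (suc i) zero    → trans (γ-const i) (ring′ (γ zero))
    (suc i) (suc j) → sym (trans (ℤₚ.*-identityˡ _) (ℤₚ.*-identityˡ _))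
  where
  X Y : Fin (suc (suc n)) → ℤ
  X zero    = ρ zero
  X (suc _) = 1ℤ
  Y zero    = γ zero
  Y (suc _) = 1ℤ
  ring : ∀ a b → a * b ≡ a * (b * 1ℤ)
  ring = ℤ-Solver.solve-∀
  ring′ : ∀ b → b ≡ 1ℤ * (b * 1ℤ)
  ring′ = ℤ-Solver.solve-∀
  ρ-const : ∀ j → ρ j ≡ ρ zero * 1ℤ
  ρ-const j = trans (solve-for (γs zero) (ρ j)) (trans (cong (_* γ zero) (trans (aligned zero j) (sym (aligned zero zero))))
    (trans (sym (solve-for (γs zero) (ρ zero))) (sym (ℤₚ.*-identityʳ (ρ zero)))))
    where
    solve-for : ∀ {g} → IsSign g → ∀ z → z ≡ z * g * g
    solve-for {g} gs z = sym (trans (ℤₚ.*-assoc z g g) (trans (cong (z *_) (sign-square gs)) (ℤₚ.*-identityʳ z)))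
  γ-const : ∀ i → γ i ≡ γ zero
  γ-const i = trans (sym (sign-cancel (ρs zero) (γ i))) (trans (cong (ρ zero *_) (trans (aligned i zero) (sym (aligned zero zero))))
    (sign-cancel (ρs zero) (γ zero)))

PositiveMinors : Matrix (suc n) → Set
PositiveMinors B = 0ℤ <ℤ per B × (∀ i j → 0ℤ <ℤ per (minor i j B))

-- By `per-bordered` the permanent is a sum of the positive numbers `per B` and `per (minor i j B)`
-- with coefficients 1 or -1, and for a border of ones all coefficients are 1. Equality up to the
-- sign `s` forces every coefficient to be `s`, that is, the border is aligned.
bordered-tight : ∀ {x : ℤ} {ρ γ : Fin (suc n) → ℤ} {B : Matrix (suc n)} → PositiveMinors B →
  IsSign x → SignVector ρ → SignVector γ → ℤ.+ ∣ per (bordered x ρ γ B) ∣ ≡ per (onesBordered B) →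
  bordered x ρ γ B ≅ onesBordered B
bordered-tight {n} {x} {ρ} {γ} {B} (B>0 , M>0) xs ρs γs e with abs-as-sign (per (bordered x ρ γ B))
... | s , ss , s·per = aligned≅onesBordered ρs γs λ i j → unsigned (trans (aligned i j) (sym sx≡1))
  where
  M : Fin (suc n) → Fin (suc n) → ℤ
  M i j = per (minor i j B)
  inner outer : Fin (suc n) → ℤ
  inner j = sum (λ i → s * ρ j * γ i * M i j)
  outer j = sum (λ i → M i j)
  signed-inner : ∀ i j → IsSign (s * ρ j * γ i)
  signed-inner i j = sign-* (sign-* ss (ρs j)) (γs i)
  ring₁ : ∀ s x p t → s * (x * p + t) ≡ s * x * p + s * t
  ring₁ = ℤ-Solver.solve-∀
  ring₂ : ∀ s a b c → s * (a * (b * c)) ≡ s * a * b * c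
  ring₂ = ℤ-Solver.solve-∀
  ring₃ : ∀ c → 1ℤ * (1ℤ * c) ≡ c
  ring₃ = ℤ-Solver.solve-∀
  total : s * x * per B + sum inner ≡ per B + sum outer
  total = begin
    s * x * per B + sum inner
      ≡⟨ cong (s * x * per B +_) (sum-cong-≗ λ j → trans (sum-cong-≗ λ i → sym (ring₂ s (ρ j) (γ i) (M i j)))
           (sum-scale s (λ i → ρ j * (γ i * M i j)))) ⟩
    s * x * per B + sum (λ j → s * sum (λ i → ρ j * (γ i * M i j)))
      ≡⟨ cong (s * x * per B +_) (sum-scale s (λ j → sum (λ i → ρ j * (γ i * M i j)))) ⟩
    s * x * per B + s * sum (λ j → sum (λ i → ρ j * (γ i * M i j)))
      ≡⟨ ring₁ s x (per B) (sum (λ j → sum (λ i → ρ j * (γ i * M i j)))) ⟨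
    s * (x * per B + sum (λ j → sum (λ i → ρ j * (γ i * M i j))))
      ≡⟨ cong (s *_) (per-bordered x ρ γ B) ⟨
    s * per (bordered x ρ γ B)
      ≡⟨ trans s·per e ⟩
    per (onesBordered B)
      ≡⟨ per-bordered 1ℤ (λ _ → 1ℤ) (λ _ → 1ℤ) B ⟩
    1ℤ * per B + sum (λ j → sum (λ i → 1ℤ * (1ℤ * M i j)))
      ≡⟨ cong₂ _+_ (ℤₚ.*-identityˡ (per B)) (sum-cong-≗ λ j → sum-cong-≗ λ i → ring₃ (M i j)) ⟩
    per B + sum outer ∎
    where open ≡-Reasoning
  inner≤outer : ∀ j → inner j ≤ℤ outer j
  inner≤outer j = sum-mono λ i → sign-*-≤ (signed-inner i j) (ℤₚ.<⇒≤ (M>0 i j))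
  tight = tight-+ (sign-*-≤ (sign-* ss xs) (ℤₚ.<⇒≤ B>0)) (sum-mono inner≤outer) total
  sx≡1 : s * x ≡ 1ℤ
  sx≡1 = sign-*-≡ (sign-* ss xs) B>0 (proj₁ tight)
  aligned : ∀ i j → s * ρ j * γ i ≡ 1ℤ
  aligned i j = sign-*-≡ (signed-inner i j) (M>0 i j)
    (tight-sum (λ i → sign-*-≤ (signed-inner i j) (ℤₚ.<⇒≤ (M>0 i j))) (tight-sum inner≤outer (proj₂ tight) j) i)
  unsigned : ∀ {y z} → s * y * z ≡ s * x → y * z ≡ x
  unsigned {y} {z} eq = trans (sym (sign-cancel ss (y * z)))
    (trans (cong (s *_) (trans (sym (ℤₚ.*-assoc s y z)) eq)) (sign-cancel ss x))

-- Deleting row i and column j of Δ χ leaves, after moving column i to the place of column j,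
-- a matrix Δ χ′ where χ′ is χ with i and j deleted.

erase : Fin n → (Fin n → Bool) → Fin n → Bool
erase j χ k = χ k ∧ not (does (k ≟ j))

transpose-first : (i j : Fin n) → Perm.transpose i j ⟨$⟩ʳ i ≡ j
transpose-first i j rewrite dec-true (i ≟ i) refl = refl

transpose-second : (i j : Fin n) → i ≢ j → Perm.transpose i j ⟨$⟩ʳ j ≡ i
transpose-second i j i≢j rewrite dec-false (j ≟ i) (i≢j ∘ sym) | dec-true (j ≟ j) refl = refl

transpose-other : (i j k : Fin n) → k ≢ i → k ≢ j → Perm.transpose i j ⟨$⟩ʳ k ≡ k
transpose-other i j k k≢i k≢j rewrite dec-false (k ≟ i) k≢i | dec-false (k ≟ j) k≢j = refl

per-minor-Δ : (χ : Fin (suc n) → Bool) (i j : Fin (suc n)) → per (minor i j (Δ χ)) ≡ per (Δ (erase j χ ∘ punchIn i))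
per-minor-Δ {n} χ i j = trans (sym (per-permuteColumns (minor i j (Δ χ)) (remove i τ))) (per-cong λ a b →
  trans (cong (Δ χ (punchIn i a)) (trans (cong (λ k → punchIn k (remove i τ ⟨$⟩ʳ b)) (sym (transpose-first i j)))
                                         (sym (Perm.punchIn-permute τ i b))))
        (entries a b))
  where
  τ = Perm.transpose i j
  ∧-false : ∀ b c → b ∧ (c ∧ false) ≡ false
  ∧-false true  true  = refl
  ∧-false true  false = refl
  ∧-false false c     = refl
  ∧-true : ∀ c → c ≡ c ∧ true
  ∧-true true  = refl
  ∧-true false = refl
  entries : ∀ a b → Δ χ (punchIn i a) (τ ⟨$⟩ʳ punchIn i b) ≡ Δ (erase j χ ∘ punchIn i) a b
  entries a b with punchIn i b ≟ j
  ... | yes q≡j = trans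
        (trans (cong (λ k → Δ χ (punchIn i a) (τ ⟨$⟩ʳ k)) q≡j)
          (trans (cong (Δ χ (punchIn i a)) (transpose-second i j (λ i≡j → punchInᵢ≢i i b (trans q≡j (sym i≡j)))))
                 (Δ-off χ (punchInᵢ≢i i a))))
        (sym (erased (a ≟ b)))
    where
    erased : Dec (a ≡ b) → Δ (erase j χ ∘ punchIn i) a b ≡ 1ℤ
    erased (no a≢b)   = Δ-off (erase j χ ∘ punchIn i) a≢b
    erased (yes refl) rewrite dec-true (punchIn i a ≟ j) q≡j | ∧-false (does (a ≟ a)) (χ (punchIn i a)) = refl
  ... | no q≢j = trans (cong (Δ χ (punchIn i a)) (transpose-other i j (punchIn i b) (punchInᵢ≢i i b) q≢j)) (kept (a ≟ b))
    where
    kept : Dec (a ≡ b) → Δ χ (punchIn i a) (punchIn i b) ≡ Δ (erase j χ ∘ punchIn i) a b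
    kept (no a≢b)   = trans (Δ-off χ (a≢b ∘ punchIn-injective i a b)) (sym (Δ-off (erase j χ ∘ punchIn i) a≢b))
    kept (yes refl) = trans (Δ-diagonal χ (punchIn i a)) (trans (cong (λ b → if b then -1ℤ else 1ℤ)
        (trans (∧-true (χ (punchIn i a))) (cong (λ b → χ (punchIn i a) ∧ not b) (sym (dec-false (punchIn i a ≟ j) q≢j)))))
      (sym (Δ-diagonal (erase j χ ∘ punchIn i) a)))

count-mono : (χ χ′ : Fin n → Bool) → (∀ i → χ i ≡ true → χ′ i ≡ true) → count χ ≤ count χ′
count-mono {zero}  χ χ′ imp = z≤n
count-mono {suc n} χ χ′ imp = ℕₚ.+-mono-≤ (head (χ zero) (χ′ zero) (imp zero)) (count-mono (χ ∘ suc) (χ′ ∘ suc) (imp ∘ suc))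
  where
  head : ∀ b b′ → (b ≡ true → b′ ≡ true) → (if b then 1 else 0) ≤ (if b′ then 1 else 0)
  head false _     _   = z≤n
  head true  true  _   = ℕₚ.≤-refl
  head true  false imp = case imp refl of λ ()

count-punchIn : (χ : Fin (suc n) → Bool) (i : Fin (suc n)) → count (χ ∘ punchIn i) ≤ count χ
count-punchIn         χ zero    = ℕₚ.m≤n+m (count (χ ∘ suc)) _
count-punchIn {suc n} χ (suc i) = ℕₚ.+-monoʳ-≤ (if χ zero then 1 else 0) (count-punchIn (χ ∘ suc) i)

count-<? : ∀ n r → count {n} (λ i → does (toℕ i ℕₚ.<? r)) ≤ r
count-<? zero    r       = z≤n
count-<? (suc n) zero    = count-<? n zero
count-<? (suc n) (suc r) = s≤s (count-<? n r)

D-positiveMinors : ∀ n r → 0ℤ <ℤ per (D (suc n) r) → (∀ l → l ≤ r → l ≤ n → 0ℤ <ℤ per (D n l)) → PositiveMinors (D (suc n) r)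
D-positiveMinors n r D>0 pos = D>0 , λ i j → let χ′ = erase j χ ∘ punchIn i in
  subst (0ℤ <ℤ_) (sym (trans (per-minor-Δ χ i j) (per-Δ χ′)))
    (pos (count χ′) (ℕₚ.≤-trans (count-punchIn (erase j χ) i) (ℕₚ.≤-trans (count-mono (erase j χ) χ (λ k → erased (χ k)))
      (count-<? (suc n) r))) (count≤ χ′))
  where
  χ : Fin (suc n) → Bool
  χ i = does (toℕ i ℕₚ.<? r)
  erased : ∀ b {c} → b ∧ c ≡ true → b ≡ true
  erased true _ = refl

RankAtMost : Matrix n → ℕ → Set
RankAtMost {n} A k = ∀ {m} (s : Fin m → Fin n) → Independent (A ∘ s) → m ≤ k

-- In contrast to `Bound`, the rank is also bounded above: `D(3,1)` and `D(3,2)` both have permanent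
-- 2, and `D(4,2)` and `D(4,4)` both have permanent 8.
Equality : ℕ → ℕ → Set
Equality m r = ∀ {n} → n ≡ suc m +ℕ r → (A : Matrix n) → IsSignMatrix A →
  (s : Fin (suc r) → Fin n) → Independent (A ∘ s) → RankAtMost A (suc r) → ∣ per A ∣ ≡ N m r → A ≅ D n r

count-all : (χ : Fin n → Bool) → (∀ j → χ j ≡ true) → count χ ≡ n
count-all {zero}  χ all = refl
count-all {suc n} χ all rewrite all zero = cong suc (count-all (χ ∘ suc) (all ∘ suc))

pred-< : ∀ {a b} → a < b → ℕ.pred b < b
pred-< {b = suc b} _ = ℕₚ.n<1+n b

∃-or-∀≢ : (χ : Fin n → Bool) (f : Fin n → ℕ) (v : ℕ) →
  (∃ λ j → χ j ≡ false × f j ≡ v) ⊎ (∀ j → χ j ≡ false → f j ≢ v)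
∃-or-∀≢ χ f v with any? (λ j → (χ j 𝔹ₚ.≟ false) ×-dec (f j ℕₚ.≟ v))
... | yes found = inj₁ found
... | no  none  = inj₂ λ j e eq → none (j , e , eq)

some-false : (χ : Fin n → Bool) → count χ < n → ∃ λ j → χ j ≡ false
some-false χ c<n with any? (λ j → χ j 𝔹ₚ.≟ false)
... | yes found = found
... | no  none  = contradiction (count-all χ λ j → not-false (χ j) (λ e → none (j , e))) (ℕₚ.<⇒≢ c<n)
  where
  not-false : ∀ b → b ≢ false → b ≡ true
  not-false true  _ = refl
  not-false false ≢ = contradiction refl ≢

module _ (m r : ℕ) (smaller : SmallerBound (suc m) r) {A : Matrix (suc n)} (n≡ : n ≡ suc m +ℕ r)
         (A-sign : IsSignMatrix A) (S : Splitting A r) where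
  open Splitting S

  -- If every regular minor stayed below `N m r`, its predecessor would bound them all and the
  -- Laplace sum would be too small. The estimate of the regular minors is a hypothesis, not
  -- `Bound m r`, so that the argument also serves `n = 5`, `r = 3`, where that bound fails.
  extremal-column : (∀ j → critical j ≡ false → ∣ per (minor row j A) ∣ ≤ N m r) → ∣ per A ∣ ≡ N (suc m) r →
    ∃ λ j → critical j ≡ false × ∣ per (minor row j A) ∣ ≡ N m r
  extremal-column regular-≤ tight with ∃-or-∀≢ critical (λ j → ∣ per (minor row j A) ∣) (N m r)
  ... | inj₁ found = found
  ... | inj₂ none  = contradiction tight (ℕₚ.<⇒≢ (ℕₚ.≤-<-trans
        (minor-sum-≤ A A-sign m r n≡ S smaller (ℕ.pred (N m r)) (ℕₚ.≤-trans ℕₚ.pred[n]≤n (criticalValue-≥ m r))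
          (λ j e → ℕₚ.<⇒≤pred (below j e)))
        (subst (r *ℕ criticalValue m r +ℕ suc (suc m) *ℕ ℕ.pred (N m r) <_) (N-laplace m r)
          (ℕₚ.+-monoʳ-< (r *ℕ criticalValue m r) (ℕₚ.*-monoʳ-< (suc (suc m))
            (pred-< (below (proj₁ regular) (proj₂ regular))))))))
    where
    r<n : r < n
    r<n = subst (r <_) (sym n≡) (s≤s (ℕₚ.m≤n+m r m))
    below : ∀ j → critical j ≡ false → ∣ per (minor row j A) ∣ < N m r
    below j e = ℕₚ.≤∧≢⇒< (regular-≤ j e) (none j e)
    -- A regular column exists, whose minor lies below `N m r`; so `N m r` is positive and its
    -- predecessor really smaller.
    regular : ∃ λ j → critical j ≡ false
    regular = some-false critical (ℕₚ.≤-<-trans (critical-count A A-sign S r<n) (ℕₚ.m≤n⇒m≤1+n r<n))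

extremal-minor : ∀ m r → Bound m r → SmallerBound (suc m) r → Equality m r →
  {A : Matrix (suc n)} → n ≡ suc m +ℕ r → IsSignMatrix A → (s : Fin (suc r) → Fin (suc n)) → Independent (A ∘ s) →
  RankAtMost A (suc r) → ∣ per A ∣ ≡ N (suc m) r → ∃ λ i → ∃ λ j → minor i j A ≅ D n r
extremal-minor {n} m r bound smaller equality {A} n≡ A-sign s ind rank≤ tight =
  go (splitting A s ind r<n)
  where
  r<n : r < n
  r<n = subst (r <_) (sym n≡) (s≤s (ℕₚ.m≤n+m r m))
  go : Splitting A r → ∃ λ i → ∃ λ j → minor i j A ≅ D n r
  go S = row , j , equality n≡ (minor row j A) (minor-sign row j A-sign) rest (minor-independent A A-sign S r<n j (proj₁ (proj₂ found)))
      (λ s′ ind′ → rank≤ (punchIn row ∘ s′) (dropColumn-independent⁻¹ j (A ∘ punchIn row ∘ s′) ind′))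
      (proj₂ (proj₂ found))
    where
    open Splitting S
    found = extremal-column m r smaller n≡ A-sign S (regular-minor-≤ A A-sign m r n≡ S smaller bound) tight
    j = proj₁ found

≅-independent-selection : {A B : Matrix n} (A≅B : A ≅ B) {s : Fin m → Fin n} →
  Independent (A ∘ s) → Independent (λ k → B (_≅_.π A≅B ⟨$⟩ʳ s k))
≅-independent-selection {A = A} {B} (mk≅ π σ x y xs ys e) {s} ind a a·≡0 k =
  trans (sym (sign-cancel (xs (s k)) (a k))) (trans (cong (x (s k) *_) (ind b b·≡0 k)) (ℤₚ.*-zeroʳ (x (s k))))
  where
  b : Fin _ → ℤ
  b k = x (s k) * a k
  ring : ∀ x a y z → x * a * (x * (y * z)) ≡ y * (x * (x * (a * z)))
  ring = ℤ-Solver.solve-∀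
  b·≡0 : ∀ j → combination b (A ∘ s) j ≡ 0ℤ
  b·≡0 j = trans
    (sum-cong-≗ λ k → trans (cong (b k *_) (e (s k) j)) (trans (ring (x (s k)) (a k) (y j) (B (π ⟨$⟩ʳ s k) (σ ⟨$⟩ʳ j)))
       (cong (y j *_) (sign-cancel (xs (s k)) (a k * B (π ⟨$⟩ʳ s k) (σ ⟨$⟩ʳ j))))))
    (trans (sum-scale (y j) (λ k → a k * B (π ⟨$⟩ʳ s k) (σ ⟨$⟩ʳ j)))
      (trans (cong (y j *_) (a·≡0 (σ ⟨$⟩ʳ j))) (ℤₚ.*-zeroʳ (y j))))

rankAtMost-≅ : {A B : Matrix n} {k : ℕ} → A ≅ B → RankAtMost A k → RankAtMost B k
rankAtMost-≅ A≅B rank≤ s ind = rank≤ _ (≅-independent-selection (≅-sym A≅B) {s} ind)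

module _ (m r : ℕ) (bound : Bound m r) (smaller : SmallerBound (suc m) r) (equality : Equality m r) where

  -- Leaves only the question which borders of `D n r` are extremal. It is answered by positive
  -- minors in general and by search in small orders.
  singular-equality-via :
    (∀ {n} → n ≡ suc m +ℕ r → ∀ x (ρ γ : Fin n → ℤ) → IsSign x → SignVector ρ → SignVector γ →
      RankAtMost (bordered x ρ γ (D n r)) (suc r) → ∣ per (bordered x ρ γ (D n r)) ∣ ≡ N (suc m) r →
      bordered x ρ γ (D n r) ≅ D (suc n) r) →
    Equality (suc m) r
  singular-equality-via unique {suc n} n≡ A A-sign s ind rank≤ tight =
    go (extremal-minor m r bound smaller equality n≡′ A-sign s ind rank≤ tight)
    where
    n≡′ = ℕₚ.suc-injective n≡
    finish : (∃ λ x → ∃ λ ρ → ∃ λ γ → IsSign x × SignVector ρ × SignVector γ × A ≅ bordered x ρ γ (D n r)) → A ≅ D (suc n) r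
    finish (x , ρ , γ , xs , ρs , γs , A≅) =
      ≅-trans A≅ (unique n≡′ x ρ γ xs ρs γs (rankAtMost-≅ A≅ rank≤) (trans (sym (≅-per A≅)) tight))
    go : (∃ λ i → ∃ λ j → minor i j A ≅ D n r) → A ≅ D (suc n) r
    go (i , j , minor≅) = finish (bordered≅ A A-sign i j minor≅)

  singular-equality : 0 < N m r → (∀ l → l ≤ r → l ≤ m +ℕ r → 0ℤ <ℤ per (D (m +ℕ r) l)) → Equality (suc m) r
  singular-equality N>0 pos = singular-equality-via unique
    where
    unique : ∀ {n} → n ≡ suc m +ℕ r → ∀ x (ρ γ : Fin n → ℤ) → IsSign x → SignVector ρ → SignVector γ →
      RankAtMost (bordered x ρ γ (D n r)) (suc r) → ∣ per (bordered x ρ γ (D n r)) ∣ ≡ N (suc m) r →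
      bordered x ρ γ (D n r) ≅ D (suc n) r
    unique {suc n} n≡ x ρ γ xs ρs γs _ tight = ≅-trans
      (bordered-tight positive xs ρs γs (trans (cong ℤ.+_ tight) (sym ones)))
      (onesBordered≅D (suc n) r r≤n)
      where
      r≤n : r ≤ suc n
      r≤n = subst (r ≤_) (sym n≡) (ℕₚ.m≤n+m r (suc m))
      positive : PositiveMinors (D (suc n) r)
      positive = D-positiveMinors n r (subst (0ℤ <ℤ_) (sym (per-D m r (suc n) n≡)) (ℤ.+<+ N>0))
        (subst (λ n → ∀ l → l ≤ r → l ≤ n → 0ℤ <ℤ per (D n l)) (sym (ℕₚ.suc-injective n≡)) pos)
      ones : per (onesBordered (D (suc n) r)) ≡ ℤ.+ N (suc m) r
      ones = trans (per-onesBordered (suc n) r r≤n) (per-D (suc m) r (suc (suc n)) (cong suc n≡))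

-- Laplace expansion along two rows

twoRows : (Fin (suc (suc n)) → ℤ) → (Fin (suc (suc n)) → ℤ) → Rows n (suc (suc n)) → Matrix (suc (suc n))
twoRows x y B zero          = x
twoRows x y B (suc zero)    = y
twoRows x y B (suc (suc i)) = B i

minor₂ : Rows n (suc (suc n)) → Fin (suc (suc n)) → Fin (suc n) → Matrix n
minor₂ B j k a b = B a (punchIn j (punchIn k b))

-- The permanent as a symmetric bilinear form in its first two rows, which may then be arbitrary
-- integer vectors.
per₂ : (Fin (suc (suc n)) → ℤ) → (Fin (suc (suc n)) → ℤ) → Rows n (suc (suc n)) → ℤ
per₂ x y B = sum (λ j → x j * sum (λ k → y (punchIn j k) * per (minor₂ B j k)))

opaque
  unfolding per

  per-twoRows : ∀ x y (B : Rows n (suc (suc n))) → per (twoRows x y B) ≡ per₂ x y B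
  per-twoRows x y B = refl

  per-splitRows : (A : Matrix (suc (suc n))) → per A ≡ per₂ (A zero) (A (suc zero)) (λ i → A (suc (suc i)))
  per-splitRows A = refl

per₂-comm : ∀ x y (B : Rows n (suc (suc n))) → per₂ x y B ≡ per₂ y x B
per₂-comm x y B = trans (sym (per-twoRows x y B)) (trans (sym (per-permuteRows (twoRows x y B) (Perm.transpose zero (suc zero)))) (trans (per-cong λ where
  zero          j → refl
  (suc zero)    j → refl
  (suc (suc i)) j → refl) (per-twoRows y x B)))

per₂-congˡ : ∀ {x x′ : Fin (suc (suc n)) → ℤ} y (B : Rows n (suc (suc n))) → x ≗ x′ → per₂ x y B ≡ per₂ x′ y B
per₂-congˡ y B x≗x′ = sum-cong-≗ λ j → cong (_* sum (λ k → y (punchIn j k) * per (minor₂ B j k))) (x≗x′ j)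

per₂-congʳ : ∀ x {y y′ : Fin (suc (suc n)) → ℤ} (B : Rows n (suc (suc n))) → y ≗ y′ → per₂ x y B ≡ per₂ x y′ B
per₂-congʳ x {y} {y′} B y≗y′ = trans (per₂-comm x y B) (trans (per₂-congˡ x B y≗y′) (per₂-comm y′ x B))

per₂-+ : ∀ x x′ y (B : Rows n (suc (suc n))) → per₂ (λ j → x j + x′ j) y B ≡ per₂ x y B + per₂ x′ y B
per₂-+ x x′ y B = trans
  (sum-cong-≗ λ j → ℤₚ.*-distribʳ-+ (rest j) (x j) (x′ j))
  (∑-distrib-+ (λ j → x j * rest j) (λ j → x′ j * rest j))
  where
  rest : _ → ℤ
  rest j = sum (λ k → y (punchIn j k) * per (minor₂ B j k))

per₂-neg : ∀ x y (B : Rows n (suc (suc n))) → per₂ (λ j → - x j) y B ≡ - per₂ x y B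
per₂-neg x y B = trans
  (sum-cong-≗ λ j → ring (x j) (rest j))
  (trans (sum-scale -1ℤ (λ j → x j * rest j)) (ℤₚ.-1*i≡-i (per₂ x y B)))
  where
  rest : _ → ℤ
  rest j = sum (λ k → y (punchIn j k) * per (minor₂ B j k))
  ring : ∀ a b → - a * b ≡ -1ℤ * (a * b)
  ring = ℤ-Solver.solve-∀

per₂-square : ∀ u w (B : Rows n (suc (suc n))) →
  per₂ (λ j → u j + w j) (λ j → u j + w j) B ≡ per₂ u u B + (per₂ u w B + per₂ u w B) + per₂ w w B
per₂-square u w B = begin
  per₂ v v B                                                  ≡⟨ per₂-+ u w v B ⟩
  per₂ u v B + per₂ w v B                                     ≡⟨ cong₂ _+_ (expand u) (expand w) ⟩
  (per₂ u u B + per₂ w u B) + (per₂ u w B + per₂ w w B)       ≡⟨ cong (λ z → (per₂ u u B + z) + (per₂ u w B + per₂ w w B)) (per₂-comm w u B) ⟩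
  (per₂ u u B + per₂ u w B) + (per₂ u w B + per₂ w w B)       ≡⟨ ring (per₂ u u B) (per₂ u w B) (per₂ w w B) ⟩
  per₂ u u B + (per₂ u w B + per₂ u w B) + per₂ w w B         ∎
  where
  open ≡-Reasoning
  v : _ → ℤ
  v j = u j + w j
  expand : ∀ x → per₂ x v B ≡ per₂ u x B + per₂ w x B
  expand x = trans (per₂-comm x v B) (per₂-+ u w x B)
  ring : ∀ a b c → (a + b) + (b + c) ≡ a + (b + b) + c
  ring = ℤ-Solver.solve-∀

per₂-difference : ∀ u w (B : Rows n (suc (suc n))) →
  per₂ (λ j → u j + w j) (λ j → u j + - w j) B ≡ per₂ u u B - per₂ w w B
per₂-difference u w B = begin
  per₂ v v⁻ B                                                       ≡⟨ per₂-+ u w v⁻ B ⟩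
  per₂ u v⁻ B + per₂ w v⁻ B                                         ≡⟨ cong₂ _+_ (expand u) (expand w) ⟩
  (per₂ u u B - per₂ w u B) + (per₂ u w B - per₂ w w B)             ≡⟨ cong (λ z → (per₂ u u B - z) + (per₂ u w B - per₂ w w B)) (per₂-comm w u B) ⟩
  (per₂ u u B - per₂ u w B) + (per₂ u w B - per₂ w w B)             ≡⟨ ring (per₂ u u B) (per₂ u w B) (per₂ w w B) ⟩
  per₂ u u B - per₂ w w B                                           ∎
  where
  open ≡-Reasoning
  v v⁻ : _ → ℤ
  v j = u j + w j
  v⁻ j = u j + - w j
  expand : ∀ x → per₂ x v⁻ B ≡ per₂ u x B - per₂ w x B
  expand x = trans (per₂-comm x v⁻ B) (trans (per₂-+ u (λ j → - w j) x B) (cong (per₂ u x B +_) (per₂-neg w x B)))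
  ring : ∀ a b c → (a - b) + (b - c) ≡ a - c
  ring = ℤ-Solver.solve-∀

indicator : Bool → ℕ
indicator b = if b then 1 else 0

SupportedOn : (Fin n → Bool) → (Fin n → ℤ) → Set
SupportedOn χ x = ∀ j → ∣ x j ∣ ≡ indicator (χ j)

sumℕ-indicator : (χ : Fin n → Bool) (M : ℕ) → sumℕ (λ j → if χ j then M else 0) ≡ count χ *ℕ M
sumℕ-indicator {zero}  χ M = refl
sumℕ-indicator {suc n} χ M with χ zero
... | true  = cong (M +ℕ_) (sumℕ-indicator (χ ∘ suc) M)
... | false = sumℕ-indicator (χ ∘ suc) M

indicator-*-≤ : ∀ b {a M} → (b ≡ true → a ≤ M) → indicator b *ℕ a ≤ (if b then M else 0)
indicator-*-≤ false     _   = z≤n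
indicator-*-≤ true  {a} a≤M = subst (_≤ _) (sym (ℕₚ.+-identityʳ a)) (a≤M refl)

abs-sum-supported : (χ : Fin n → Bool) (x w : Fin n → ℤ) (M : ℕ) → SupportedOn χ x →
  (∀ j → χ j ≡ true → ∣ w j ∣ ≤ M) → ∣ sum (λ j → x j * w j) ∣ ≤ count χ *ℕ M
abs-sum-supported χ x w M supp w≤M = begin
  ∣ sum (λ j → x j * w j) ∣                   ≤⟨ abs-sum (λ j → x j * w j) ⟩
  sumℕ (λ j → ∣ x j * w j ∣)                  ≤⟨ sumℕ-mono (λ j → subst (_≤ (if χ j then M else 0))
                                                   (sym (trans (ℤₚ.abs-* (x j) (w j)) (cong (_*ℕ ∣ w j ∣) (supp j))))
                                                   (indicator-*-≤ (χ j) (w≤M j))) ⟩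
  sumℕ (λ j → if χ j then M else 0)           ≡⟨ sumℕ-indicator χ M ⟩
  count χ *ℕ M                                ∎
  where open ℕₚ.≤-Reasoning

per₂-≤ : (χ ψ : Fin (suc (suc n)) → Bool) (x y : Fin (suc (suc n)) → ℤ) (B : Rows n (suc (suc n))) (c M : ℕ) →
  SupportedOn χ x → SupportedOn ψ y → (∀ j → χ j ≡ true → count (ψ ∘ punchIn j) ≤ c) →
  (∀ j k → χ j ≡ true → ψ (punchIn j k) ≡ true → ∣ per (minor₂ B j k) ∣ ≤ M) →
  ∣ per₂ x y B ∣ ≤ count χ *ℕ (c *ℕ M)
per₂-≤ χ ψ x y B c M x-supp y-supp c-bound M-bound = abs-sum-supported χ x
  (λ j → sum (λ k → y (punchIn j k) * per (minor₂ B j k))) (c *ℕ M) x-supp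
  λ j χj → ℕₚ.≤-trans
    (abs-sum-supported (ψ ∘ punchIn j) (y ∘ punchIn j) (λ k → per (minor₂ B j k)) M (λ k → y-supp (punchIn j k)) (λ k → M-bound j k χj))
    (ℕₚ.*-monoˡ-≤ M (c-bound j χj))

count-punchIn-≡ : (χ : Fin (suc n) → Bool) (j : Fin (suc n)) → count χ ≡ indicator (χ j) +ℕ count (χ ∘ punchIn j)
count-punchIn-≡         χ zero    = refl
count-punchIn-≡ {suc n} χ (suc j) = trans (cong (indicator (χ zero) +ℕ_) (count-punchIn-≡ (χ ∘ suc) j))
  (ring (indicator (χ zero)) (indicator (χ (suc j))) (count (χ ∘ suc ∘ punchIn j)))
  where
  ring : ∀ a b c → a +ℕ (b +ℕ c) ≡ b +ℕ (a +ℕ c)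
  ring = ℕ-Solver.solve-∀

count-punchIn-true : (χ : Fin (suc n) → Bool) (j : Fin (suc n)) → χ j ≡ true → count (χ ∘ punchIn j) ≡ ℕ.pred (count χ)
count-punchIn-true χ j χj = cong ℕ.pred (sym (trans (count-punchIn-≡ χ j) (cong (λ b → indicator b +ℕ count (χ ∘ punchIn j)) χj)))

per₂-diagonal-≤ : (χ : Fin (suc (suc n)) → Bool) (u : Fin (suc (suc n)) → ℤ) (B : Rows n (suc (suc n))) (M : ℕ) →
  SupportedOn χ u → (∀ j k → χ j ≡ true → χ (punchIn j k) ≡ true → ∣ per (minor₂ B j k) ∣ ≤ M) →
  ∣ per₂ u u B ∣ ≤ count χ *ℕ (ℕ.pred (count χ) *ℕ M)
per₂-diagonal-≤ χ u B M supp = per₂-≤ χ χ u u B (ℕ.pred (count χ)) M supp supp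
  (λ j χj → ℕₚ.≤-reflexive (count-punchIn-true χ j χj))

-- The two rows are u + w and u - w, where u and w have disjoint supports; the mixed terms cancel.

module TwoRows (A : Matrix (suc (suc n))) (A-sign : IsSignMatrix A) where
  agree differ : Fin (suc (suc n)) → Bool
  agree j = does (A zero j ℤₚ.≟ A (suc zero) j)
  differ = not ∘ agree

  u w : Fin (suc (suc n)) → ℤ
  u j = if agree j then A zero j else 0ℤ
  w j = if agree j then 0ℤ else A zero j

  lower : Rows n (suc (suc n))
  lower i = A (suc (suc i))

  u-supported : SupportedOn agree u
  u-supported j with agree j
  ... | true  = sign-abs (A-sign zero j)
  ... | false = refl

  w-supported : SupportedOn differ w
  w-supported j with agree j
  ... | true  = refl
  ... | false = sign-abs (A-sign zero j)

  row-zero : ∀ j → A zero j ≡ u j + w j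
  row-zero j with agree j
  ... | true  = sym (ℤₚ.+-identityʳ (A zero j))
  ... | false = sym (ℤₚ.+-identityˡ (A zero j))

  row-one : ∀ j → A (suc zero) j ≡ u j + - w j
  row-one j with A zero j ℤₚ.≟ A (suc zero) j
  ... | yes e = trans (sym e) (sym (ℤₚ.+-identityʳ (A zero j)))
  ... | no ne = trans (opposite (A-sign zero j) (A-sign (suc zero) j) ne) (sym (ℤₚ.+-identityˡ (- A zero j)))
    where
    opposite : ∀ {x y} → IsSign x → IsSign y → x ≢ y → y ≡ - x
    opposite (inj₁ refl) (inj₁ refl) ne = contradiction refl ne
    opposite (inj₁ refl) (inj₂ refl) ne = refl
    opposite (inj₂ refl) (inj₁ refl) ne = refl
    opposite (inj₂ refl) (inj₂ refl) ne = contradiction refl ne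

  per-difference : per A ≡ per₂ u u lower - per₂ w w lower
  per-difference = trans (per-splitRows A) (trans (per₂-congˡ (A (suc zero)) lower row-zero)
    (trans (per₂-congʳ (λ j → u j + w j) lower row-one) (per₂-difference u w lower)))

  per-≤ : ∣ per A ∣ ≤ ∣ per₂ u u lower ∣ +ℕ ∣ per₂ w w lower ∣
  per-≤ = subst (λ z → ∣ z ∣ ≤ ∣ per₂ u u lower ∣ +ℕ ∣ per₂ w w lower ∣) (sym per-difference) (ℤₚ.∣i-j∣≤∣i∣+∣j∣ (per₂ u u lower) (per₂ w w lower))

  agree+differ : count agree +ℕ count differ ≡ suc (suc n)
  agree+differ = count-not agree

  uniform-≤ : (M : ℕ) → (∀ j k → ∣ per (minor₂ lower j k) ∣ ≤ M) →
    ∣ per A ∣ ≤ (count agree *ℕ ℕ.pred (count agree) +ℕ count differ *ℕ ℕ.pred (count differ)) *ℕ M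
  uniform-≤ M bound = ℕₚ.≤-trans per-≤ (ℕₚ.≤-trans
    (ℕₚ.+-mono-≤ (per₂-diagonal-≤ agree u lower M u-supported (λ j k _ _ → bound j k))
                 (per₂-diagonal-≤ differ w lower M w-supported (λ j k _ _ → bound j k)))
    (ℕₚ.≤-reflexive (ring (count agree) (ℕ.pred (count agree)) (count differ) (ℕ.pred (count differ)) M)))
    where
    ring : ∀ a a′ b b′ m → a *ℕ (a′ *ℕ m) +ℕ b *ℕ (b′ *ℕ m) ≡ (a *ℕ a′ +ℕ b *ℕ b′) *ℕ m
    ring = ℕ-Solver.solve-∀

-- Here n = 7 + k, and two rows agree in 3 + a places and differ in 3 + b places.

crude<N : ∀ k a b → a +ℕ b ≡ suc k →
  ((3 +ℕ a) *ℕ (2 +ℕ a) +ℕ (3 +ℕ b) *ℕ (2 +ℕ b)) *ℕ N 2 (2 +ℕ k) < N 0 (6 +ℕ k)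
crude<N k a b a+b = begin-strict
  ((3 +ℕ a) *ℕ (2 +ℕ a) +ℕ (3 +ℕ b) *ℕ (2 +ℕ b)) *ℕ N 2 (2 +ℕ k)
    ≤⟨ ℕₚ.*-monoˡ-≤ (N 2 (2 +ℕ k)) pairs ⟩
  (6 +ℕ (4 +ℕ k) *ℕ (3 +ℕ k)) *ℕ N 2 (2 +ℕ k)
    ≡⟨ cong ((6 +ℕ (4 +ℕ k) *ℕ (3 +ℕ k)) *ℕ_) (N-rel 1 (2 +ℕ k)) ⟩
  (6 +ℕ (4 +ℕ k) *ℕ (3 +ℕ k)) *ℕ (((3 +ℕ k) *ℕ x +ℕ 2 *ℕ g) +ℕ 2 *ℕ x)
    <⟨ ℕₚ.m<m+n _ {4 *ℕ (1 +ℕ k) *ℕ g +ℕ (2 *ℕ k *ℕ k +ℕ 10 *ℕ k) *ℕ x}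
         (ℕₚ.≤-trans (N₀-pos (1 +ℕ k)) (ℕₚ.≤-trans (ℕₚ.m≤m+n g ((3 +ℕ 4 *ℕ k) *ℕ g)) (ℕₚ.≤-trans (ℕₚ.≤-reflexive (ring₁ k g)) (ℕₚ.m≤m+n _ _)))) ⟩
  (6 +ℕ (4 +ℕ k) *ℕ (3 +ℕ k)) *ℕ (((3 +ℕ k) *ℕ x +ℕ 2 *ℕ g) +ℕ 2 *ℕ x) +ℕ (4 *ℕ (1 +ℕ k) *ℕ g +ℕ (2 *ℕ k *ℕ k +ℕ 10 *ℕ k) *ℕ x)
    ≡⟨ ring₂ k x g ⟩
  (5 +ℕ k) *ℕ ((4 +ℕ k) *ℕ ((3 +ℕ k) *ℕ x +ℕ 2 *ℕ g) +ℕ 2 *ℕ ((3 +ℕ k) *ℕ x)) ∎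
  where
  open ℕₚ.≤-Reasoning
  -- Unfolding the recursion of `N`, both sides become combinations of these two values; the slack
  -- added above is their difference.
  x = N 1 (2 +ℕ k)
  g = N 0 (3 +ℕ k)
  ring₁ : ∀ k g → g +ℕ (3 +ℕ 4 *ℕ k) *ℕ g ≡ 4 *ℕ (1 +ℕ k) *ℕ g
  ring₁ = ℕ-Solver.solve-∀
  ring₂ : ∀ k x g → (6 +ℕ (4 +ℕ k) *ℕ (3 +ℕ k)) *ℕ (((3 +ℕ k) *ℕ x +ℕ 2 *ℕ g) +ℕ 2 *ℕ x) +ℕ (4 *ℕ (1 +ℕ k) *ℕ g +ℕ (2 *ℕ k *ℕ k +ℕ 10 *ℕ k) *ℕ x) ≡
    (5 +ℕ k) *ℕ ((4 +ℕ k) *ℕ ((3 +ℕ k) *ℕ x +ℕ 2 *ℕ g) +ℕ 2 *ℕ ((3 +ℕ k) *ℕ x))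
  ring₂ = ℕ-Solver.solve-∀
  ring₃ : ∀ a b → (3 +ℕ a) *ℕ (2 +ℕ a) +ℕ (3 +ℕ b) *ℕ (2 +ℕ b) +ℕ 2 *ℕ a *ℕ b ≡ 6 +ℕ (3 +ℕ (a +ℕ b)) *ℕ (2 +ℕ (a +ℕ b))
  ring₃ = ℕ-Solver.solve-∀
  -- Convexity: for a fixed sum `a + b` the number of terms is largest when `a` or `b` is 0, and the
  -- slack is `2ab`.
  pairs : (3 +ℕ a) *ℕ (2 +ℕ a) +ℕ (3 +ℕ b) *ℕ (2 +ℕ b) ≤ 6 +ℕ (4 +ℕ k) *ℕ (3 +ℕ k)
  pairs = ℕₚ.≤-trans (ℕₚ.m≤m+n _ (2 *ℕ a *ℕ b)) (ℕₚ.≤-reflexive (trans (ring₃ a b) (cong (λ z → 6 +ℕ (3 +ℕ z) *ℕ (2 +ℕ z)) a+b)))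

-- Sign vectors that differ in few places, up to a global sign

-- A list of places may contain repetitions, which cancel in pairs, so composing two differences is
-- concatenation. Its length is the number of changed places only if the list is duplicate-free.
flips : List (Fin n) → Fin n → ℤ
flips []       j = 1ℤ
flips (a ∷ as) j = flipSign a j * flips as j

flips-sign : (as : List (Fin n)) → SignVector (flips as)
flips-sign []       j = inj₁ refl
flips-sign (a ∷ as) j = sign-* (flipSign-sign a j) (flips-sign as j)

flips-++ : (as bs : List (Fin n)) (j : Fin n) → flips (as ++ bs) j ≡ flips as j * flips bs j
flips-++ []       bs j = sym (ℤₚ.*-identityˡ (flips bs j))
flips-++ (a ∷ as) bs j = trans (cong (flipSign a j *_) (flips-++ as bs j)) (sym (ℤₚ.*-assoc (flipSign a j) (flips as j) (flips bs j)))

flips-cancel : (a : Fin n) (as : List (Fin n)) → flips (a ∷ a ∷ as) ≗ flips as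
flips-cancel a as j = sign-cancel (flipSign-sign a j) (flips as j)

flips-swap : (a b : Fin n) (as : List (Fin n)) → flips (a ∷ b ∷ as) ≗ flips (b ∷ a ∷ as)
flips-swap a b as j = ring (flipSign a j) (flipSign b j) (flips as j)
  where
  ring : ∀ x y z → x * (y * z) ≡ y * (x * z)
  ring = ℤ-Solver.solve-∀

record Differ (as : List (Fin n)) (x y : Fin n → ℤ) : Set where
  constructor mkDiffer
  field
    scale      : ℤ
    scale-sign : IsSign scale
    differ≡    : ∀ j → y j ≡ scale * (flips as j * x j)

differ-cong : {as bs : List (Fin n)} {x y : Fin n → ℤ} → flips as ≗ flips bs → Differ as x y → Differ bs x y
differ-cong {x = x} as≗bs (mkDiffer s ss e) = mkDiffer s ss λ j → trans (e j) (cong (λ z → s * (z * x j)) (as≗bs j))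

differ-compose : {as bs : List (Fin n)} {x y z : Fin n → ℤ} → Differ as x y → Differ bs x z → Differ (as ++ bs) y z
differ-compose {as = as} {bs} {x} {y} {z} (mkDiffer s ss e) (mkDiffer s′ ss′ e′) = mkDiffer (s * s′) (sign-* ss ss′) λ j → sym (begin
  s * s′ * (flips (as ++ bs) j * y j)
    ≡⟨ cong₂ (λ u v → s * s′ * (u * v)) (flips-++ as bs j) (e j) ⟩
  s * s′ * (flips as j * flips bs j * (s * (flips as j * x j)))
    ≡⟨ ring s s′ (flips as j) (flips bs j) (x j) ⟩
  s * (s * (flips as j * (flips as j * (s′ * (flips bs j * x j)))))
    ≡⟨ sign-cancel ss (flips as j * (flips as j * (s′ * (flips bs j * x j)))) ⟩
  flips as j * (flips as j * (s′ * (flips bs j * x j)))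
    ≡⟨ sign-cancel (flips-sign as j) (s′ * (flips bs j * x j)) ⟩
  s′ * (flips bs j * x j)
    ≡⟨ e′ j ⟨
  z j ∎)
  where
  open ≡-Reasoning
  ring : ∀ s t a b x → s * t * (a * b * (s * (a * x))) ≡ s * (s * (a * (a * (t * (b * x)))))
  ring = ℤ-Solver.solve-∀

differ-refl : (x : Fin n → ℤ) → Differ [] x x
differ-refl x = mkDiffer 1ℤ (inj₁ refl) λ j → sym (trans (ℤₚ.*-identityˡ (1ℤ * x j)) (ℤₚ.*-identityˡ (x j)))

differ-sym : {as : List (Fin n)} {x y : Fin n → ℤ} → Differ as x y → Differ as y x
differ-sym {as = as} {x} {y} d = differ-cong {as = as ++ []} (λ j → trans (flips-++ as [] j) (ℤₚ.*-identityʳ (flips as j)))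
  (differ-compose d (differ-refl x))

differ-cancel : {a : Fin n} {as : List (Fin n)} {x y : Fin n → ℤ} → Differ (a ∷ a ∷ as) x y → Differ as x y
differ-cancel {a = a} {as} = differ-cong {as = a ∷ a ∷ as} (flips-cancel a as)

differ-swap : {a b : Fin n} {as : List (Fin n)} {x y : Fin n → ℤ} → Differ (a ∷ b ∷ as) x y → Differ (b ∷ a ∷ as) x y
differ-swap {a = a} {b} {as} = differ-cong {as = a ∷ b ∷ as} (flips-swap a b as)

dot : (x y : Fin n → ℤ) → ℤ
dot x y = sum (λ j → x j * y j)

flipSign-off : {a j : Fin n} → j ≢ a → flipSign a j ≡ 1ℤ
flipSign-off {a = a} {j} j≢a rewrite dec-false (j ≟ a) j≢a = refl

flipSign-at : (a : Fin n) → flipSign a a ≡ -1ℤ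
flipSign-at a rewrite dec-true (a ≟ a) refl = refl

flips-off : {a : Fin n} {as : List (Fin n)} → All (a ≢_) as → flips as a ≡ 1ℤ
flips-off []             = refl
flips-off (a≢b ∷ a∉as) = cong₂ _*_ (flipSign-off a≢b) (flips-off a∉as)

sum-flipSign : (a : Fin n) (z : Fin n → ℤ) → sum (λ j → flipSign a j * z j) ≡ sum z - ℤ.+ 2 * z a
sum-flipSign {suc n} a z = begin
  sum (λ j → flipSign a j * z j)
    ≡⟨ sum-remove {i = a} (λ j → flipSign a j * z j) ⟩
  flipSign a a * z a + sum (λ k → flipSign a (punchIn a k) * z (punchIn a k))
    ≡⟨ cong₂ (λ u v → u * z a + v) (flipSign-at a) (sum-cong-≗ λ k → trans
         (cong (_* z (punchIn a k)) (flipSign-off (punchInᵢ≢i a k))) (ℤₚ.*-identityˡ (z (punchIn a k)))) ⟩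
  -1ℤ * z a + sum (λ k → z (punchIn a k))
    ≡⟨ ring (z a) (sum (λ k → z (punchIn a k))) ⟩
  z a + sum (λ k → z (punchIn a k)) - ℤ.+ 2 * z a
    ≡⟨ cong (λ u → u - ℤ.+ 2 * z a) (sum-remove {i = a} z) ⟨
  sum z - ℤ.+ 2 * z a ∎
  where
  open ≡-Reasoning
  ring : ∀ x s → -1ℤ * x + s ≡ x + s - ℤ.+ 2 * x
  ring = ℤ-Solver.solve-∀

sum-flips : {as : List (Fin n)} → AllPairs _≢_ as → sum (flips as) ≡ ℤ.+ n - ℤ.+ (2 *ℕ length as)
sum-flips {n} [] = trans (sum-const n 1ℤ) (trans (ℤₚ.*-identityʳ (ℤ.+ n)) (sym (ℤₚ.+-identityʳ (ℤ.+ n))))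
sum-flips {n} {a ∷ as} (a∉as ∷ unique) = begin
  sum (λ j → flipSign a j * flips as j)
    ≡⟨ sum-flipSign a (flips as) ⟩
  sum (flips as) - ℤ.+ 2 * flips as a
    ≡⟨ cong₂ (λ u v → u - ℤ.+ 2 * v) (sum-flips unique) (flips-off a∉as) ⟩
  ℤ.+ n - ℤ.+ (2 *ℕ length as) - ℤ.+ 2
    ≡⟨ ring (ℤ.+ n) (ℤ.+ (2 *ℕ length as)) ⟩
  ℤ.+ n - (ℤ.+ 2 + ℤ.+ (2 *ℕ length as))
    ≡⟨ cong (λ k → ℤ.+ n - ℤ.+ k) (ℕₚ.*-distribˡ-+ 2 1 (length as)) ⟨
  ℤ.+ n - ℤ.+ (2 *ℕ suc (length as)) ∎
  where
  open ≡-Reasoning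
  ring : ∀ x y → x - y - ℤ.+ 2 ≡ x - (ℤ.+ 2 + y)
  ring = ℤ-Solver.solve-∀

-- The absolute inner product of two sign vectors that differ in `l` places up to a global sign. It
-- separates three places from one unless `n = 4`, three from two unless `n = 5`, and four from two
-- unless `n = 6`.
correlation : ℕ → ℕ → ℕ
correlation n l = ∣ ℤ.+ n - ℤ.+ (2 *ℕ l) ∣

abs-dot : {as : List (Fin n)} {x y : Fin n → ℤ} → SignVector x → Differ as x y → AllPairs _≢_ as →
  ∣ dot x y ∣ ≡ correlation n (length as)
abs-dot {as = as} {x} {y} xs (mkDiffer s ss e) unique = begin
  ∣ sum (λ j → x j * y j) ∣            ≡⟨ cong ∣_∣ (sum-cong-≗ λ j → trans (cong (x j *_) (e j)) (trans (ring (x j) s (flips as j))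
                                            (cong (s *_) (sign-cancel (xs j) (flips as j))))) ⟩
  ∣ sum (λ j → s * flips as j) ∣       ≡⟨ cong ∣_∣ (sum-scale s (flips as)) ⟩
  ∣ s * sum (flips as) ∣               ≡⟨ abs-sign* ss (sum (flips as)) ⟩
  ∣ sum (flips as) ∣                   ≡⟨ cong ∣_∣ (sum-flips unique) ⟩
  correlation _ (length as)            ∎
  where
  open ≡-Reasoning
  ring : ∀ x s f → x * (s * (f * x)) ≡ s * (x * (x * f))
  ring = ℤ-Solver.solve-∀

correlation-unique : {as bs : List (Fin n)} {x y : Fin n → ℤ} → SignVector x → Differ as x y → AllPairs _≢_ as →
  Differ bs x y → AllPairs _≢_ bs → correlation n (length as) ≡ correlation n (length bs)
correlation-unique xs d u d′ u′ = trans (sym (abs-dot xs d u)) (abs-dot xs d′ u′)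

Close : (x y : Fin n → ℤ) → Set
Close x y = (∃ λ a → Differ (a ∷ []) x y) ⊎ (∃ λ a → ∃ λ b → a ≢ b × Differ (a ∷ b ∷ []) x y)

-- Linear dependence among rows that differ in few places

unitVector : Fin n → Fin n → ℤ
unitVector i k = if does (k ≟ i) then 1ℤ else 0ℤ

unitVector-at : (i : Fin n) → unitVector i i ≡ 1ℤ
unitVector-at i rewrite dec-true (i ≟ i) refl = refl

unitVector-off : {i k : Fin n} → k ≢ i → unitVector i k ≡ 0ℤ
unitVector-off {i = i} {k} k≢i rewrite dec-false (k ≟ i) k≢i = refl

combination-unitVector : (i : Fin m) (v : Rows m n) (j : Fin n) → combination (unitVector i) v j ≡ v i j
combination-unitVector i v j = trans
  (sum-single (λ k → unitVector i k * v k j) i λ k k≢i → trans (cong (_* v k j) (unitVector-off k≢i)) (ℤₚ.*-zeroˡ (v k j)))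
  (trans (cong (_* v i j) (unitVector-at i)) (ℤₚ.*-identityˡ (v i j)))

proportional-dependent : {A : Matrix n} → Independent A → {p q : Fin n} → p ≢ q → ¬ Differ [] (A p) (A q)
proportional-dependent {A = A} ind {p} {q} p≢q (mkDiffer s ss e) = case trans (sym at-q) (ind c c·≡0 q) of λ ()
  where
  c : Fin _ → ℤ
  c k = 1ℤ * unitVector q k - s * unitVector p k
  at-q : c q ≡ 1ℤ
  at-q = trans (cong₂ (λ u v → 1ℤ * u - s * v) (unitVector-at q) (unitVector-off (p≢q ∘ sym))) (ring s)
    where
    ring : ∀ s → 1ℤ * 1ℤ - s * 0ℤ ≡ 1ℤ
    ring = ℤ-Solver.solve-∀
  c·≡0 : ∀ j → combination c A j ≡ 0ℤ
  c·≡0 j = trans (combination-scale-sub 1ℤ s (unitVector p) (unitVector q) A j)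
    (trans (cong₂ (λ u v → 1ℤ * u - s * v) (trans (combination-unitVector q A j) (e j)) (combination-unitVector p A j)) (ring s (A p j)))
    where
    ring : ∀ s x → 1ℤ * (s * (1ℤ * x)) - s * x ≡ 0ℤ
    ring = ℤ-Solver.solve-∀

flips-inclusion : {a b : Fin n} → a ≢ b → ∀ j → flipSign a j * flipSign b j ≡ flipSign a j + flipSign b j - 1ℤ
flips-inclusion {a = a} {b} a≢b j with j ≟ a
... | no  _    = ring (flipSign b j)
  where
  ring : ∀ z → 1ℤ * z ≡ 1ℤ + z - 1ℤ
  ring = ℤ-Solver.solve-∀
... | yes refl = trans (cong (-1ℤ *_) (flipSign-off a≢b)) (sym (cong (λ z → -1ℤ + z - 1ℤ) (flipSign-off a≢b)))

-- Up to signs the four rows are one vector with nothing, `a`, `b`, and both places flipped. The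
-- first and the last have the same sum as the other two, by `flips-inclusion`.
square-dependent : {A : Matrix n} → Independent A → {p q t t′ : Fin n} → t′ ≢ p → t′ ≢ q → t′ ≢ t → {a b : Fin n} → a ≢ b →
  Differ (a ∷ []) (A p) (A q) → Differ (b ∷ []) (A p) (A t) → ¬ Differ (a ∷ b ∷ []) (A p) (A t′)
square-dependent {A = A} ind {p} {q} {t} {t′} t′≢p t′≢q t′≢t {a} {b} a≢b (mkDiffer s₁ ss₁ e₁) (mkDiffer s₂ ss₂ e₂) (mkDiffer s₃ ss₃ e₃) =
  sign-≢0 ss₃ (trans (sym at-t′) (ind c c·≡0 t′))
  where
  c₁ c₂ c : Fin _ → ℤ
  c₁ k = s₃ * unitVector t′ k - s₁ * unitVector q k
  c₂ k = s₂ * unitVector t k - 1ℤ * unitVector p k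
  c k = 1ℤ * c₁ k - 1ℤ * c₂ k
  at-t′ : c t′ ≡ s₃
  at-t′ = trans (cong₂ (λ u v → 1ℤ * u - 1ℤ * v)
      (cong₂ (λ u v → s₃ * u - s₁ * v) (unitVector-at t′) (unitVector-off t′≢q))
      (cong₂ (λ u v → s₂ * u - 1ℤ * v) (unitVector-off t′≢t) (unitVector-off t′≢p)))
    (ring s₁ s₂ s₃)
    where
    ring : ∀ s₁ s₂ s₃ → 1ℤ * (s₃ * 1ℤ - s₁ * 0ℤ) - 1ℤ * (s₂ * 0ℤ - 1ℤ * 0ℤ) ≡ s₃
    ring = ℤ-Solver.solve-∀
  c·≡0 : ∀ j → combination c A j ≡ 0ℤ
  c·≡0 j = begin
    combination c A j
      ≡⟨ combination-scale-sub 1ℤ 1ℤ c₂ c₁ A j ⟩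
    1ℤ * combination c₁ A j - 1ℤ * combination c₂ A j
      ≡⟨ cong₂ (λ u v → 1ℤ * u - 1ℤ * v)
           (trans (combination-scale-sub s₃ s₁ (unitVector q) (unitVector t′) A j)
             (cong₂ (λ u v → s₃ * u - s₁ * v) (trans (combination-unitVector t′ A j) (e₃ j)) (trans (combination-unitVector q A j) (e₁ j))))
           (trans (combination-scale-sub s₂ 1ℤ (unitVector p) (unitVector t) A j)
             (cong₂ (λ u v → s₂ * u - 1ℤ * v) (trans (combination-unitVector t A j) (e₂ j)) (combination-unitVector p A j))) ⟩
    1ℤ * (s₃ * (s₃ * (fa * (fb * 1ℤ) * x)) - s₁ * (s₁ * (fa * 1ℤ * x))) - 1ℤ * (s₂ * (s₂ * (fb * 1ℤ * x)) - 1ℤ * x)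
      ≡⟨ cong₂ (λ u v → 1ℤ * u - 1ℤ * v)
           (cong₂ _-_ (trans (sign-cancel ss₃ (fa * (fb * 1ℤ) * x)) (cong (_* x) (trans (cong (fa *_) (ℤₚ.*-identityʳ fb)) (flips-inclusion a≢b j))))
                      (sign-cancel ss₁ (fa * 1ℤ * x)))
           (cong (_- 1ℤ * x) (sign-cancel ss₂ (fb * 1ℤ * x))) ⟩
    1ℤ * ((fa + fb - 1ℤ) * x - fa * 1ℤ * x) - 1ℤ * (fb * 1ℤ * x - 1ℤ * x)
      ≡⟨ ring fa fb x ⟩
    0ℤ ∎
    where
    open ≡-Reasoning
    fa = flipSign a j
    fb = flipSign b j
    x = A p j
    ring : ∀ a b x → 1ℤ * ((a + b - 1ℤ) * x - a * 1ℤ * x) - 1ℤ * (b * 1ℤ * x - 1ℤ * x) ≡ 0ℤ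
    ring = ℤ-Solver.solve-∀

-- Configurations of pairwise close rows

∃⊎∀ : {P Q : Fin n → Set} → (∀ i → P i ⊎ Q i) → (∃ λ i → P i) ⊎ (∀ i → Q i)
∃⊎∀ {zero}  f = inj₂ λ ()
∃⊎∀ {suc n} f with f zero | ∃⊎∀ (f ∘ suc)
... | inj₁ p | _              = inj₁ (zero , p)
... | inj₂ q | inj₁ (i , p)   = inj₁ (suc i , p)
... | inj₂ q | inj₂ qs        = inj₂ λ where
  zero    → q
  (suc i) → qs i

module RowGeometry {A : Matrix n} (A-sign : IsSignMatrix A) (ind : Independent A)
                   (close : ∀ p q → p ≢ q → Close (A p) (A q)) where

  far₃ : correlation n 3 ≢ correlation n 1 → correlation n 3 ≢ correlation n 2 → {p q : Fin n} → p ≢ q →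
    {a b c : Fin n} → a ≢ b → a ≢ c → b ≢ c → ¬ Differ (a ∷ b ∷ c ∷ []) (A p) (A q)
  far₃ 3≢1 3≢2 {p} {q} p≢q a≢b a≢c b≢c d with close p q p≢q
  ... | inj₁ (_ , d′)           = 3≢1 (correlation-unique (A-sign p) d ((a≢b ∷ a≢c ∷ []) ∷ (b≢c ∷ []) ∷ [] ∷ []) d′ ([] ∷ []))
  ... | inj₂ (_ , _ , e≢f , d′) = 3≢2 (correlation-unique (A-sign p) d ((a≢b ∷ a≢c ∷ []) ∷ (b≢c ∷ []) ∷ [] ∷ []) d′ ((e≢f ∷ []) ∷ [] ∷ []))

  same-pair : {p q t : Fin n} → q ≢ t → {a b : Fin n} → Differ (a ∷ b ∷ []) (A p) (A q) → ¬ Differ (a ∷ b ∷ []) (A p) (A t)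
  same-pair q≢t {a} {b} pq pt = proportional-dependent ind q≢t (differ-cong {as = a ∷ b ∷ a ∷ b ∷ []} {bs = []} cancel (differ-compose pq pt))
    where
    cancel : flips (a ∷ b ∷ a ∷ b ∷ []) ≗ flips []
    cancel j = trans (cong (flipSign a j *_) (flips-swap b a (b ∷ []) j)) (trans (flips-cancel a (b ∷ b ∷ []) j) (flips-cancel b [] j))

  -- If two rows differ in a single place a, every other row is b or ab relative to the first of them,
  -- and all of them have the same type.

  centre : correlation n 3 ≢ correlation n 1 → correlation n 3 ≢ correlation n 2 → {p q : Fin n} → p ≢ q → {a : Fin n} →
    Differ (a ∷ []) (A p) (A q) → ∃ λ c → ∀ t → t ≢ c → ∃ λ j → Differ (j ∷ []) (A c) (A t)
  centre 3≢1 3≢2 {p} {q} p≢q {a} pq with ∃⊎∀ kinds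
    where
    Single Double : Fin n → Set
    Single t = ∃ λ j → j ≢ a × Differ (j ∷ []) (A p) (A t)
    Double t = ∃ λ j → j ≢ a × Differ (a ∷ j ∷ []) (A p) (A t)
    kind : ∀ t → t ≢ p → t ≢ q → Double t ⊎ Single t
    kind t t≢p t≢q with close p t (t≢p ∘ sym)
    ... | inj₁ (j , pt) with j ≟ a
    ...   | no j≢a   = inj₂ (j , j≢a , pt)
    ...   | yes refl = ⊥-elim (proportional-dependent ind (t≢q ∘ sym) (differ-cancel (differ-compose pq pt)))
    kind t t≢p t≢q | inj₂ (b , c , b≢c , pt) with b ≟ a | c ≟ a
    ...   | yes refl | _        = inj₁ (c , (b≢c ∘ sym) , pt)
    ...   | no  b≢a  | yes refl = inj₁ (b , b≢a , differ-swap pt)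
    ...   | no  b≢a  | no c≢a   = ⊥-elim (far₃ 3≢1 3≢2 (t≢q ∘ sym) (b≢a ∘ sym) (c≢a ∘ sym) b≢c (differ-compose pq pt))
    kinds : ∀ t → (t ≢ p × t ≢ q × Double t) ⊎ (t ≡ p ⊎ t ≡ q ⊎ Single t)
    kinds t with t ≟ p | t ≟ q
    ... | yes e   | _       = inj₂ (inj₁ e)
    ... | no _    | yes e   = inj₂ (inj₂ (inj₁ e))
    ... | no t≢p  | no t≢q  with kind t t≢p t≢q
    ...   | inj₁ d = inj₁ (t≢p , t≢q , d)
    ...   | inj₂ s = inj₂ (inj₂ (inj₂ s))
  ... | inj₂ single = p , λ t t≢p → case single t of λ where
          (inj₁ t≡p)                   → contradiction t≡p t≢p
          (inj₂ (inj₁ refl))           → a , pq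
          (inj₂ (inj₂ (j , _ , pt)))   → j , pt
  -- One row `u` of the second type makes `q` the centre, since relative to `q` the place `a`
  -- cancels from such rows. A further row of the first type, at a place `j`, would close a square
  -- with `u` if `j` is `k`, and otherwise differ from `u` in three places.
  ... | inj₁ (u , u≢p , u≢q , k , k≢a , pu) = q , λ t t≢q → neighbour t t≢q (t ≟ p) (t ≟ u)
    where
    neighbour : ∀ t → t ≢ q → Dec (t ≡ p) → Dec (t ≡ u) → ∃ λ j → Differ (j ∷ []) (A q) (A t)
    neighbour t t≢q (yes refl) _          = a , differ-sym pq
    neighbour t t≢q (no _)     (yes refl) = k , differ-cancel (differ-compose pq pu)
    neighbour t t≢q (no t≢p)   (no t≢u) with close p t (t≢p ∘ sym)
    ... | inj₂ (b , c , b≢c , pt) with b ≟ a | c ≟ a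
    ...   | yes refl | _        = c , differ-cancel (differ-compose pq pt)
    ...   | no  b≢a  | yes refl = b , differ-cancel (differ-compose pq (differ-swap pt))
    ...   | no  b≢a  | no c≢a   = ⊥-elim (far₃ 3≢1 3≢2 (t≢q ∘ sym) (b≢a ∘ sym) (c≢a ∘ sym) b≢c (differ-compose pq pt))
    neighbour t t≢q (no t≢p)   (no t≢u) | inj₁ (j , pt) with j ≟ a | j ≟ k
    ...   | yes refl | _        = ⊥-elim (proportional-dependent ind (t≢q ∘ sym) (differ-cancel (differ-compose pq pt)))
    ...   | no  j≢a  | yes refl = ⊥-elim (square-dependent ind u≢p u≢q (t≢u ∘ sym) (k≢a ∘ sym) pq pt pu)
    ...   | no  j≢a  | no j≢k   = ⊥-elim (far₃ 3≢1 3≢2 t≢u j≢a j≢k (k≢a ∘ sym) (differ-compose pt pu))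

  -- If no two rows differ in a single place, the rows relative to the row p are pairs which meet pairwise,
  -- hence (there being at least four of them) all contain a common place a.

  module _ (4≢2 : correlation n 4 ≢ correlation n 2) (5≤n : 5 ≤ n)
           (double : ∀ p q → p ≢ q → ∃ λ a → ∃ λ b → a ≢ b × Differ (a ∷ b ∷ []) (A p) (A q)) where

    far₄ : {p q : Fin n} → p ≢ q → {a b c d : Fin n} → a ≢ b → c ≢ d → a ≢ c → a ≢ d → b ≢ c → b ≢ d →
      ¬ Differ (a ∷ b ∷ c ∷ d ∷ []) (A p) (A q)
    far₄ {p} {q} p≢q a≢b c≢d a≢c a≢d b≢c b≢d dd with double p q p≢q
    ... | _ , _ , e≢f , d′ = 4≢2 (correlation-unique (A-sign p) dd
            ((a≢b ∷ a≢c ∷ a≢d ∷ []) ∷ (b≢c ∷ b≢d ∷ []) ∷ (c≢d ∷ []) ∷ [] ∷ []) d′ ((e≢f ∷ []) ∷ [] ∷ []))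

    meets : {p q t : Fin n} → p ≢ t → q ≢ t → {a b : Fin n} → a ≢ b → Differ (a ∷ b ∷ []) (A p) (A q) →
      (∃ λ x → x ≢ a × x ≢ b × Differ (a ∷ x ∷ []) (A p) (A t)) ⊎ (∃ λ x → x ≢ a × x ≢ b × Differ (b ∷ x ∷ []) (A p) (A t))
    meets {p} {q} {t} p≢t q≢t {a} {b} a≢b pq with double p t p≢t
    ... | c , d , c≢d , pt with c ≟ a | d ≟ a | c ≟ b | d ≟ b
    ...   | yes refl | _        | _        | yes refl = ⊥-elim (same-pair q≢t pq pt)
    ...   | yes refl | _        | _        | no d≢b   = inj₁ (d , (c≢d ∘ sym) , d≢b , pt)
    ...   | no c≢a   | yes refl | yes refl | _        = ⊥-elim (same-pair q≢t pq (differ-swap pt))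
    ...   | no c≢a   | yes refl | no c≢b   | _        = inj₁ (c , c≢a , c≢b , differ-swap pt)
    ...   | no c≢a   | no d≢a   | yes refl | _        = inj₂ (d , d≢a , (c≢d ∘ sym) , pt)
    ...   | no c≢a   | no d≢a   | no c≢b   | yes refl = inj₂ (c , c≢a , c≢b , differ-swap pt)
    ...   | no c≢a   | no d≢a   | no c≢b   | no d≢b   =
            ⊥-elim (far₄ q≢t a≢b c≢d (c≢a ∘ sym) (d≢a ∘ sym) (c≢b ∘ sym) (d≢b ∘ sym) (differ-compose pq pt))

    -- Pairwise meeting pairs form a star or a triangle. Besides `ab` and `ac`, a pair without `a`
    -- must be `bc`. If it occurred, a fifth row would bring a fourth pair, which cannot be one of
    -- these three and would miss one of them.
    hub : {p q u : Fin n} → p ≢ q → p ≢ u → q ≢ u → {a b c : Fin n} → a ≢ b → c ≢ a → c ≢ b →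
      Differ (a ∷ b ∷ []) (A p) (A q) → Differ (a ∷ c ∷ []) (A p) (A u) →
      ∀ t → t ≢ p → ∃ λ x → Differ (a ∷ x ∷ []) (A p) (A t)
    hub {p} {q} {u} p≢q p≢u q≢u {a} {b} {c} a≢b c≢a c≢b pq pu = λ t t≢p → case ∃⊎∀ kinds of λ where
        (inj₂ common) → [ (λ t≡p → contradiction t≡p t≢p) , id ]′ (common t)
        (inj₁ (v , v≢p , v≢q , v≢u , pv)) → ⊥-elim (triangle v v≢p v≢q v≢u pv)
      where
      kind : ∀ t → t ≢ p → t ≢ q → t ≢ u → Differ (b ∷ c ∷ []) (A p) (A t) ⊎ (∃ λ x → x ≢ a × x ≢ b × Differ (a ∷ x ∷ []) (A p) (A t))
      kind t t≢p t≢q t≢u with meets (t≢p ∘ sym) (t≢q ∘ sym) a≢b pq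
      ... | inj₁ ax = inj₂ ax
      ... | inj₂ (x , x≢a , x≢b , pt) with x ≟ c
      ...   | yes refl = inj₁ pt
      ...   | no x≢c   = ⊥-elim (far₄ (t≢u ∘ sym) (c≢a ∘ sym) (x≢b ∘ sym) a≢b (x≢a ∘ sym) c≢b (x≢c ∘ sym) (differ-compose pu pt))
      kinds : ∀ t → (t ≢ p × t ≢ q × t ≢ u × Differ (b ∷ c ∷ []) (A p) (A t)) ⊎ (t ≡ p ⊎ ∃ λ x → Differ (a ∷ x ∷ []) (A p) (A t))
      kinds t with t ≟ p | t ≟ q | t ≟ u
      ... | yes e   | _        | _        = inj₂ (inj₁ e)
      ... | no _    | yes refl | _        = inj₂ (inj₂ (b , pq))
      ... | no _    | no _     | yes refl = inj₂ (inj₂ (c , pu))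
      ... | no t≢p  | no t≢q   | no t≢u   with kind t t≢p t≢q t≢u
      ...   | inj₁ bc               = inj₁ (t≢p , t≢q , t≢u , bc)
      ...   | inj₂ (x , _ , _ , pt) = inj₂ (inj₂ (x , pt))
      triangle : ∀ v → v ≢ p → v ≢ q → v ≢ u → ¬ Differ (b ∷ c ∷ []) (A p) (A v)
      triangle v v≢p v≢q v≢u pv = case missed-value four 5≤n of λ where
          (t , four≢t) → case kind t (four≢t zero ∘ sym) (four≢t (suc zero) ∘ sym) (four≢t (suc (suc zero)) ∘ sym) of λ where
            (inj₁ pt) → same-pair (four≢t (suc (suc (suc zero)))) pv pt
            (inj₂ (x , x≢a , x≢b , pt)) → case x ≟ c of λ where
              (yes refl) → same-pair (four≢t (suc (suc zero))) pu pt
              (no x≢c)   → far₄ (four≢t (suc (suc (suc zero)))) (c≢b ∘ sym) (x≢a ∘ sym) (a≢b ∘ sym) (x≢b ∘ sym) c≢a (x≢c ∘ sym)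
                             (differ-compose pv pt)
        where
        four : Fin 4 → Fin n
        four zero                   = p
        four (suc zero)             = q
        four (suc (suc zero))       = u
        four (suc (suc (suc zero))) = v

    star : {p q u : Fin n} → p ≢ q → p ≢ u → q ≢ u → ∃ λ a → ∀ t → t ≢ p → ∃ λ x → Differ (a ∷ x ∷ []) (A p) (A t)
    star {p} {q} {u} p≢q p≢u q≢u with double p q p≢q
    ... | a , b , a≢b , pq with meets p≢u q≢u a≢b pq
    ...   | inj₁ (c , c≢a , c≢b , pu) = a , hub p≢q p≢u q≢u a≢b c≢a c≢b pq pu
    ...   | inj₂ (c , c≢a , c≢b , pu) = b , hub p≢q p≢u q≢u (a≢b ∘ sym) c≢b c≢a (differ-swap pq) pu

-- Matrices all of whose rows are close to one sign vector

injective⇒surjective : (h : Fin n → Fin n) → (∀ {i j} → h i ≡ h j → i ≡ j) → ∀ y → ∃ λ i → h i ≡ y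
injective⇒surjective {suc n} h h-inj y with any? (λ i → h i ≟ y)
... | yes hit  = hit
... | no  miss = contradiction (injective⇒≤ {f = λ i → punchOut (y≢h i)} λ {i} {j} e → h-inj (punchOut-injective (y≢h i) (y≢h j) e)) ℕₚ.1+n≰n
  where
  y≢h : ∀ i → y ≢ h i
  y≢h i e = miss (i , sym e)

injective⇒permutation : (h : Fin n → Fin n) → (∀ {i j} → h i ≡ h j → i ≡ j) → ∃ λ (π : Permutation′ n) → ∀ i → π ⟨$⟩ʳ i ≡ h i
injective⇒permutation h h-inj = Perm.permutation h (λ y → proj₁ (surj y)) (λ y → proj₂ (surj y)) (λ i → h-inj (proj₂ (surj (h i)))) , λ _ → refl
  where
  surj = injective⇒surjective h h-inj

flipSign≡Δ : (χ : Fin n → Bool) (i j : Fin n) → (if χ i then flipSign i j else 1ℤ) ≡ Δ χ i j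
flipSign≡Δ χ i j with i ≟ j
... | yes refl with χ i
...   | true  = flipSign-at i
...   | false = refl
flipSign≡Δ χ i j | no i≢j with χ i
...   | true  = flipSign-off (i≢j ∘ sym)
...   | false = refl

-- Recognises marked matrices: all rows are, up to sign, a common vector `z`, and a marked row `t`
-- is flipped at its own place `π t`. Scaling by `z` and moving row `t` to index `π t` puts the
-- flips on the diagonal.
marked≅Δ : {A : Matrix n} (π : Permutation′ n) (f : Fin n → Bool) (z s : Fin n → ℤ) → SignVector z → SignVector s →
  (∀ t j → A t j ≡ s t * ((if f t then flipSign (π ⟨$⟩ʳ t) j else 1ℤ) * z j)) → A ≅ Δ (λ k → f (π ⟨$⟩ˡ k))
marked≅Δ {A = A} π f z s zs ss e = mk≅ π Perm.id s z ss zs λ t j → trans (e t j) (cong (s t *_)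
  (trans (ℤₚ.*-comm _ (z j)) (cong (z j *_) (trans
    (cong (λ b → if b then flipSign (π ⟨$⟩ʳ t) j else 1ℤ) (cong f (sym (Perm.inverseˡ π))))
    (flipSign≡Δ (λ k → f (π ⟨$⟩ˡ k)) (π ⟨$⟩ʳ t) j)))))

count-one-false : (χ : Fin (suc n) → Bool) (b : Fin (suc n)) → χ b ≡ false → (∀ k → χ (punchIn b k) ≡ true) → count χ ≡ n
count-one-false χ b χb others = trans (count-punchIn-≡ χ b)
  (trans (cong (λ c → indicator c +ℕ count (χ ∘ punchIn b)) χb) (count-all (χ ∘ punchIn b) others))

-- The places flipped in the other rows are distinct, since rows with the same place would be
-- proportional. Hence exactly one place is left over, and it is assigned to the unmarked central
-- row.
centred-zero≅D : {A : Matrix (suc n)} → IsSignMatrix A → Independent A →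
  (∀ k → ∃ λ j → Differ (j ∷ []) (A zero) (A (suc k))) → A ≅ D (suc n) n
centred-zero≅D {n} {A} A-sign ind near = subst (λ c → A ≅ D (suc n) c) count≡n (≅-trans A≅Δ (Δ≅D χ))
  where
  g : Fin n → Fin (suc n)
  g k = proj₁ (near k)
  g-inj : ∀ {k l} → g k ≡ g l → k ≡ l
  g-inj {k} {l} e with k ≟ l
  ... | yes k≡l = k≡l
  ... | no  k≢l = ⊥-elim (proportional-dependent {A = A} ind (k≢l ∘ suc-injective)
        (differ-cancel (differ-compose (proj₂ (near k)) (subst (λ a → Differ (a ∷ []) (A zero) (A (suc l))) (sym e) (proj₂ (near l))))))
  missed = missed-value g (ℕₚ.n<1+n n)
  h : Fin (suc n) → Fin (suc n)
  h zero    = proj₁ missed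
  h (suc k) = g k
  h-inj : ∀ {i j} → h i ≡ h j → i ≡ j
  h-inj {zero}  {zero}  e = refl
  h-inj {zero}  {suc l} e = contradiction (sym e) (proj₂ missed l)
  h-inj {suc k} {zero}  e = contradiction e (proj₂ missed k)
  h-inj {suc k} {suc l} e = cong suc (g-inj e)
  π,≡ = injective⇒permutation h h-inj
  π = proj₁ π,≡
  f : Fin (suc n) → Bool
  f zero    = false
  f (suc _) = true
  s : Fin (suc n) → ℤ
  s zero    = 1ℤ
  s (suc k) = Differ.scale (proj₂ (near k))
  s-sign : SignVector s
  s-sign zero    = inj₁ refl
  s-sign (suc k) = Differ.scale-sign (proj₂ (near k))
  χ : Fin (suc n) → Bool
  χ k = f (π ⟨$⟩ˡ k)
  A≅Δ : A ≅ Δ χ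
  A≅Δ = marked≅Δ π f (A zero) s (A-sign zero) s-sign λ where
    zero    j → sym (trans (ℤₚ.*-identityˡ _) (ℤₚ.*-identityˡ _))
    (suc k) j → trans (Differ.differ≡ (proj₂ (near k)) j)
                  (cong (λ u → s (suc k) * (u * A zero j)) (ℤₚ.*-identityʳ (flipSign (g k) j)))
  count≡n : count χ ≡ n
  count≡n = count-one-false χ (π ⟨$⟩ʳ zero) (cong f (Perm.inverseˡ π)) λ k → f-true (π ⟨$⟩ˡ punchIn (π ⟨$⟩ʳ zero) k)
      λ e → punchInᵢ≢i (π ⟨$⟩ʳ zero) k (trans (sym (Perm.inverseʳ π)) (cong (π ⟨$⟩ʳ_) e))
    where
    f-true : ∀ i → i ≢ zero → f i ≡ true
    f-true zero    i≢0 = contradiction refl i≢0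
    f-true (suc _) _   = refl

centred≅D : {A : Matrix (suc n)} → IsSignMatrix A → Independent A →
  (∃ λ c → ∀ t → t ≢ c → ∃ λ j → Differ (j ∷ []) (A c) (A t)) → A ≅ D (suc n) n
centred≅D {n} {A} A-sign ind (c , near) = ≅-trans (permuteRows≅ A ρ)
  (centred-zero≅D (λ i → A-sign (ρ ⟨$⟩ʳ i)) (≅-independent (permuteRows≅ A ρ) ind) λ k → near (punchIn c k) (punchInᵢ≢i c k))
  where
  ρ = insert zero c Perm.id

-- The common vector `z` is the first row flipped at `a`. Relative to it the first row is flipped at
-- `a` and every other row at its own place, so all rows are marked.
starred-zero≅D : {A : Matrix (suc n)} → IsSignMatrix A → Independent A → {a : Fin (suc n)} →
  (∀ k → ∃ λ x → Differ (a ∷ x ∷ []) (A zero) (A (suc k))) → A ≅ D (suc n) (suc n)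
starred-zero≅D {n} {A} A-sign ind {a} near = subst (λ c → A ≅ D (suc n) c) (count-all χ λ _ → refl) (≅-trans A≅Δ (Δ≅D χ))
  where
  g : Fin n → Fin (suc n)
  g k = proj₁ (near k)
  g≢a : ∀ k → g k ≢ a
  g≢a k e = proportional-dependent {A = A} ind {zero} {suc k} (λ ()) (differ-cancel (subst (λ x → Differ (a ∷ x ∷ []) (A zero) (A (suc k))) e (proj₂ (near k))))
  g-inj : ∀ {k l} → g k ≡ g l → k ≡ l
  g-inj {k} {l} e with k ≟ l
  ... | yes k≡l = k≡l
  ... | no  k≢l = ⊥-elim (proportional-dependent {A = A} ind (k≢l ∘ suc-injective)
        (differ-cong {as = a ∷ g k ∷ a ∷ g k ∷ []} {bs = []}
          (λ j → trans (cong (flipSign a j *_) (flips-swap (g k) a (g k ∷ []) j)) (trans (flips-cancel a (g k ∷ g k ∷ []) j) (flips-cancel (g k) [] j)))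
          (differ-compose (proj₂ (near k)) (subst (λ x → Differ (a ∷ x ∷ []) (A zero) (A (suc l))) (sym e) (proj₂ (near l))))))
  h : Fin (suc n) → Fin (suc n)
  h zero    = a
  h (suc k) = g k
  h-inj : ∀ {i j} → h i ≡ h j → i ≡ j
  h-inj {zero}  {zero}  e = refl
  h-inj {zero}  {suc l} e = contradiction (sym e) (g≢a l)
  h-inj {suc k} {zero}  e = contradiction e (g≢a k)
  h-inj {suc k} {suc l} e = cong suc (g-inj e)
  π = proj₁ (injective⇒permutation h h-inj)
  s z : Fin (suc n) → ℤ
  s zero    = 1ℤ
  s (suc k) = Differ.scale (proj₂ (near k))
  z j = flipSign a j * A zero j
  s-sign : SignVector s
  s-sign zero    = inj₁ refl
  s-sign (suc k) = Differ.scale-sign (proj₂ (near k))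
  χ : Fin (suc n) → Bool
  χ _ = true
  ring : ∀ a x y → a * (x * 1ℤ) * y ≡ x * (a * y)
  ring = ℤ-Solver.solve-∀
  A≅Δ : A ≅ Δ χ
  A≅Δ = marked≅Δ π χ z s (λ j → sign-* (flipSign-sign a j) (A-sign zero j)) s-sign λ where
    zero    j → sym (trans (ℤₚ.*-identityˡ _) (sign-cancel (flipSign-sign a j) (A zero j)))
    (suc k) j → trans (Differ.differ≡ (proj₂ (near k)) j)
                  (cong (s (suc k) *_) (ring (flipSign a j) (flipSign (g k) j) (A zero j)))

starred≅D : {A : Matrix (suc n)} → IsSignMatrix A → Independent A → (p : Fin (suc n)) →
  (∃ λ a → ∀ t → t ≢ p → ∃ λ x → Differ (a ∷ x ∷ []) (A p) (A t)) → A ≅ D (suc n) (suc n)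
starred≅D {n} {A} A-sign ind p (a , near) = ≅-trans (permuteRows≅ A ρ)
  (starred-zero≅D (λ i → A-sign (ρ ⟨$⟩ʳ i)) (≅-independent (permuteRows≅ A ρ) ind) λ k → near (punchIn p k) (punchInᵢ≢i p k))
  where
  ρ = insert zero p Perm.id

-- Reading off the places where two sign vectors differ

count-zero : (χ : Fin n → Bool) → count χ ≡ 0 → ∀ j → χ j ≡ false
count-zero {suc n} χ c j with χ zero in e
count-zero {suc n} χ c zero    | false = e
count-zero {suc n} χ c (suc j) | false = count-zero (χ ∘ suc) c j

FlipsOf : List (Fin n) → (Fin n → Bool) → Set
FlipsOf as χ = ∀ j → (if χ j then -1ℤ else 1ℤ) ≡ flips as j

flipsOf-zero : (χ : Fin n → Bool) → count χ ≡ 0 → FlipsOf [] χ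
flipsOf-zero χ c j = cong (λ b → if b then -1ℤ else 1ℤ) (count-zero χ c j)

flipsOf-one : (χ : Fin n → Bool) → count χ ≡ 1 → ∃ λ a → FlipsOf (a ∷ []) χ
flipsOf-one {suc n} χ c with χ zero in e
... | true  = zero , λ where
  zero    → cong (λ b → if b then -1ℤ else 1ℤ) e
  (suc j) → cong (λ b → if b then -1ℤ else 1ℤ) (count-zero (χ ∘ suc) (ℕₚ.suc-injective c) j)
... | false = case flipsOf-one (χ ∘ suc) c of λ where
  (a , fl) → suc a , λ where
    zero    → cong (λ b → if b then -1ℤ else 1ℤ) e
    (suc j) → fl j

flipsOf-two : (χ : Fin n → Bool) → count χ ≡ 2 → ∃ λ a → ∃ λ b → a ≢ b × FlipsOf (a ∷ b ∷ []) χ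
flipsOf-two {suc n} χ c with χ zero in e
... | true  = case flipsOf-one (χ ∘ suc) (ℕₚ.suc-injective c) of λ where
  (b , fl) → zero , suc b , (λ ()) , λ where
    zero    → cong (λ b → if b then -1ℤ else 1ℤ) e
    (suc j) → trans (fl j) (sym (ℤₚ.*-identityˡ (flips (b ∷ []) j)))
... | false = case flipsOf-two (χ ∘ suc) c of λ where
  (a , b , a≢b , fl) → suc a , suc b , (a≢b ∘ suc-injective) , λ where
    zero    → cong (λ b → if b then -1ℤ else 1ℤ) e
    (suc j) → fl j

agreement : (x y : Fin n → ℤ) → Fin n → Bool
agreement x y j = does (x j ℤₚ.≟ y j)

differ-agreement : {as : List (Fin n)} {x y : Fin n → ℤ} → SignVector x → SignVector y →
  FlipsOf as (not ∘ agreement x y) → Differ as x y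
differ-agreement {as = as} {x} {y} xs ys fl = mkDiffer 1ℤ (inj₁ refl) λ j → trans (value j (xs j) (ys j))
  (trans (cong (_* x j) (fl j)) (sym (ℤₚ.*-identityˡ (flips as j * x j))))
  where
  value : ∀ j → IsSign (x j) → IsSign (y j) → y j ≡ (if not (does (x j ℤₚ.≟ y j)) then -1ℤ else 1ℤ) * x j
  value j (inj₁ e) (inj₁ e′) rewrite e | e′ = refl
  value j (inj₁ e) (inj₂ e′) rewrite e | e′ = refl
  value j (inj₂ e) (inj₁ e′) rewrite e | e′ = refl
  value j (inj₂ e) (inj₂ e′) rewrite e | e′ = refl

differ-disagreement : {as : List (Fin n)} {x y : Fin n → ℤ} → SignVector x → SignVector y →
  FlipsOf as (agreement x y) → Differ as x y
differ-disagreement {as = as} {x} {y} xs ys fl = mkDiffer -1ℤ (inj₂ refl) λ j → trans (value j (xs j) (ys j))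
  (cong (λ u → -1ℤ * (u * x j)) (fl j))
  where
  value : ∀ j → IsSign (x j) → IsSign (y j) → y j ≡ -1ℤ * ((if does (x j ℤₚ.≟ y j) then -1ℤ else 1ℤ) * x j)
  value j (inj₁ e) (inj₁ e′) rewrite e | e′ = refl
  value j (inj₁ e) (inj₂ e′) rewrite e | e′ = refl
  value j (inj₂ e) (inj₁ e′) rewrite e | e′ = refl
  value j (inj₂ e) (inj₂ e′) rewrite e | e′ = refl

few-places : (χ : Fin n → Bool) → count χ ≤ 2 →
  FlipsOf [] χ ⊎ (∃ λ a → FlipsOf (a ∷ []) χ) ⊎ (∃ λ a → ∃ λ b → a ≢ b × FlipsOf (a ∷ b ∷ []) χ)
few-places χ c≤2 with count χ in e
... | 0 = inj₁ (flipsOf-zero χ e)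
... | 1 = inj₂ (inj₁ (flipsOf-one χ e))
... | 2 = inj₂ (inj₂ (flipsOf-two χ e))
few-places χ (s≤s (s≤s ())) | suc (suc (suc _))

close-rows : {A : Matrix n} → IsSignMatrix A → Independent A → {p q : Fin n} → p ≢ q →
  count (not ∘ agreement (A p) (A q)) ≤ 2 ⊎ count (agreement (A p) (A q)) ≤ 2 → Close (A p) (A q)
close-rows {A = A} A-sign ind {p} {q} p≢q (inj₁ few) with few-places (not ∘ agreement (A p) (A q)) few
... | inj₁ fl                        = ⊥-elim (proportional-dependent {A = A} ind p≢q (differ-agreement (A-sign p) (A-sign q) fl))
... | inj₂ (inj₁ (a , fl))           = inj₁ (a , differ-agreement (A-sign p) (A-sign q) fl)
... | inj₂ (inj₂ (a , b , a≢b , fl)) = inj₂ (a , b , a≢b , differ-agreement (A-sign p) (A-sign q) fl)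
close-rows {A = A} A-sign ind {p} {q} p≢q (inj₂ few) with few-places (agreement (A p) (A q)) few
... | inj₁ fl                        = ⊥-elim (proportional-dependent {A = A} ind p≢q (differ-disagreement (A-sign p) (A-sign q) fl))
... | inj₂ (inj₁ (a , fl))           = inj₁ (a , differ-disagreement (A-sign p) (A-sign q) fl)
... | inj₂ (inj₂ (a , b , a≢b , fl)) = inj₂ (a , b , a≢b , differ-disagreement (A-sign p) (A-sign q) fl)

-- Nonsingular matrices of order at least 7

Nonsingular : ℕ → Set
Nonsingular r = (A : Matrix (suc r)) → IsSignMatrix A → Independent A → ∣ per A ∣ < N 0 r ⊎ A ≅ D (suc r) r

frontRows : Fin (suc (suc n)) → Fin (suc n) → Permutation′ (suc (suc n))
frontRows p q = insert zero p (insert zero q Perm.id)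

minor₂-independent : (B : Rows (suc (suc m)) (suc (suc n))) → Independent B → ∀ j k →
  ∃ λ (s : Fin m → Fin (suc (suc m))) → Independent (λ i l → B (s i) (punchIn j (punchIn k l)))
minor₂-independent B ind j k with dropColumn-dropRow j B ind
... | i , ind₁ with dropColumn-dropRow k (dropColumn j (B ∘ punchIn i)) ind₁
...   | i′ , ind₂ = punchIn i ∘ punchIn i′ , ind₂

dropRows₂-independent : {A : Rows (suc (suc m)) n} → Independent A → Independent (λ i → A (suc (suc i)))
dropRows₂-independent {A = A} ind = dropRow-independent zero (λ i → A (suc i)) (dropRow-independent zero A ind)

module FrontRows (A : Matrix (suc (suc (suc (suc m))))) (A-sign : IsSignMatrix A) (ind : Independent A)
                 (p : Fin (suc (suc (suc (suc m))))) (q : Fin (suc (suc (suc m)))) where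
  A′ : Matrix (suc (suc (suc (suc m))))
  A′ i = A (frontRows p q ⟨$⟩ʳ i)

  A≅A′ : A ≅ A′
  A≅A′ = permuteRows≅ A (frontRows p q)

  A′-sign : IsSignMatrix A′
  A′-sign i = A-sign (frontRows p q ⟨$⟩ʳ i)

  open TwoRows A′ A′-sign public

  lower-independent : Independent lower
  lower-independent = dropRows₂-independent {A = A′} (≅-independent A≅A′ ind)

  per-A≤ : (V : ℕ) → (∀ (B : Matrix (suc (suc m))) → IsSignMatrix B → (s : Fin m → Fin (suc (suc m))) → Independent (B ∘ s) → ∣ per B ∣ ≤ V) →
    ∣ per A ∣ ≤ (count agree *ℕ ℕ.pred (count agree) +ℕ count differ *ℕ ℕ.pred (count differ)) *ℕ V
  per-A≤ V bound = subst (_≤ (count agree *ℕ ℕ.pred (count agree) +ℕ count differ *ℕ ℕ.pred (count differ)) *ℕ V)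
    (sym (≅-per A≅A′))
    (uniform-≤ V λ j k → bound (minor₂ lower j k) (λ a b → A′-sign (suc (suc a)) (punchIn j (punchIn k b)))
      (proj₁ (minor₂-independent lower lower-independent j k)) (proj₂ (minor₂-independent lower lower-independent j k)))

data PairKind (A : Matrix n) : Set where
  single : ∀ p q a → p ≢ q → Differ (a ∷ []) (A p) (A q) → PairKind A
  double : (∀ p q → p ≢ q → ∃ λ a → ∃ λ b → a ≢ b × Differ (a ∷ b ∷ []) (A p) (A q)) → PairKind A

pairKind : {A : Matrix n} → (∀ p q → p ≢ q → Close (A p) (A q)) → PairKind A
pairKind {n} {A} close = [ (λ where (p , q , p≢q , a , d) → single p q a p≢q d) , double ]′ (∃⊎∀ λ p → ∃⊎∀ λ q → kind p q)
  where
  kind : ∀ p q → (p ≢ q × ∃ λ a → Differ (a ∷ []) (A p) (A q)) ⊎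
                 (p ≢ q → ∃ λ a → ∃ λ b → a ≢ b × Differ (a ∷ b ∷ []) (A p) (A q))
  kind p q with p ≟ q
  ... | yes p≡q = inj₂ λ p≢q → contradiction p≡q p≢q
  ... | no  p≢q with close p q p≢q
  ...   | inj₁ d = inj₁ (p≢q , d)
  ...   | inj₂ d = inj₂ λ _ → d

far⊎close : {A : Matrix (suc n)} → IsSignMatrix A → Independent A →
  (∃ λ p → ∃ λ q → 3 ≤ count (agreement (A p) (A (punchIn p q))) × 3 ≤ count (not ∘ agreement (A p) (A (punchIn p q)))) ⊎
  (∀ p q → p ≢ q → Close (A p) (A q))
far⊎close {n} {A} A-sign ind with ∃⊎∀ (λ p → ∃⊎∀ (λ q → kind p q))
  where
  kind : ∀ p q → (3 ≤ count (agreement (A p) (A (punchIn p q))) × 3 ≤ count (not ∘ agreement (A p) (A (punchIn p q)))) ⊎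
                 Close (A p) (A (punchIn p q))
  kind p q with 3 ℕₚ.≤? count (agreement (A p) (A (punchIn p q))) | 3 ℕₚ.≤? count (not ∘ agreement (A p) (A (punchIn p q)))
  ... | yes far | yes far′ = inj₁ (far , far′)
  ... | yes _   | no  few  = inj₂ (close-rows {A = A} A-sign ind (punchInᵢ≢i p q ∘ sym) (inj₁ (ℕ.s≤s⁻¹ (ℕₚ.≰⇒> few))))
  ... | no few  | _        = inj₂ (close-rows {A = A} A-sign ind (punchInᵢ≢i p q ∘ sym) (inj₂ (ℕ.s≤s⁻¹ (ℕₚ.≰⇒> few))))
... | inj₁ far = inj₁ far
... | inj₂ cl  = inj₂ λ p q p≢q → subst (λ q → Close (A p) (A q)) (punchIn-punchOut p≢q) (cl p (punchOut p≢q))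

abs-per-D-full : ∀ k → ∣ per (D (5 +ℕ k) (5 +ℕ k)) ∣ < N 0 (4 +ℕ k)
abs-per-D-full k = case per-D-full-bounds k of λ where
  (p , per≡p , _ , p<N) → subst (_< N 0 (4 +ℕ k)) (sym (cong ∣_∣ per≡p)) p<N

all-double< : ∀ k → correlation (5 +ℕ k) 4 ≢ correlation (5 +ℕ k) 2 → (A : Matrix (5 +ℕ k)) → IsSignMatrix A → Independent A →
  (close : ∀ p q → p ≢ q → Close (A p) (A q)) →
  (∀ p q → p ≢ q → ∃ λ a → ∃ λ b → a ≢ b × Differ (a ∷ b ∷ []) (A p) (A q)) → ∣ per A ∣ < N 0 (4 +ℕ k)
all-double< k 4≢2 A A-sign ind close dbl = subst (_< N 0 (4 +ℕ k))
  (sym (≅-per (starred≅D A-sign ind zero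
    (RowGeometry.star A-sign ind close 4≢2 (ℕₚ.m≤m+n 5 k) dbl {zero} {suc zero} {suc (suc zero)} (λ ()) (λ ()) (λ ())))))
  (abs-per-D-full k)

correlation₄< : ∀ k → correlation (7 +ℕ k) 4 < correlation (7 +ℕ k) 2
correlation₄< zero    = s≤s (s≤s z≤n)
correlation₄< (suc k) = s≤s (ℕₚ.m≤n+m k 3)

module _ (k : ℕ) (bound : Bound 2 (2 +ℕ k)) where

  far< : (A : Matrix (7 +ℕ k)) → IsSignMatrix A → Independent A → ∀ p q →
    3 ≤ count (agreement (A p) (A (punchIn p q))) → 3 ≤ count (not ∘ agreement (A p) (A (punchIn p q))) → ∣ per A ∣ < N 0 (6 +ℕ k)
  far< A A-sign ind p q far far′ = ℕₚ.≤-<-trans (per-A≤ (N 2 (2 +ℕ k)) λ B B-sign s → bound refl B B-sign s)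
    (go (count agree) (count differ) far far′ agree+differ)
    where
    open FrontRows A A-sign ind p q
    go : ∀ c d → 3 ≤ c → 3 ≤ d → c +ℕ d ≡ 7 +ℕ k → (c *ℕ ℕ.pred c +ℕ d *ℕ ℕ.pred d) *ℕ N 2 (2 +ℕ k) < N 0 (6 +ℕ k)
    go (suc (suc (suc a))) (suc (suc (suc b))) (s≤s (s≤s (s≤s z≤n))) (s≤s (s≤s (s≤s z≤n))) e = crude<N k a b
      (ℕₚ.+-cancelˡ-≡ 6 (a +ℕ b) (suc k) (trans (ring a b) e))
      where
      ring : ∀ a b → 6 +ℕ (a +ℕ b) ≡ 3 +ℕ a +ℕ (3 +ℕ b)
      ring = ℕ-Solver.solve-∀

  nonsingular-large : Nonsingular (6 +ℕ k)
  nonsingular-large A A-sign ind = case far⊎close A-sign ind of λ where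
      (inj₁ (p , q , far , far′)) → inj₁ (far< A A-sign ind p q far far′)
      (inj₂ close) → by-kind close (pairKind close)
    where
    by-kind : (∀ p q → p ≢ q → Close (A p) (A q)) → PairKind A → ∣ per A ∣ < N 0 (6 +ℕ k) ⊎ A ≅ D (7 +ℕ k) (6 +ℕ k)
    by-kind close (single p q a p≢q d) = inj₂ (centred≅D A-sign ind
      (RowGeometry.centre A-sign ind close (ℕₚ.<⇒≢ (s≤s (s≤s (ℕₚ.m≤n+m k 3)))) (ℕₚ.<⇒≢ (s≤s (s≤s (ℕₚ.m≤n+m k 1)))) p≢q d))
    by-kind close (double dbl) = inj₁ (all-double< (2 +ℕ k) (ℕₚ.<⇒≢ (correlation₄< k))
      A A-sign ind close dbl)

selection-injective : {A : Matrix n} (s : Fin n → Fin n) → Independent (A ∘ s) → ∀ {i j} → s i ≡ s j → i ≡ j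
selection-injective {A = A} s ind {i} {j} e with i ≟ j
... | yes i≡j = i≡j
... | no  i≢j = ⊥-elim (proportional-dependent {A = A ∘ s} ind i≢j (subst (λ k → Differ [] (A (s i)) (A k)) e (differ-refl (A (s i)))))

selection-independent : {A : Matrix n} (s : Fin n → Fin n) → Independent (A ∘ s) → Independent A
selection-independent {A = A} s ind = ≅-independent {A = A ∘ s} (≅-trans {B = λ i → A (π ⟨$⟩ʳ i)}
  (≗⇒≅ λ i j → cong (λ k → A k j) (sym (proj₂ π,≡ i))) (≅-sym (permuteRows≅ A π))) ind
  where
  π,≡ = injective⇒permutation s (selection-injective {A = A} s ind)
  π = proj₁ π,≡

abs-per-D : ∀ m r n → n ≡ suc m +ℕ r → ∣ per (D n r) ∣ ≡ N m r
abs-per-D m r n n≡ = cong ∣_∣ (per-D m r n n≡)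

nonsingular-bound : Nonsingular r → Bound 0 r
nonsingular-bound {r} nonsing refl A A-sign s ind = case nonsing A A-sign (selection-independent {A = A} s ind) of λ where
  (inj₁ lt)  → ℕₚ.<⇒≤ lt
  (inj₂ A≅D) → ℕₚ.≤-reflexive (trans (≅-per A≅D) (abs-per-D 0 r (suc r) refl))

nonsingular-equality : Nonsingular r → Equality 0 r
nonsingular-equality {r} nonsing refl A A-sign s ind _ tight = case nonsing A A-sign (selection-independent {A = A} s ind) of λ where
  (inj₁ lt)  → contradiction tight (ℕₚ.<⇒≢ lt)
  (inj₂ A≅D) → A≅D

-- Exhaustive search

record Search (X : Set) : Set₁ where
  field
    holds : (X → Bool) → Bool
    sound : ∀ P → holds P ≡ true → ∀ x → P x ≡ true

open Search public

∧-trueˡ : ∀ {a b} → a ∧ b ≡ true → a ≡ true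
∧-trueˡ {true} _ = refl

∧-trueʳ : ∀ {a b} → a ∧ b ≡ true → b ≡ true
∧-trueʳ {true} e = e

bits : Search Bool
holds bits P = P true ∧ P false
sound bits P e true  = ∧-trueˡ e
sound bits P e false = ∧-trueʳ {P true} e

vectors : {X : Set} → Search X → ∀ n → Search (Vec X n)
holds (vectors S zero)    P          = P []
holds (vectors S (suc n)) P          = holds S λ x → holds (vectors S n) λ v → P (x ∷ v)
sound (vectors S zero)    P e []      = e
sound (vectors S (suc n)) P e (x ∷ v) = sound (vectors S n) (λ v → P (x ∷ v))
  (sound S (λ x → holds (vectors S n) λ v → P (x ∷ v)) e x) v

searched : {X : Set} (S : Search X) {P : X → Set} (P? : ∀ x → Dec (P x)) → holds S (λ x → does (P? x)) ≡ true → ∀ x → P x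
searched S P? e x with P? x | sound S (λ x → does (P? x)) e x
... | yes p | _ = p

-- Sign matrices as bit matrices, and their normal forms

BitMatrix : ℕ → ℕ → Set
BitMatrix m n = Vec (Vec Bool n) m

bitMatrices : ∀ m n → Search (BitMatrix m n)
bitMatrices m n = vectors (vectors bits n) m

toSign : Bool → ℤ
toSign b = if b then -1ℤ else 1ℤ

fromSign : ℤ → Bool
fromSign x = does (x ℤₚ.≟ -1ℤ)

toSign-fromSign : ∀ {x} → IsSign x → toSign (fromSign x) ≡ x
toSign-fromSign (inj₁ refl) = refl
toSign-fromSign (inj₂ refl) = refl

signVector : Vec Bool n → Fin n → ℤ
signVector v j = toSign (lookup v j)

toBits : (Fin n → ℤ) → Vec Bool n
toBits x = tabulate (fromSign ∘ x)

signVector-toBits : {x : Fin n → ℤ} → SignVector x → ∀ j → signVector (toBits x) j ≡ x j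
signVector-toBits {x = x} xs j = trans (cong toSign (lookup∘tabulate (fromSign ∘ x) j)) (toSign-fromSign (xs j))

signRows : BitMatrix m n → Rows m n
signRows V i = signVector (lookup V i)

toBitRows : Rows m n → BitMatrix m n
toBitRows B = tabulate (toBits ∘ B)

signRows-toBitRows : {B : Rows m n} → (∀ i → SignVector (B i)) → ∀ i j → signRows (toBitRows B) i j ≡ B i j
signRows-toBitRows {B = B} Bs i j = trans (cong (λ v → signVector v j) (lookup∘tabulate (toBits ∘ B) i)) (signVector-toBits (Bs i) j)

-- Scaling turns the first row and the first column into ones, which leaves `n * n` signs to search.
normalForm : BitMatrix n n → Matrix (suc n)
normalForm V = onesBordered (signRows V)

record Normalised (A : Matrix (suc n)) (V : BitMatrix n n) : Set where
  field
    x y    : Fin (suc n) → ℤ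
    x-sign : SignVector x
    y-sign : SignVector y
    entry  : ∀ i j → A i j ≡ x i * (y j * normalForm V i j)

normalise : (A : Matrix (suc n)) → IsSignMatrix A → ∃ (Normalised A)
normalise {n} A A-sign = toBitRows B , record
  { x = x ; y = y
  ; x-sign = λ i → A-sign i zero
  ; y-sign = ys
  ; entry = λ where
      zero    zero    → sym (trans (cong (x zero *_) (trans (ℤₚ.*-identityʳ (y zero)) y₀)) (ℤₚ.*-identityʳ (x zero)))
      zero    (suc j) → sym (trans (cong (x zero *_) (ℤₚ.*-identityʳ (y (suc j)))) (sign-cancel (A-sign zero zero) (A zero (suc j))))
      (suc i) zero    → sym (trans (cong (x (suc i) *_) (trans (ℤₚ.*-identityʳ (y zero)) y₀)) (ℤₚ.*-identityʳ (x (suc i))))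
      (suc i) (suc j) → sym (trans (cong (λ b → x (suc i) * (y (suc j) * b)) (signRows-toBitRows B-sign i j))
        (trans (ring (x (suc i)) (y (suc j)) (A (suc i) (suc j)))
          (trans (sign-cancel (A-sign (suc i) zero) (y (suc j) * (y (suc j) * A (suc i) (suc j)))) (sign-cancel (ys (suc j)) (A (suc i) (suc j))))))
  }
  where
  x y : Fin (suc n) → ℤ
  x i = A i zero
  y j = A zero zero * A zero j
  ys : SignVector y
  ys j = sign-* (A-sign zero zero) (A-sign zero j)
  y₀ : y zero ≡ 1ℤ
  y₀ = sign-square (A-sign zero zero)
  B : Rows n n
  B i j = x (suc i) * (y (suc j) * A (suc i) (suc j))
  B-sign : ∀ i → SignVector (B i)
  B-sign i j = sign-* (A-sign (suc i) zero) (sign-* (ys (suc j)) (A-sign (suc i) (suc j)))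
  ring : ∀ x y a → x * (y * (x * (y * a))) ≡ x * (x * (y * (y * a)))
  ring = ℤ-Solver.solve-∀

normalised≅ : {A : Matrix (suc n)} {V : BitMatrix n n} → Normalised A V → A ≅ normalForm V
normalised≅ N = mk≅ Perm.id Perm.id x y x-sign y-sign entry
  where open Normalised N

normalForm-sign : (V : BitMatrix n n) → IsSignMatrix (normalForm V)
normalForm-sign V zero    zero    = inj₁ refl
normalForm-sign V zero    (suc j) = inj₁ refl
normalForm-sign V (suc i) zero    = inj₁ refl
normalForm-sign V (suc i) (suc j) = if-sign (lookup (lookup V i) j)

differ? : (as : List (Fin n)) (x y : Fin n → ℤ) → Dec (Differ as x y)
differ? as x y = map′
  (λ where (inj₁ e) → mkDiffer 1ℤ (inj₁ refl) e ; (inj₂ e) → mkDiffer -1ℤ (inj₂ refl) e)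
  (λ where (mkDiffer _ (inj₁ refl) e) → inj₁ e ; (mkDiffer _ (inj₂ refl) e) → inj₂ e)
  (all? (λ j → y j ℤₚ.≟ 1ℤ * (flips as j * x j)) ⊎-dec all? (λ j → y j ℤₚ.≟ -1ℤ * (flips as j * x j)))

Centred : Matrix n → Set
Centred {n} A = ∃ λ (c : Fin n) → ∀ t → t ≡ c ⊎ ∃ λ j → Differ (j ∷ []) (A c) (A t)

centred? : (A : Matrix n) → Dec (Centred A)
centred? A = any? λ c → all? λ t → (t ≟ c) ⊎-dec any? λ j → differ? (j ∷ []) (A c) (A t)

centred⇒≅D : {A : Matrix (suc n)} → IsSignMatrix A → Independent A → Centred A → A ≅ D (suc n) n
centred⇒≅D A-sign ind (c , near) = centred≅D A-sign ind (c , λ t t≢c → [ (λ t≡c → contradiction t≡c t≢c) , id ]′ (near t))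

SmallOrCentred : ℕ → Matrix n → Set
SmallOrCentred v A = ∣ per A ∣ < v ⊎ ¬ Independent A ⊎ Centred A

smallOrCentred? : (v : ℕ) (A : Matrix n) → Dec (SmallOrCentred v A)
smallOrCentred? v A = (∣ per A ∣ ℕₚ.<? v) ⊎-dec (¬? (independent? A) ⊎-dec centred? A)

by-search : (∀ V → SmallOrCentred (N 0 r) (normalForm {r} V)) → Nonsingular r
by-search {r} found A A-sign ind = go (normalise A A-sign)
  where
  go : ∃ (Normalised A) → ∣ per A ∣ < N 0 r ⊎ A ≅ D (suc r) r
  go (V , nf) = case found V of λ where
      (inj₁ small)        → inj₁ (subst (_< N 0 r) (sym (≅-per A≅)) small)
      (inj₂ (inj₁ dep))   → ⊥-elim (dep ind′)
      (inj₂ (inj₂ cent))  → inj₂ (≅-trans A≅ (centred⇒≅D (normalForm-sign V) ind′ cent))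
    where
    A≅ = normalised≅ nf
    ind′ = ≅-independent A≅ ind

opaque
  unfolding per

  search₁ : holds (bitMatrices 0 0) (λ V → does (smallOrCentred? (N 0 0) (normalForm V))) ≡ true
  search₁ = refl

  search₂ : holds (bitMatrices 1 1) (λ V → does (smallOrCentred? (N 0 1) (normalForm V))) ≡ true
  search₂ = refl

  search₃ : holds (bitMatrices 2 2) (λ V → does (smallOrCentred? (N 0 2) (normalForm V))) ≡ true
  search₃ = refl

-- The shape that a sign matrix of order 4 must have if its permanent exceeds 8 in absolute value.
-- At order 6 this shape is excluded for minors when all rows differ in exactly two places.
ThreeProportional : Matrix 4 → Set
ThreeProportional A = ∃ λ o → ∀ k → Differ [] (A (punchIn o zero)) (A (punchIn o (suc k)))

threeProportional? : (A : Matrix 4) → Dec (ThreeProportional A)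
threeProportional? A = any? λ o → all? λ k → differ? [] (A (punchIn o zero)) (A (punchIn o (suc k)))

opaque
  unfolding per

  search₄ : holds (bitMatrices 3 3) (λ V → does ((∣ per (normalForm V) ∣ ℕₚ.≤? 8) ⊎-dec threeProportional? (normalForm V))) ≡ true
  search₄ = refl

-- Nonsingular matrices of order 5

trues : Vec Bool n
trues = tabulate (λ _ → true)

opaque
  unfolding per

  search₅ : holds (bitMatrices 3 4) (λ V → does (smallOrCentred? 24 (normalForm (trues ∷ V)))) ≡ true
  search₅ = refl

small⊎centred₅ : ∀ V → SmallOrCentred 24 (normalForm (trues ∷ V))
small⊎centred₅ = searched (bitMatrices 3 4) (λ V → smallOrCentred? 24 (normalForm (trues ∷ V))) search₅

-- In the normal form the first row is all ones and the second starts with 1. As they differ, up to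
-- sign, only in the first place, the second is -1 everywhere else. At order 5 this leaves 12 signs
-- instead of 16.
normalise-single : (A : Matrix (suc (suc n))) → IsSignMatrix A → Differ (zero ∷ []) (A zero) (A (suc zero)) →
  ∃ λ V → Normalised A (trues ∷ V)
normalise-single {n} A A-sign (mkDiffer s ss e) with normalise A A-sign in eq
... | (v ∷ V) , nf = V , subst (λ v → Normalised A (v ∷ V)) v≡trues nf
  where
  row : Fin (suc n) → ℤ
  row j = A (suc zero) zero * (A zero zero * A zero (suc j) * A (suc zero) (suc j))
  v≡ : v ≡ toBits row
  v≡ = cong (λ p → headRow (proj₁ p)) (sym eq)
    where
    headRow : BitMatrix (suc n) (suc n) → Vec Bool (suc n)
    headRow (v ∷ _) = v
  row≡-1 : ∀ j → row j ≡ -1ℤ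
  row≡-1 j = begin
    A (suc zero) zero * (a * b * A (suc zero) (suc j))
      ≡⟨ cong₂ (λ u w → u * (a * b * w)) (e zero) (e (suc j)) ⟩
    s * (-1ℤ * 1ℤ * a) * (a * b * (s * (1ℤ * 1ℤ * b)))
      ≡⟨ ring s a b ⟩
    - (s * (s * (a * (a * (b * b)))))
      ≡⟨ cong -_ (trans (sign-cancel ss (a * (a * (b * b)))) (trans (sign-cancel (A-sign zero zero) (b * b)) (sign-square (A-sign zero (suc j))))) ⟩
    -1ℤ ∎
    where
    open ≡-Reasoning
    a = A zero zero
    b = A zero (suc j)
    ring : ∀ s a b → s * (-1ℤ * 1ℤ * a) * (a * b * (s * (1ℤ * 1ℤ * b))) ≡ - (s * (s * (a * (a * (b * b)))))
    ring = ℤ-Solver.solve-∀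
  v≡trues : v ≡ trues
  v≡trues = trans v≡ (tabulate-cong λ j → cong fromSign (row≡-1 j))

single-case₅ : (A : Matrix 5) → IsSignMatrix A → Independent A → ∀ p q a → p ≢ q → Differ (a ∷ []) (A p) (A q) →
  ∣ per A ∣ < 24 ⊎ A ≅ D 5 4
single-case₅ A A-sign ind p q a p≢q d = go (normalise-single A′ A′-sign d′)
  where
  ρ = frontRows p (punchOut p≢q)
  σ = insert zero a Perm.id
  A′ : Matrix 5
  A′ i j = A (ρ ⟨$⟩ʳ i) (σ ⟨$⟩ʳ j)
  A≅A′ : A ≅ A′
  A≅A′ = ≅-trans (permuteRows≅ A ρ) (permuteColumns≅ (λ i j → A (ρ ⟨$⟩ʳ i) j) σ)
  A′-sign : IsSignMatrix A′
  A′-sign i j = A-sign (ρ ⟨$⟩ʳ i) (σ ⟨$⟩ʳ j)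
  d″ : Differ (a ∷ []) (A p) (A (punchIn p (punchOut p≢q)))
  d″ = subst (λ q → Differ (a ∷ []) (A p) (A q)) (sym (punchIn-punchOut p≢q)) d
  d′ : Differ (zero ∷ []) (A′ zero) (A′ (suc zero))
  d′ = mkDiffer (Differ.scale d″) (Differ.scale-sign d″) λ where
    zero    → trans (Differ.differ≡ d″ a) (cong (λ u → Differ.scale d″ * (u * 1ℤ * A p a)) (flipSign-at a))
    (suc j) → trans (Differ.differ≡ d″ (punchIn a j)) (cong (λ u → Differ.scale d″ * (u * 1ℤ * A p (punchIn a j))) (flipSign-off (punchInᵢ≢i a j)))
  go : (∃ λ V → Normalised A′ (trues ∷ V)) → ∣ per A ∣ < 24 ⊎ A ≅ D 5 4
  go (V , nf) = case small⊎centred₅ V of λ where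
      (inj₁ small)       → inj₁ (subst (_< 24) (sym (≅-per A≅)) small)
      (inj₂ (inj₁ dep))  → ⊥-elim (dep (≅-independent A≅ ind))
      (inj₂ (inj₂ cent)) → inj₂ (≅-trans A≅ (centred⇒≅D (normalForm-sign (trues ∷ V)) (≅-independent A≅ ind) cent))
    where
    A≅ : A ≅ normalForm (trues ∷ V)
    A≅ = ≅-trans A≅A′ (normalised≅ nf)

nonsingular₅ : Nonsingular 4
nonsingular₅ A A-sign ind = case far⊎close A-sign ind of λ where
    (inj₁ (p , q , far , far′)) → contradiction (ℕₚ.≤-trans (ℕₚ.+-mono-≤ far far′)
      (ℕₚ.≤-reflexive (count-not (agreement (A p) (A (punchIn p q)))))) (ℕₚ.<⇒≱ (ℕₚ.n<1+n 5))
    (inj₂ close) → by-kind close (pairKind close)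
  where
  by-kind : (∀ p q → p ≢ q → Close (A p) (A q)) → PairKind A → ∣ per A ∣ < 24 ⊎ A ≅ D 5 4
  by-kind close (single p q a p≢q d) = single-case₅ A A-sign ind p q a p≢q d
  by-kind close (double dbl)         = inj₁ (all-double< 0 (λ ()) A A-sign ind close dbl)

nonsingular₁ : Nonsingular 0
nonsingular₁ = by-search (searched (bitMatrices 0 0) (λ V → smallOrCentred? (N 0 0) (normalForm V)) search₁)

nonsingular₂ : Nonsingular 1
nonsingular₂ = by-search (searched (bitMatrices 1 1) (λ V → smallOrCentred? (N 0 1) (normalForm V)) search₂)

nonsingular₃ : Nonsingular 2
nonsingular₃ = by-search (searched (bitMatrices 2 2) (λ V → smallOrCentred? (N 0 2) (normalForm V)) search₃)

-- Nonsingular matrices of order 6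

-- The nonzero factor `c` is a common denominator: `y` lies in the rational span of the rows.
Spans : Rows m n → (Fin n → ℤ) → Set
Spans {m} v y = ∃ λ c → c ≢ 0ℤ × ∃ λ (a : Fin m → ℤ) → ∀ j → combination a v j ≡ c * y j

*-≢0 : ∀ {x y} → x ≢ 0ℤ → y ≢ 0ℤ → x * y ≢ 0ℤ
*-≢0 {x} x≢0 y≢0 xy≡0 = [ x≢0 , y≢0 ]′ (ℤₚ.i*j≡0⇒i≡0∨j≡0 x xy≡0)

spans-zero : (v : Rows m n) (y : Fin n → ℤ) → (∀ j → y j ≡ 0ℤ) → Spans v y
spans-zero v y y≡0 = 1ℤ , (λ ()) , (λ _ → 0ℤ) , λ j →
  trans (sum-zero (λ i → 0ℤ * v i j) (λ i → ℤₚ.*-zeroˡ (v i j))) (sym (trans (ℤₚ.*-identityˡ (y j)) (y≡0 j)))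

spans-+ : (v : Rows m n) {y z w : Fin n → ℤ} → (∀ j → w j ≡ y j + z j) → Spans v y → Spans v z → Spans v w
spans-+ v {y} {z} {w} w≡ (c , c≢0 , a , ay) (d , d≢0 , b , bz) = c * d , *-≢0 c≢0 d≢0 , (λ i → c * b i - (- d) * a i) , λ j →
  trans (combination-scale-sub c (- d) a b v j)
    (trans (cong₂ (λ s t → c * s - (- d) * t) (bz j) (ay j)) (trans (ring c d (y j) (z j)) (cong (c * d *_) (sym (w≡ j)))))
  where
  ring : ∀ c d y z → c * (d * z) - (- d) * (c * y) ≡ c * d * (y + z)
  ring = ℤ-Solver.solve-∀

spans-sum : (v : Rows m n) (f : Fin r → Fin n → ℤ) → (∀ i → Spans v (f i)) → Spans v (λ j → sum (λ i → f i j))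
spans-sum {r = zero}  v f spans = spans-zero v (λ _ → 0ℤ) λ _ → refl
spans-sum {r = suc r} v f spans = spans-+ v (λ j → refl) (spans zero) (spans-sum v (f ∘ suc) (spans ∘ suc))

-- Each coloop puts a multiple of its unit vector into the span, and `y` is a sum of multiples of
-- the unit vectors in its support.
spans-coloops : (v : Rows m (suc n)) (y : Fin (suc n) → ℤ) → (∀ i → y i ≡ 0ℤ ⊎ Coloop i v) → Spans v y
spans-coloops v y coloops = let (c , c≢0 , a , e) = spans-sum v (λ i j → y i * unitVector i j) part in
    c , c≢0 , a , λ j → trans (e j) (cong (c *_) (total j))
  where
  total : ∀ j → sum (λ i → y i * unitVector i j) ≡ y j
  total j = trans (sum-single (λ i → y i * unitVector i j) j λ i i≢j →
      trans (cong (y i *_) (unitVector-off {i = i} (i≢j ∘ sym))) (ℤₚ.*-zeroʳ (y i)))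
    (trans (cong (y j *_) (unitVector-at j)) (ℤₚ.*-identityʳ (y j)))
  part : ∀ i → Spans v (λ j → y i * unitVector i j)
  part i with coloops i
  ... | inj₁ y≡0 = spans-zero v _ λ j → trans (cong (_* unitVector i j) y≡0) (ℤₚ.*-zeroˡ (unitVector i j))
  ... | inj₂ (a , at , off) = combination a v i , at , (λ k → y i * a k) ,
        λ j → trans (combination-tail-scale (y i) a v j) (off-or-at {P = λ j → y i * combination a v j ≡ combination a v i * (y i * unitVector i j)} i
          (trans (ring (y i) (combination a v i)) (cong (λ u → combination a v i * (y i * u)) (sym (unitVector-at i))))
          (λ k → trans (cong (y i *_) (off k)) (trans (zeros (y i) (combination a v i))
            (cong (λ u → combination a v i * (y i * u)) (sym (unitVector-off (punchInᵢ≢i i k)))))) j)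
    where
    ring : ∀ y c → y * c ≡ c * (y * 1ℤ)
    ring = ℤ-Solver.solve-∀
    zeros : ∀ y c → y * 0ℤ ≡ c * (y * 0ℤ)
    zeros = ℤ-Solver.solve-∀

-- If all columns in the support of y were critical for the remaining rows, y would lie in their span.

noncritical-column : (A : Rows (suc (suc m)) (suc n)) → Independent A → (χ : Fin (suc n) → Bool) (y : Fin (suc n) → ℤ) (β : ℤ) →
  (∀ j → χ j ≡ false → y j ≡ 0ℤ) → (∀ j → A zero j + β * A (suc zero) j ≡ ℤ.+ 2 * y j) →
  ∃ λ a → χ a ≡ true × Independent (dropColumn a (λ i → A (suc (suc i))))
noncritical-column {m} A ind χ y β y-off A-y with any? (λ a → (χ a 𝔹ₚ.≟ true) ×-dec independent? (dropColumn a (λ i → A (suc (suc i)))))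
... | yes found = found
... | no  none  = case spans-coloops lower y critical of λ where
    (c , c≢0 , a , e) → contradiction (ind (coefficients c a) (relation c a e) zero) c≢0
  where
  lower = λ i → A (suc (suc i))
  critical : ∀ j → y j ≡ 0ℤ ⊎ Coloop j lower
  critical j with χ j in χj
  ... | false = inj₁ (y-off j χj)
  ... | true  = inj₂ (coloop j lower (dropRows₂-independent {A = A} ind) λ indⱼ → none (j , χj , indⱼ))
  -- The first two rows contribute `2 c y` and the remaining ones `-2 c y`, so the first row would
  -- have coefficient `c`, which is nonzero, in a relation of `A`.
  coefficients : ℤ → (Fin m → ℤ) → Fin (suc (suc m)) → ℤ
  coefficients c a zero          = c
  coefficients c a (suc zero)    = c * β
  coefficients c a (suc (suc i)) = - ℤ.+ 2 * a i
  relation : ∀ c a → (∀ j → combination a lower j ≡ c * y j) → ∀ j → combination (coefficients c a) A j ≡ 0ℤ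
  relation c a e j = trans
    (cong (λ s → c * A zero j + (c * β * A (suc zero) j + s)) (trans (combination-tail-scale (- ℤ.+ 2) a lower j) (cong (- ℤ.+ 2 *_) (e j))))
    (trans (ring c β (A zero j) (A (suc zero) j) (y j)) (trans (cong (λ s → c * s - c * (ℤ.+ 2 * y j)) (A-y j)) (ℤₚ.+-inverseʳ (c * (ℤ.+ 2 * y j)))))
    where
    ring : ∀ c β x z y → c * x + (c * β * z + - ℤ.+ 2 * (c * y)) ≡ c * (x + β * z) - c * (ℤ.+ 2 * y)
    ring = ℤ-Solver.solve-∀

count-cong : {χ ψ : Fin n → Bool} → χ ≗ ψ → count χ ≡ count ψ
count-cong {zero}  χ≗ψ = refl
count-cong {suc n} χ≗ψ = cong₂ (λ b c → indicator b +ℕ c) (χ≗ψ zero) (count-cong (χ≗ψ ∘ suc))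

count-none : (χ : Fin n → Bool) → (∀ j → χ j ≡ false) → count χ ≡ 0
count-none {zero}  χ none = refl
count-none {suc n} χ none rewrite none zero = count-none (χ ∘ suc) (none ∘ suc)

only : Fin n → Fin n → Bool
only a j = does (j ≟ a)

count-only : (a : Fin (suc n)) → count (only a) ≡ 1
count-only a = trans (count-punchIn-≡ (only a) a) (cong₂ (λ b c → indicator b +ℕ c) (dec-true (a ≟ a) refl)
  (count-none (only a ∘ punchIn a) λ k → dec-false (punchIn a k ≟ a) (punchInᵢ≢i a k)))

count-erase : (χ : Fin (suc n) → Bool) (a : Fin (suc n)) → χ a ≡ true → count χ ≡ suc (count (erase a χ))
count-erase χ a χa = trans (count-punchIn-≡ χ a) (trans (cong (λ b → indicator b +ℕ count (χ ∘ punchIn a)) χa) (cong suc (sym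
  (trans (count-punchIn-≡ (erase a χ) a) (cong₂ (λ b c → indicator b +ℕ c) erased (count-cong kept))))))
  where
  erased : erase a χ a ≡ false
  erased rewrite dec-true (a ≟ a) refl with χ a
  ... | true  = refl
  ... | false = refl
  kept : erase a χ ∘ punchIn a ≗ χ ∘ punchIn a
  kept k rewrite dec-false (punchIn a k ≟ a) (punchInᵢ≢i a k) with χ (punchIn a k)
  ... | true  = refl
  ... | false = refl

-- For a column `a` whose minors satisfy the better bound `V′`, split `u` into its part `e` at `a`
-- and the rest `u′`. The square of `e` vanishes because no column is used twice, the two mixed
-- terms involve only minors without column `a`, and the square of `u′` has `c (c - 1)` terms.
per₂-diagonal-≤′ : (χ : Fin (suc (suc n)) → Bool) (u : Fin (suc (suc n)) → ℤ) (B : Rows n (suc (suc n))) (a : Fin (suc (suc n))) (c V V′ : ℕ) →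
  SupportedOn χ u → χ a ≡ true → count χ ≡ suc c → (∀ k → ∣ per (minor₂ B a k) ∣ ≤ V′) → (∀ j k → ∣ per (minor₂ B j k) ∣ ≤ V) →
  ∣ per₂ u u B ∣ ≤ 2 *ℕ (c *ℕ V′) +ℕ c *ℕ (ℕ.pred c *ℕ V)
per₂-diagonal-≤′ χ u B a c V V′ u-supp χa count≡ a-bound bound = begin
  ∣ per₂ u u B ∣
    ≡⟨ cong ∣_∣ (trans (trans (per₂-congˡ u B split) (per₂-congʳ (λ j → e j + u′ j) B split)) (per₂-square e u′ B)) ⟩
  ∣ per₂ e e B + (per₂ e u′ B + per₂ e u′ B) + per₂ u′ u′ B ∣
    ≤⟨ ℕₚ.≤-trans (ℤₚ.∣i+j∣≤∣i∣+∣j∣ (per₂ e e B + (per₂ e u′ B + per₂ e u′ B)) (per₂ u′ u′ B))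
         (ℕₚ.+-monoˡ-≤ ∣ per₂ u′ u′ B ∣ (ℕₚ.≤-trans (ℤₚ.∣i+j∣≤∣i∣+∣j∣ (per₂ e e B) (per₂ e u′ B + per₂ e u′ B))
           (ℕₚ.+-monoʳ-≤ ∣ per₂ e e B ∣ (ℤₚ.∣i+j∣≤∣i∣+∣j∣ (per₂ e u′ B) (per₂ e u′ B))))) ⟩
  ∣ per₂ e e B ∣ +ℕ (∣ per₂ e u′ B ∣ +ℕ ∣ per₂ e u′ B ∣) +ℕ ∣ per₂ u′ u′ B ∣
    ≤⟨ ℕₚ.+-mono-≤ (ℕₚ.+-mono-≤ ee (ℕₚ.+-mono-≤ eu eu)) uu ⟩
  0 +ℕ (c *ℕ V′ +ℕ c *ℕ V′) +ℕ c *ℕ (ℕ.pred c *ℕ V)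
    ≡⟨ ring (c *ℕ V′) (c *ℕ (ℕ.pred c *ℕ V)) ⟩
  2 *ℕ (c *ℕ V′) +ℕ c *ℕ (ℕ.pred c *ℕ V) ∎
  where
  open ℕₚ.≤-Reasoning
  ring : ∀ x y → 0 +ℕ (x +ℕ x) +ℕ y ≡ 2 *ℕ x +ℕ y
  ring = ℕ-Solver.solve-∀
  e u′ : _ → ℤ
  e j = if only a j then u j else 0ℤ
  u′ j = if only a j then 0ℤ else u j
  split : ∀ j → u j ≡ e j + u′ j
  split j with only a j
  ... | true  = sym (ℤₚ.+-identityʳ (u j))
  ... | false = sym (ℤₚ.+-identityˡ (u j))
  e-supp : SupportedOn (only a) e
  e-supp j with j ≟ a
  ... | yes refl = trans (u-supp j) (cong indicator χa)
  ... | no  _    = refl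
  ψ = erase a χ
  u′-supp : SupportedOn ψ u′
  u′-supp j with j ≟ a
  ... | yes _ with χ j
  ...   | true  = refl
  ...   | false = refl
  u′-supp j | no _ with χ j | u-supp j
  ...   | true  | s = s
  ...   | false | s = s
  count-ψ : count ψ ≡ c
  count-ψ = ℕₚ.suc-injective (trans (sym (count-erase χ a χa)) count≡)
  at-a : ∀ j → only a j ≡ true → j ≡ a
  at-a j e with j ≟ a
  ... | yes j≡a = j≡a
  ee : ∣ per₂ e e B ∣ ≤ 0
  ee = subst (λ k → ∣ per₂ e e B ∣ ≤ k *ℕ (ℕ.pred k *ℕ V)) (count-only a)
    (per₂-diagonal-≤ (only a) e B V e-supp λ j k _ _ → bound j k)
  eu : ∣ per₂ e u′ B ∣ ≤ c *ℕ V′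
  eu = subst (∣ per₂ e u′ B ∣ ≤_) (trans (cong (_*ℕ (c *ℕ V′)) (count-only a)) (ℕₚ.*-identityˡ (c *ℕ V′)))
    (per₂-≤ (only a) ψ e u′ B c V′ e-supp u′-supp (λ j _ → ℕₚ.≤-trans (count-punchIn ψ j) (ℕₚ.≤-reflexive count-ψ))
      λ j k j-only _ → subst (λ j → ∀ k → ∣ per (minor₂ B j k) ∣ ≤ V′) (sym (at-a j j-only)) a-bound k)
  uu : ∣ per₂ u′ u′ B ∣ ≤ c *ℕ (ℕ.pred c *ℕ V)
  uu = subst (λ k → ∣ per₂ u′ u′ B ∣ ≤ k *ℕ (ℕ.pred k *ℕ V)) count-ψ
    (per₂-diagonal-≤ ψ u′ B V u′-supp λ j k _ _ → bound j k)

differ-outside : {x y : Fin n → ℤ} → SignVector x → SignVector y → {c d : Fin n} → c ≢ d → {σ : ℤ} → IsSign σ →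
  (∀ l → l ≢ c → l ≢ d → y l ≡ σ * x l) →
  Differ [] x y ⊎ Differ (c ∷ []) x y ⊎ Differ (d ∷ []) x y ⊎ Differ (c ∷ d ∷ []) x y
differ-outside {x = x} {y} xs ys {c} {d} c≢d {σ} σs off with sign-ratio (xs c) (ys c) | sign-ratio (xs d) (ys d)
  where
  sign-ratio : ∀ {a b} → IsSign a → IsSign b → b ≡ σ * a ⊎ b ≡ σ * (-1ℤ * a)
  sign-ratio {a} {b} as bs = go σs as bs
    where
    go : ∀ {σ a b} → IsSign σ → IsSign a → IsSign b → b ≡ σ * a ⊎ b ≡ σ * (-1ℤ * a)
    go (inj₁ refl) (inj₁ refl) (inj₁ refl) = inj₁ refl
    go (inj₁ refl) (inj₁ refl) (inj₂ refl) = inj₂ refl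
    go (inj₁ refl) (inj₂ refl) (inj₁ refl) = inj₂ refl
    go (inj₁ refl) (inj₂ refl) (inj₂ refl) = inj₁ refl
    go (inj₂ refl) (inj₁ refl) (inj₁ refl) = inj₂ refl
    go (inj₂ refl) (inj₁ refl) (inj₂ refl) = inj₁ refl
    go (inj₂ refl) (inj₂ refl) (inj₁ refl) = inj₁ refl
    go (inj₂ refl) (inj₂ refl) (inj₂ refl) = inj₂ refl
... | inj₁ ec | inj₁ ed = inj₁ (mkDiffer σ σs (by-places ec ed off))
  where
  by-places : y c ≡ σ * x c → y d ≡ σ * x d → (∀ l → l ≢ c → l ≢ d → y l ≡ σ * x l) → ∀ l → y l ≡ σ * (1ℤ * x l)
  by-places ec ed off l with l ≟ c | l ≟ d
  ... | yes refl | _        = trans ec (cong (σ *_) (sym (ℤₚ.*-identityˡ (x l))))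
  ... | no _     | yes refl = trans ed (cong (σ *_) (sym (ℤₚ.*-identityˡ (x l))))
  ... | no l≢c   | no l≢d   = trans (off l l≢c l≢d) (cong (σ *_) (sym (ℤₚ.*-identityˡ (x l))))
... | inj₂ ec | inj₁ ed = inj₂ (inj₁ (mkDiffer σ σs by-places))
  where
  by-places : ∀ l → y l ≡ σ * (flipSign c l * 1ℤ * x l)
  by-places l with l ≟ c | l ≟ d
  ... | yes refl | _        = ec
  ... | no _     | yes refl = trans ed (cong (σ *_) (sym (ℤₚ.*-identityˡ (x l))))
  ... | no l≢c   | no l≢d   = trans (off l l≢c l≢d) (cong (σ *_) (sym (ℤₚ.*-identityˡ (x l))))
... | inj₁ ec | inj₂ ed = inj₂ (inj₂ (inj₁ (mkDiffer σ σs by-places)))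
  where
  by-places : ∀ l → y l ≡ σ * (flipSign d l * 1ℤ * x l)
  by-places l with l ≟ d | l ≟ c
  ... | yes refl | _        = ed
  ... | no _     | yes refl = trans ec (cong (σ *_) (sym (ℤₚ.*-identityˡ (x l))))
  ... | no l≢d   | no l≢c   = trans (off l l≢c l≢d) (cong (σ *_) (sym (ℤₚ.*-identityˡ (x l))))
... | inj₂ ec | inj₂ ed = inj₂ (inj₂ (inj₂ (mkDiffer σ σs by-places)))
  where
  by-places : ∀ l → y l ≡ σ * (flipSign c l * (flipSign d l * 1ℤ) * x l)
  by-places l with l ≟ c | l ≟ d
  ... | yes refl | yes l≡d  = contradiction l≡d c≢d
  ... | yes refl | no _     = ec
  ... | no _     | yes refl = ed
  ... | no l≢c   | no l≢d   = trans (off l l≢c l≢d) (cong (σ *_) (sym (ℤₚ.*-identityˡ (x l))))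

flipsOf-≤1 : (χ : Fin n → Bool) → count χ ≤ 1 → FlipsOf [] χ ⊎ ∃ λ a → FlipsOf (a ∷ []) χ
flipsOf-≤1 χ c≤1 with count χ in e
... | 0 = inj₁ (flipsOf-zero χ e)
... | 1 = inj₂ (flipsOf-one χ e)
flipsOf-≤1 χ (s≤s ()) | suc (suc _)

proportional⊎small₄ : ∀ V → ∣ per (normalForm V) ∣ ≤ 8 ⊎ ThreeProportional (normalForm V)
proportional⊎small₄ = searched (bitMatrices 3 3) (λ V → (∣ per (normalForm V) ∣ ℕₚ.≤? 8) ⊎-dec threeProportional? (normalForm V)) search₄

threeProportional : (A : Matrix 4) → IsSignMatrix A → ∣ per A ∣ ≤ 8 ⊎ ThreeProportional A
threeProportional A A-sign = go (normalise A A-sign)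
  where
  go : ∃ (Normalised A) → ∣ per A ∣ ≤ 8 ⊎ ThreeProportional A
  go (V , nf) = case proportional⊎small₄ V of λ where
      (inj₁ small)   → inj₁ (subst (_≤ 8) (sym (≅-per (normalised≅ nf))) small)
      (inj₂ (o , d)) → inj₂ (o , λ k → rescale (punchIn o zero) (punchIn o (suc k)) (d k))
    where
    open Normalised nf
    rescale : ∀ p q → Differ [] (normalForm V p) (normalForm V q) → Differ [] (A p) (A q)
    rescale p q (mkDiffer s ss e) = mkDiffer (x q * s * x p) (sign-* (sign-* (x-sign q) ss) (x-sign p)) λ j →
      trans (entry q j) (trans (cong (λ u → x q * (y j * u)) (e j))
        (sym (trans (cong (λ u → x q * s * x p * (1ℤ * u)) (entry p j)) (trans (ring (x q) s (x p) (y j) (normalForm V p j))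
          (cong (λ u → x q * (y j * (s * (1ℤ * u)))) (sign-cancel (x-sign p) (normalForm V p j)))))))
      where
      ring : ∀ a s b y z → a * s * b * (1ℤ * (b * (y * z))) ≡ a * (y * (s * (1ℤ * (b * (b * z)))))
      ring = ℤ-Solver.solve-∀

module _ (bound-rank2 : Bound 2 1) (bound-rank3 : Bound 1 2) where

  -- The uniform bound 12 · 12 = 144 is too weak. But among the three columns where the rows agree,
  -- one is not critical for the four lower rows: minors without it keep three independent rows and
  -- are at most 8 rather than 12. So the agreeing part is at most 2 · 2 · 8 + 2 · 12 = 56, likewise
  -- the differing part, and 112 < 128.
  far₆< : (A : Matrix 6) → IsSignMatrix A → Independent A → ∀ p q →
    3 ≤ count (agreement (A p) (A (punchIn p q))) → 3 ≤ count (not ∘ agreement (A p) (A (punchIn p q))) → ∣ per A ∣ < 128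
  far₆< A A-sign ind p q far far′ = subst (_< 128) (sym (≅-per A≅A′)) (ℕₚ.≤-<-trans per-≤
      (ℕₚ.≤-<-trans (ℕₚ.+-mono-≤ u-part w-part) (ℕₚ.m≤m+n 113 15)))
    where
    open FrontRows A A-sign ind p q
    counts : count agree ≡ 3 × count differ ≡ 3
    counts = go (count agree) (count differ) far far′ agree+differ
      where
      go : ∀ c d → 3 ≤ c → 3 ≤ d → c +ℕ d ≡ 6 → c ≡ 3 × d ≡ 3
      go (suc (suc (suc a))) (suc (suc (suc b))) (s≤s (s≤s (s≤s z≤n))) (s≤s (s≤s (s≤s z≤n))) e =
        cong (3 +ℕ_) (ℕₚ.m+n≡0⇒m≡0 a a+b≡0) , cong (3 +ℕ_) (ℕₚ.m+n≡0⇒n≡0 a a+b≡0)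
        where
        ring : ∀ a b → 6 +ℕ (a +ℕ b) ≡ 3 +ℕ a +ℕ (3 +ℕ b)
        ring = ℕ-Solver.solve-∀
        a+b≡0 : a +ℕ b ≡ 0
        a+b≡0 = ℕₚ.+-cancelˡ-≡ 6 (a +ℕ b) 0 (trans (ring a b) e)
    A′-independent : Independent A′
    A′-independent = ≅-independent A≅A′ ind
    minor-≤12 : ∀ j k → ∣ per (minor₂ lower j k) ∣ ≤ 12
    minor-≤12 j k = bound-rank2 refl (minor₂ lower j k) (λ a b → A′-sign (suc (suc a)) (punchIn j (punchIn k b)))
      (proj₁ (minor₂-independent lower lower-independent j k)) (proj₂ (minor₂-independent lower lower-independent j k))
    minor-≤8 : ∀ a → Independent (dropColumn a lower) → ∀ k → ∣ per (minor₂ lower a k) ∣ ≤ 8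
    minor-≤8 a indₐ k = bound-rank3 refl (minor₂ lower a k) (λ i b → A′-sign (suc (suc i)) (punchIn a (punchIn k b)))
      (punchIn (proj₁ (dropColumn-dropRow k (dropColumn a lower) indₐ))) (proj₂ (dropColumn-dropRow k (dropColumn a lower) indₐ))
    u-off : ∀ j → agree j ≡ false → u j ≡ 0ℤ
    u-off j e rewrite e = refl
    w-off : ∀ j → differ j ≡ false → w j ≡ 0ℤ
    w-off j e with agree j
    ... | true = refl
    ring⁺ : ∀ u w → u + w + 1ℤ * (u + - w) ≡ ℤ.+ 2 * u
    ring⁺ = ℤ-Solver.solve-∀
    ring⁻ : ∀ u w → u + w + -1ℤ * (u + - w) ≡ ℤ.+ 2 * w
    ring⁻ = ℤ-Solver.solve-∀
    u-part : ∣ per₂ u u lower ∣ ≤ 56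
    u-part = case noncritical-column A′ A′-independent agree u 1ℤ u-off
        (λ j → trans (cong₂ (λ x y → x + 1ℤ * y) (row-zero j) (row-one j)) (ring⁺ (u j) (w j))) of λ where
      (a , agree-a , indₐ) → per₂-diagonal-≤′ agree u lower a 2 12 8 u-supported agree-a (proj₁ counts) (minor-≤8 a indₐ) minor-≤12
    w-part : ∣ per₂ w w lower ∣ ≤ 56
    w-part = case noncritical-column A′ A′-independent differ w -1ℤ w-off
        (λ j → trans (cong₂ (λ x y → x + -1ℤ * y) (row-zero j) (row-one j)) (ring⁻ (u j) (w j))) of λ where
      (a , differ-a , indₐ) → per₂-diagonal-≤′ differ w lower a 2 12 8 w-supported differ-a (proj₂ counts) (minor-≤8 a indₐ) minor-≤12

module _ (A : Matrix 6) (A-sign : IsSignMatrix A) (ind : Independent A) (close : ∀ p q → p ≢ q → Close (A p) (A q))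
         (dbl : ∀ p q → p ≢ q → ∃ λ a → ∃ λ b → a ≢ b × Differ (a ∷ b ∷ []) (A p) (A q)) where
  open FrontRows A A-sign ind zero zero

  private
    not-single : ∀ {p q} → p ≢ q → ∀ {a} → ¬ Differ (a ∷ []) (A p) (A q)
    not-single {p} {q} p≢q d = case dbl p q p≢q of λ where
      (_ , _ , a≢b , d′) → contradiction (correlation-unique (A-sign p) d ([] ∷ []) d′ ((a≢b ∷ []) ∷ [] ∷ [])) λ ()

    not-few : ∀ {p q} → p ≢ q → (Differ [] (A p) (A q) ⊎ ∃ λ a → Differ (a ∷ []) (A p) (A q)) → ⊥
    not-few p≢q (inj₁ d)       = proportional-dependent {A = A} ind p≢q d
    not-few p≢q (inj₂ (a , d)) = not-single p≢q d

    -- The worst split, 2 and 4, gives 14 · 8 = 112. A split 1 and 5 would give 160, which is why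
    -- rows that differ in one place are treated separately.
    counts-≤ : ∀ c d → 2 ≤ c → 2 ≤ d → c +ℕ d ≡ 6 → (c *ℕ ℕ.pred c +ℕ d *ℕ ℕ.pred d) *ℕ 8 < 128
    counts-≤ 2 4 _ _ refl = ℕₚ.m≤m+n 113 15
    counts-≤ 3 3 _ _ refl = ℕₚ.m≤m+n 97 31
    counts-≤ 4 2 _ _ refl = ℕₚ.m≤m+n 113 15
    counts-≤ 5 1 _ (s≤s ()) refl
    counts-≤ 6 0 _ () refl
    counts-≤ (suc zero) _ (s≤s ()) _ _

    two≤agree : 2 ≤ count agree
    two≤agree = ℕₚ.≰⇒> λ c≤1 → not-few {zero} {suc zero} (λ ()) (case flipsOf-≤1 agree c≤1 of λ where
      (inj₁ fl)       → inj₁ (differ-disagreement (A-sign zero) (A-sign (suc zero)) fl)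
      (inj₂ (a , fl)) → inj₂ (a , differ-disagreement (A-sign zero) (A-sign (suc zero)) fl))

    two≤differ : 2 ≤ count differ
    two≤differ = ℕₚ.≰⇒> λ c≤1 → not-few {zero} {suc zero} (λ ()) (case flipsOf-≤1 differ c≤1 of λ where
      (inj₁ fl)       → inj₁ (differ-agreement (A-sign zero) (A-sign (suc zero)) fl)
      (inj₂ (a , fl)) → inj₂ (a , differ-agreement (A-sign zero) (A-sign (suc zero)) fl))

    -- Rows that become proportional after the deletion of two columns can differ, up to sign, only
    -- there; as no two rows differ in fewer than two places, they differ in both.
    deleted-pair : ∀ {p q} → p ≢ q → ∀ j k → Differ [] (λ l → A p (punchIn j (punchIn k l))) (λ l → A q (punchIn j (punchIn k l))) →
      Differ (j ∷ punchIn j k ∷ []) (A p) (A q)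
    deleted-pair {p} {q} p≢q j k (mkDiffer σ σs e) with differ-outside (A-sign p) (A-sign q) {j} {punchIn j k} (punchInᵢ≢i j k ∘ sym) σs outside
      where
      outside : ∀ l → l ≢ j → l ≢ punchIn j k → A q l ≡ σ * A p l
      outside = off-or-at {P = λ l → l ≢ j → l ≢ punchIn j k → A q l ≡ σ * A p l} j (λ j≢j _ → contradiction refl j≢j)
        (off-or-at {P = λ l → punchIn j l ≢ j → punchIn j l ≢ punchIn j k → A q (punchIn j l) ≡ σ * A p (punchIn j l)} k
          (λ _ k≢k → contradiction refl k≢k)
          λ l _ _ → trans (e l) (cong (σ *_) (ℤₚ.*-identityˡ _)))
    ... | inj₁ d               = ⊥-elim (proportional-dependent {A = A} ind p≢q d)
    ... | inj₂ (inj₁ d)        = ⊥-elim (not-single p≢q d)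
    ... | inj₂ (inj₂ (inj₁ d)) = ⊥-elim (not-single p≢q d)
    ... | inj₂ (inj₂ (inj₂ d)) = d

    ρ : Fin 6 → Fin 6
    ρ i = frontRows {4} zero zero ⟨$⟩ʳ i

    ρ-injective : ∀ {i j} → ρ i ≡ ρ j → i ≡ j
    ρ-injective e = trans (sym (Perm.inverseˡ (frontRows {4} zero zero)))
      (trans (cong (frontRows {4} zero zero ⟨$⟩ˡ_) e) (Perm.inverseˡ (frontRows {4} zero zero)))

    -- If a minor exceeded 8, three of its rows would be proportional. The corresponding rows of `A`
    -- would then differ in the same two deleted columns, and two of them would be proportional.
    lower-minor-≤8 : ∀ j k → ∣ per (minor₂ lower j k) ∣ ≤ 8
    lower-minor-≤8 j k = case threeProportional (minor₂ lower j k) (λ a b → A′-sign (suc (suc a)) (punchIn j (punchIn k b))) of λ where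
        (inj₁ small)   → small
        (inj₂ (o , d)) → ⊥-elim (RowGeometry.same-pair A-sign ind close {index o zero} {index o (suc zero)} {index o (suc (suc zero))}
          (index-≢ o (λ ())) (deleted-pair (index-≢ o (λ ())) j k (d zero)) (deleted-pair (index-≢ o (λ ())) j k (d (suc zero))))
      where
      index : Fin 4 → Fin 3 → Fin 6
      index o k = ρ (suc (suc (punchIn o k)))
      index-≢ : ∀ o {k l} → k ≢ l → index o k ≢ index o l
      index-≢ o k≢l e = k≢l (punchIn-injective o _ _ (suc-injective (suc-injective (ρ-injective e))))

  all-double₆< : ∣ per A ∣ < 128
  all-double₆< = subst (_< 128) (sym (≅-per A≅A′)) (ℕₚ.≤-<-trans (uniform-≤ 8 lower-minor-≤8)
    (counts-≤ (count agree) (count differ) two≤agree two≤differ agree+differ))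

nonsingular₆ : Bound 2 1 → Bound 1 2 → Nonsingular 5
nonsingular₆ bound-rank2 bound-rank3 A A-sign ind = case far⊎close A-sign ind of λ where
    (inj₁ (p , q , far , far′)) → inj₁ (far₆< bound-rank2 bound-rank3 A A-sign ind p q far far′)
    (inj₂ close) → by-kind close (pairKind close)
  where
  by-kind : (∀ p q → p ≢ q → Close (A p) (A q)) → PairKind A → ∣ per A ∣ < 128 ⊎ A ≅ D 6 5
  by-kind close (single p q a p≢q d) = inj₂ (centred≅D A-sign ind (RowGeometry.centre A-sign ind close (λ ()) (λ ()) p≢q d))
  by-kind close (double dbl)         = inj₁ (all-double₆< A A-sign ind close dbl)

-- The exceptional cases of order 3, 4 and 5

Starred : Matrix n → Set
Starred {n} A = ∃ λ (p : Fin n) → ∃ λ (a : Fin n) → ∀ t → t ≡ p ⊎ ∃ λ x → Differ (a ∷ x ∷ []) (A p) (A t)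

starred? : (A : Matrix n) → Dec (Starred A)
starred? A = any? λ p → any? λ a → all? λ t → (t ≟ p) ⊎-dec any? λ x → differ? (a ∷ x ∷ []) (A p) (A t)

Kind₄ : Matrix 4 → Set
Kind₄ A = ∣ per A ∣ < 4 ⊎ ¬ Independent A ⊎ Centred A ⊎ Starred A

kind₄? : (A : Matrix 4) → Dec (Kind₄ A)
kind₄? A = (∣ per A ∣ ℕₚ.<? 4) ⊎-dec (¬? (independent? A) ⊎-dec (centred? A ⊎-dec starred? A))

OneMarked : Matrix n → Set
OneMarked {n} A = ∃ λ (c : Fin n) → ∃ λ (t : Fin n) → ∃ λ (j : Fin n) →
  Differ (j ∷ []) (A c) (A t) × (∀ u → u ≡ t ⊎ Differ [] (A c) (A u))

oneMarked? : (A : Matrix n) → Dec (OneMarked A)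
oneMarked? A = any? λ c → any? λ t → any? λ j → differ? (j ∷ []) (A c) (A t) ×-dec all? λ u → (u ≟ t) ⊎-dec differ? [] (A c) (A u)

oneMarked⇒≅D : {A : Matrix (suc n)} → IsSignMatrix A → OneMarked A → A ≅ D (suc n) 1
oneMarked⇒≅D {n} {A} A-sign (c , t , j , d , others) = subst (λ l → A ≅ D (suc n) l) count≡1 (≅-trans A≅Δ (Δ≅D (λ k → f (π ⟨$⟩ˡ k))))
  where
  π = Perm.transpose t j
  f : Fin (suc n) → Bool
  f u = does (u ≟ t)
  Row : Fin (suc n) → Bool → Set
  Row u b = ∃ λ s → IsSign s × ∀ k → A u k ≡ s * ((if b then flipSign (π ⟨$⟩ʳ u) k else 1ℤ) * A c k)
  row : ∀ u → Row u (f u)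
  row u = go (u ≟ t) (others u)
    where
    go : (u≟t : Dec (u ≡ t)) → u ≡ t ⊎ Differ [] (A c) (A u) → Row u (does u≟t)
    go (no u≢t)  (inj₁ u≡t) = contradiction u≡t u≢t
    go (no _)    (inj₂ d′)  = Differ.scale d′ , Differ.scale-sign d′ , Differ.differ≡ d′
    go (yes u≡t) _          = subst (λ u → Row u true) (sym u≡t) (Differ.scale d , Differ.scale-sign d , λ k → trans (Differ.differ≡ d k)
      (cong (λ z → Differ.scale d * (z * A c k)) (trans (ℤₚ.*-identityʳ (flipSign j k)) (cong (λ l → flipSign l k) (sym (transpose-first t j))))))
  A≅Δ : A ≅ Δ (λ k → f (π ⟨$⟩ˡ k))
  A≅Δ = marked≅Δ π f (A c) (proj₁ ∘ row) (A-sign c) (λ u → proj₁ (proj₂ (row u))) (λ u → proj₂ (proj₂ (row u)))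
  count≡1 : count (λ k → f (π ⟨$⟩ˡ k)) ≡ 1
  count≡1 = trans (count-cong λ k → does-cong (π ⟨$⟩ˡ k ≟ t) (k ≟ j)
      (λ e → trans (sym (Perm.inverseʳ π)) (trans (cong (π ⟨$⟩ʳ_) e) (transpose-first t j)))
      (λ e → trans (cong (π ⟨$⟩ˡ_) (trans e (sym (transpose-first t j)))) (Perm.inverseˡ π)))
    (count-only j)

TwoMarked : Matrix n → Set
TwoMarked {n} A = ∃ λ (c : Fin n) → ∃ λ (t : Fin n) → ∃ λ (t′ : Fin n) → t ≢ t′ × ∃ λ (j : Fin n) → ∃ λ (j′ : Fin n) → j ≢ j′ ×
  Differ (j ∷ []) (A c) (A t) × Differ (j′ ∷ []) (A c) (A t′) × (∀ u → u ≡ t ⊎ u ≡ t′ ⊎ Differ [] (A c) (A u))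

twoMarked? : (A : Matrix n) → Dec (TwoMarked A)
twoMarked? A = any? λ c → any? λ t → any? λ t′ → ¬? (t ≟ t′) ×-dec any? λ j → any? λ j′ → ¬? (j ≟ j′) ×-dec
  (differ? (j ∷ []) (A c) (A t) ×-dec (differ? (j′ ∷ []) (A c) (A t′) ×-dec
    all? λ u → (u ≟ t) ⊎-dec ((u ≟ t′) ⊎-dec differ? [] (A c) (A u))))

twoMarked⇒≅D : {A : Matrix (suc n)} → IsSignMatrix A → TwoMarked A → A ≅ D (suc n) 2
twoMarked⇒≅D {n} {A} A-sign (c , t , t′ , t≢t′ , j , j′ , j≢j′ , d , d′ , others) =
  subst (λ l → A ≅ D (suc n) l) count≡2 (≅-trans A≅Δ (Δ≅D χ))
  where
  -- The first transposition sends `t` to `j`. The second sends the current image `x` of `t′` to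
  -- `j′`, and it fixes `j`, which is neither `x` nor `j′`.
  τ = Perm.transpose t j
  x = τ ⟨$⟩ʳ t′
  π = τ ∘ₚ Perm.transpose x j′
  j≢x : j ≢ x
  j≢x e = t≢t′ (trans (sym (Perm.inverseˡ τ)) (trans (cong (τ ⟨$⟩ˡ_) (trans (transpose-first t j) e)) (Perm.inverseˡ τ)))
  πt : π ⟨$⟩ʳ t ≡ j
  πt = trans (cong (Perm.transpose x j′ ⟨$⟩ʳ_) (transpose-first t j)) (transpose-other x j′ j j≢x j≢j′)
  πt′ : π ⟨$⟩ʳ t′ ≡ j′
  πt′ = transpose-first x j′
  f χ : Fin (suc n) → Bool
  f u = does (u ≟ t) ∨ does (u ≟ t′)
  χ k = f (π ⟨$⟩ˡ k)
  Row : Fin (suc n) → Bool → Set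
  Row u b = ∃ λ s → IsSign s × ∀ k → A u k ≡ s * ((if b then flipSign (π ⟨$⟩ʳ u) k else 1ℤ) * A c k)
  marked : ∀ {v a} → π ⟨$⟩ʳ v ≡ a → Differ (a ∷ []) (A c) (A v) → Row v true
  marked πv d = Differ.scale d , Differ.scale-sign d , λ k → trans (Differ.differ≡ d k)
    (cong (λ z → Differ.scale d * (z * A c k)) (trans (ℤₚ.*-identityʳ _) (cong (λ l → flipSign l k) (sym πv))))
  row : ∀ u → Row u (f u)
  row u = go (u ≟ t) (u ≟ t′) (others u)
    where
    go : (u≟t : Dec (u ≡ t)) (u≟t′ : Dec (u ≡ t′)) → u ≡ t ⊎ u ≡ t′ ⊎ Differ [] (A c) (A u) → Row u (does u≟t ∨ does u≟t′)
    go (yes u≡t) _          _                 = subst (λ u → Row u true) (sym u≡t) (marked πt d)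
    go (no _)    (yes u≡t′) _                 = subst (λ u → Row u true) (sym u≡t′) (marked πt′ d′)
    go (no u≢t)  (no _)     (inj₁ u≡t)        = contradiction u≡t u≢t
    go (no _)    (no u≢t′)  (inj₂ (inj₁ e))   = contradiction e u≢t′
    go (no _)    (no _)     (inj₂ (inj₂ d″))  = Differ.scale d″ , Differ.scale-sign d″ , Differ.differ≡ d″
  A≅Δ : A ≅ Δ χ
  A≅Δ = marked≅Δ π f (A c) (proj₁ ∘ row) (A-sign c) (λ u → proj₁ (proj₂ (row u))) (λ u → proj₂ (proj₂ (row u)))
  preimage : ∀ {v a} → π ⟨$⟩ʳ v ≡ a → ∀ k → does (π ⟨$⟩ˡ k ≟ v) ≡ does (k ≟ a)
  preimage {v} {a} πv k = does-cong (π ⟨$⟩ˡ k ≟ v) (k ≟ a)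
    (λ e → trans (sym (Perm.inverseʳ π)) (trans (cong (π ⟨$⟩ʳ_) e) πv))
    (λ e → trans (cong (π ⟨$⟩ˡ_) (trans e (sym πv))) (Perm.inverseˡ π))
  χ≡ : ∀ k → χ k ≡ only j k ∨ only j′ k
  χ≡ k = cong₂ _∨_ (preimage πt k) (preimage πt′ k)
  erased : erase j χ ≗ only j′
  erased k = trans (cong (_∧ not (does (k ≟ j))) (χ≡ k)) (go (k ≟ j) (k ≟ j′))
    where
    go : (k≟j : Dec (k ≡ j)) (k≟j′ : Dec (k ≡ j′)) → (does k≟j ∨ does k≟j′) ∧ not (does k≟j) ≡ does k≟j′
    go (yes e) (yes e′) = contradiction (trans (sym e) e′) j≢j′
    go (yes _) (no _)   = refl
    go (no _)  (yes _)  = refl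
    go (no _)  (no _)   = refl
  count≡2 : count χ ≡ 2
  count≡2 = trans (count-erase χ j (trans (χ≡ j) (cong (_∨ only j′ j) (dec-true (j ≟ j) refl))))
    (cong suc (trans (count-cong erased) (count-only j′)))

-- For `v` the permanent of `D(3,1)` or `D(4,1)`, excluding nonsingular matrices is enough: among
-- singular ones of that order this value already forces the shape.
RankOneMarked : ℕ → Matrix n → Set
RankOneMarked v A = ∣ per A ∣ ≢ v ⊎ Independent A ⊎ OneMarked A

rankOneMarked? : (v : ℕ) (A : Matrix n) → Dec (RankOneMarked v A)
rankOneMarked? v A = ¬? (∣ per A ∣ ℕₚ.≟ v) ⊎-dec (independent? A ⊎-dec oneMarked? A)

pairs : {X Y : Set} → Search X → Search Y → Search (X × Y)
holds (pairs S T) P           = holds S λ x → holds T λ y → P (x , y)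
sound (pairs S T) P e (x , y) = sound T (λ y → P (x , y)) (sound S (λ x → holds T λ y → P (x , y)) e x) y

Border : ℕ → Set
Border n = Bool × Vec Bool n × Vec Bool n

borders : ∀ n → Search (Border n)
borders n = pairs bits (pairs (vectors bits n) (vectors bits n))

border : Border n → Matrix n → Matrix (suc n)
border (b , ρ , γ) = bordered (toSign b) (signVector ρ) (signVector γ)

Aligned : Border n → Set
Aligned (b , ρ , γ) = ∀ i j → signVector ρ j * signVector γ i ≡ toSign b

aligned? : (b : Border n) → Dec (Aligned b)
aligned? (b , ρ , γ) = all? λ i → all? λ j → signVector ρ j * signVector γ i ℤₚ.≟ toSign b

AlignedBorder : ℕ → Matrix n → Border n → Set
AlignedBorder v B b = ∣ per (border b B) ∣ ≢ v ⊎ Aligned b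

alignedBorder? : (v : ℕ) (B : Matrix n) (b : Border n) → Dec (AlignedBorder v B b)
alignedBorder? v B b = ¬? (∣ per (border b B) ∣ ℕₚ.≟ v) ⊎-dec aligned? b

MarkedBorder : ℕ → Matrix n → Border n → Set
MarkedBorder v B b = ∣ per (border b B) ∣ ≢ v ⊎ Independent (border b B) ⊎ TwoMarked (border b B)

markedBorder? : (v : ℕ) (B : Matrix n) (b : Border n) → Dec (MarkedBorder v B b)
markedBorder? v B b = ¬? (∣ per (border b B) ∣ ℕₚ.≟ v) ⊎-dec (independent? (border b B) ⊎-dec twoMarked? (border b B))

opaque
  unfolding per

  search-kind₄ : holds (bitMatrices 3 3) (λ V → does (kind₄? (normalForm V))) ≡ true
  search-kind₄ = refl

  search-D31 : holds (bitMatrices 2 2) (λ V → does (rankOneMarked? 2 (normalForm V))) ≡ true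
  search-D31 = refl

  search-D41 : holds (bitMatrices 3 3) (λ V → does (rankOneMarked? 12 (normalForm V))) ≡ true
  search-D41 = refl

  search-D42 : holds (borders 3) (λ b → does (markedBorder? 8 (D 3 2) b)) ≡ true
  search-D42 = refl

  search-D53 : holds (borders 4) (λ b → does (alignedBorder? 32 (D 4 3) b)) ≡ true
  search-D53 = refl

  search-D44 : holds (borders 4) (λ b → does (∣ per (border b (D 4 4)) ∣ ℕₚ.<? 32)) ≡ true
  search-D44 = refl

  per-D₄₄ : per (D 4 4) ≡ ℤ.+ 8
  per-D₄₄ = refl

abs-per-D₄₄ : ∣ per (D 4 4) ∣ ≡ 8
abs-per-D₄₄ = cong ∣_∣ per-D₄₄

trichotomy₄ : (A : Matrix 4) → IsSignMatrix A → Independent A → ∣ per A ∣ < 4 ⊎ A ≅ D 4 3 ⊎ A ≅ D 4 4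
trichotomy₄ A A-sign ind = go (normalise A A-sign)
  where
  go : ∃ (Normalised A) → ∣ per A ∣ < 4 ⊎ A ≅ D 4 3 ⊎ A ≅ D 4 4
  go (V , nf) = case searched (bitMatrices 3 3) (λ V → kind₄? (normalForm V)) search-kind₄ V of λ where
      (inj₁ small)                   → inj₁ (subst (_< 4) (sym (≅-per A≅)) small)
      (inj₂ (inj₁ dep))              → ⊥-elim (dep ind′)
      (inj₂ (inj₂ (inj₁ cent)))      → inj₂ (inj₁ (≅-trans A≅ (centred⇒≅D (normalForm-sign V) ind′ cent)))
      (inj₂ (inj₂ (inj₂ (p , a , near)))) → inj₂ (inj₂ (≅-trans A≅ (starred≅D (normalForm-sign V) ind′ p
        (a , λ t t≢p → [ (λ t≡p → contradiction t≡p t≢p) , id ]′ (near t)))))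
    where
    A≅ = normalised≅ nf
    ind′ = ≅-independent A≅ ind

independent-rank : {A : Matrix n} {k : ℕ} → RankAtMost A k → Independent A → n ≤ k
independent-rank rank≤ ind = rank≤ id ind

oneMarked-equality : (v : ℕ) → (∀ V → RankOneMarked v (normalForm {suc n} V)) → (A : Matrix (suc (suc n))) → IsSignMatrix A →
  ¬ Independent A → ∣ per A ∣ ≡ v → A ≅ D (suc (suc n)) 1
oneMarked-equality v found A A-sign dep tight = go (normalise A A-sign)
  where
  go : ∃ (Normalised A) → A ≅ D _ 1
  go (V , nf) = case found V of λ where
      (inj₁ ≢v)         → contradiction (trans (sym (≅-per A≅)) tight) ≢v
      (inj₂ (inj₁ ind)) → contradiction (≅-independent (≅-sym A≅) ind) dep
      (inj₂ (inj₂ one)) → ≅-trans A≅ (oneMarked⇒≅D (normalForm-sign V) one)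
    where
    A≅ = normalised≅ nf

equality₃₁ : Equality 1 1
equality₃₁ refl A A-sign s ind rank≤ tight = oneMarked-equality 2
  (searched (bitMatrices 2 2) (λ V → rankOneMarked? 2 (normalForm V)) search-D31) A A-sign
  (λ ind → ℕₚ.<⇒≱ (ℕₚ.n<1+n 2) (independent-rank {A = A} rank≤ ind)) tight

equality₄₁ : Equality 2 1
equality₄₁ refl A A-sign s ind rank≤ tight = oneMarked-equality 12
  (searched (bitMatrices 3 3) (λ V → rankOneMarked? 12 (normalForm V)) search-D41) A A-sign
  (λ ind → ℕₚ.<⇒≱ (ℕₚ.m≤m+n 3 1) (independent-rank {A = A} rank≤ ind)) tight

borderBits : ℤ → (ρ γ : Fin n → ℤ) → Border n
borderBits x ρ γ = fromSign x , toBits ρ , toBits γ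

border-bits : {x : ℤ} {ρ γ : Fin n → ℤ} {B : Matrix n} → IsSign x → SignVector ρ → SignVector γ →
  ∀ i j → bordered x ρ γ B i j ≡ border (borderBits x ρ γ) B i j
border-bits xs ρs γs zero    zero    = sym (toSign-fromSign xs)
border-bits xs ρs γs zero    (suc j) = sym (signVector-toBits ρs j)
border-bits xs ρs γs (suc i) zero    = sym (signVector-toBits γs i)
border-bits xs ρs γs (suc i) (suc j) = refl

border-sign : (b : Border n) {B : Matrix n} → IsSignMatrix B → IsSignMatrix (border b B)
border-sign b             B-sign zero    zero    = if-sign _
border-sign b             B-sign zero    (suc j) = if-sign _
border-sign b             B-sign (suc i) zero    = if-sign _
border-sign b             B-sign (suc i) (suc j) = B-sign i j

-- Some minors of `D(3,2)` have permanent 0, and equality imposes nothing on the border there.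
-- Extremal borders need not be aligned, so the search recognises the shape of `D(4,2)` instead.
equality₄₂ : Bound 0 2 → SmallerBound 1 2 → Equality 0 2 → Equality 1 2
equality₄₂ bound smaller equality = singular-equality-via 0 2 bound smaller equality unique
  where
  unique : ∀ {n} → n ≡ 3 → ∀ x (ρ γ : Fin n → ℤ) → IsSign x → SignVector ρ → SignVector γ →
    RankAtMost (bordered x ρ γ (D n 2)) 3 → ∣ per (bordered x ρ γ (D n 2)) ∣ ≡ 8 → bordered x ρ γ (D n 2) ≅ D (suc n) 2
  unique refl x ρ γ xs ρs γs rank≤ tight =
      case searched (borders 3) (markedBorder? 8 (D 3 2)) search-D42 b of λ where
        (inj₁ ≢8)         → contradiction (trans (sym (≅-per B≅)) tight) ≢8
        (inj₂ (inj₁ ind)) → contradiction (independent-rank {A = bordered x ρ γ (D 3 2)} rank≤ (≅-independent (≅-sym B≅) ind)) (ℕₚ.<⇒≱ (ℕₚ.n<1+n 3))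
        (inj₂ (inj₂ two)) → ≅-trans B≅ (twoMarked⇒≅D (border-sign b (D-sign 3 2)) two)
    where
    b = borderBits x ρ γ
    B≅ : bordered x ρ γ (D 3 2) ≅ border b (D 3 2)
    B≅ = ≗⇒≅ (border-bits xs ρs γs)

-- For n = 5 and r = 3 the regular minors are nonsingular of order 4, where D(4,4) violates the bound.

module _ (A : Matrix 5) (A-sign : IsSignMatrix A) (S : Splitting A 3) where
  open Splitting S

  regular-minor₅₃ : ∀ j → critical j ≡ false → ∣ per (minor row j A) ∣ < 4 ⊎ minor row j A ≅ D 4 3 ⊎ minor row j A ≅ D 4 4
  regular-minor₅₃ j e = trichotomy₄ (minor row j A) (minor-sign row j A-sign)
    (selection-independent {A = minor row j A} rest (minor-independent A A-sign S (ℕₚ.n<1+n 3) j e))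

  -- No border of `D(4,4)` reaches 32, so a minor that violates the order 4 bound still forces
  -- strict inequality at order 5.
  D₄₄-minor< : (∃ λ j → minor row j A ≅ D 4 4) → ∣ per A ∣ < 32
  D₄₄-minor< (j , minor≅) = go (bordered≅ A A-sign row j minor≅)
    where
    go : (∃ λ x → ∃ λ ρ → ∃ λ γ → IsSign x × SignVector ρ × SignVector γ × A ≅ bordered x ρ γ (D 4 4)) → ∣ per A ∣ < 32
    go (x , ρ , γ , xs , ρs , γs , A≅) = subst (_< 32) (sym (≅-per (≅-trans A≅ (≗⇒≅ (border-bits xs ρs γs)))))
      (searched (borders 4) (λ b → ∣ per (border b (D 4 4)) ∣ ℕₚ.<? 32) search-D44 (borderBits x ρ γ))

  D₄₄-minor⊎regular-≤ : (∃ λ j → minor row j A ≅ D 4 4) ⊎ (∀ j → critical j ≡ false → ∣ per (minor row j A) ∣ ≤ 4)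
  D₄₄-minor⊎regular-≤ = ∃⊎∀ λ j → go j (critical j) refl
    where
    at-most-4 : ∀ j → ∣ per (minor row j A) ∣ < 4 ⊎ minor row j A ≅ D 4 3 ⊎ minor row j A ≅ D 4 4 →
      minor row j A ≅ D 4 4 ⊎ ∣ per (minor row j A) ∣ ≤ 4
    at-most-4 j (inj₁ small)       = inj₂ (ℕₚ.<⇒≤ small)
    at-most-4 j (inj₂ (inj₁ ≅D₄₃)) = inj₂ (ℕₚ.≤-reflexive (trans (≅-per ≅D₄₃) (abs-per-D 0 3 4 refl)))
    at-most-4 j (inj₂ (inj₂ ≅D₄₄)) = inj₁ ≅D₄₄
    go : ∀ j b → critical j ≡ b → minor row j A ≅ D 4 4 ⊎ (critical j ≡ false → ∣ per (minor row j A) ∣ ≤ 4)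
    go j true  e = inj₂ λ e′ → contradiction (trans (sym e) e′) λ ()
    go j false e = [ inj₁ , (λ small → inj₂ λ _ → small) ]′ (at-most-4 j (regular-minor₅₃ j e))

bound₅₃ : Bound 1 2 → Bound 1 3
bound₅₃ smaller refl A A-sign s ind = go (splitting A s ind (ℕₚ.n<1+n 3))
  where
  go : Splitting A 3 → ∣ per A ∣ ≤ 32
  go S = case D₄₄-minor⊎regular-≤ A A-sign S of λ where
    (inj₁ D₄₄)       → ℕₚ.<⇒≤ (D₄₄-minor< A A-sign S D₄₄)
    -- At most three critical minors, each at most 8, and the others at most 4: 3 · 8 + 2 · 4 = 32.
    (inj₂ regular-≤) → minor-sum-≤ A A-sign 0 3 refl S smaller 4 (ℕₚ.m≤m+n 4 4) regular-≤

equality₅₃ : Bound 1 2 → Equality 1 3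
equality₅₃ smaller refl A A-sign s ind rank≤ tight = go (splitting A s ind (ℕₚ.n<1+n 3))
  where
  unique : ∀ x (ρ γ : Fin 4 → ℤ) → IsSign x → SignVector ρ → SignVector γ → ∣ per (bordered x ρ γ (D 4 3)) ∣ ≡ 32 →
    bordered x ρ γ (D 4 3) ≅ D 5 3
  unique x ρ γ xs ρs γs tight = case searched (borders 4) (alignedBorder? 32 (D 4 3)) search-D53 b of λ where
      (inj₁ ≢32)     → contradiction (trans (sym (≅-per B≅)) tight) ≢32
      (inj₂ aligned) → ≅-trans B≅ (≅-trans (aligned≅onesBordered (λ j → if-sign _) (λ i → if-sign _) aligned) (onesBordered≅D 4 3 (ℕₚ.m≤m+n 3 1)))
    where
    b = borderBits x ρ γ
    B≅ : bordered x ρ γ (D 4 3) ≅ border b (D 4 3)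
    B≅ = ≗⇒≅ (border-bits xs ρs γs)
  go : Splitting A 3 → A ≅ D 5 3
  go S = case D₄₄-minor⊎regular-≤ A A-sign S of λ where
      (inj₁ D₄₄)       → contradiction tight (ℕₚ.<⇒≢ (D₄₄-minor< A A-sign S D₄₄))
      (inj₂ regular-≤) → case extremal-column 0 3 smaller refl A-sign S regular-≤ tight of λ where
        (j , e , extremal) → case regular-minor₅₃ A A-sign S j e of λ where
          (inj₁ small)       → contradiction extremal (ℕₚ.<⇒≢ small)
          (inj₂ (inj₁ ≅D₄₃)) → finish (bordered≅ A A-sign (Splitting.row S) j ≅D₄₃)
          (inj₂ (inj₂ ≅D₄₄)) → case trans (sym extremal) (trans (≅-per ≅D₄₄) abs-per-D₄₄) of λ ()
    where
    finish : (∃ λ x → ∃ λ ρ → ∃ λ γ → IsSign x × SignVector ρ × SignVector γ × A ≅ bordered x ρ γ (D 4 3)) → A ≅ D 5 3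
    finish (x , ρ , γ , xs , ρs , γs , A≅) = ≅-trans A≅ (unique x ρ γ xs ρs γs (trans (sym (≅-per A≅)) tight))

-- The induction

mutual
  nonsingular : ∀ r → r ≢ 3 → Nonsingular r
  nonsingular 0 _ = nonsingular₁
  nonsingular 1 _ = nonsingular₂
  nonsingular 2 _ = nonsingular₃
  nonsingular 3 r≢3 = contradiction refl r≢3
  nonsingular 4 _ = nonsingular₅
  nonsingular 5 _ = nonsingular₆ (bound 1 2 λ ()) (bound 2 1 λ ())
  nonsingular (suc (suc (suc (suc (suc (suc k)))))) _ = nonsingular-large k (bound (suc (suc k)) 2 λ ())

  -- Only nonsingular matrices of order 4 are excluded. The step that would appeal to them, `r = 3`
  -- and `m = 1`, is taken by `bound₅₃`, so the exclusion does not propagate.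
  bound : ∀ r m → (m ≡ 0 → r ≢ 3) → Bound m r
  bound r       zero    r≢3 = nonsingular-bound (nonsingular r (r≢3 refl))
  bound zero    (suc m) _   = singular-bound m zero (bound zero m λ _ ()) tt
  bound 1       (suc m) _   = singular-bound m 1 (bound 1 m λ _ ()) (bound 0 (suc m) λ ())
  bound 2       (suc m) _   = singular-bound m 2 (bound 2 m λ _ ()) (bound 1 (suc m) λ ())
  bound 3       1       _   = bound₅₃ (bound 2 1 λ ())
  bound 3       (suc (suc m)) _ = singular-bound (suc m) 3 (bound 3 (suc m) λ ()) (bound 2 (suc (suc m)) λ ())
  bound (suc (suc (suc (suc r)))) (suc m) _ = singular-bound m (4 +ℕ r)
    (bound (suc (suc (suc (suc r)))) m λ _ ()) (bound (suc (suc (suc r))) (suc m) λ ())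

smaller : ∀ r m → SmallerBound (suc m) r
smaller zero    m = tt
smaller (suc r) m = bound r (suc m) λ ()

N-positive : ∀ m l → (l ≡ 0 ⊎ 2 ≤ m +ℕ l) → 0 < N m l
N-positive m       zero          _               = ℕₚ.1≤n! (suc m)
N-positive zero    (suc (suc l)) _               = N₀-pos l
N-positive (suc m) (suc l)       _               = N-pos m (suc l)
N-positive zero    1             (inj₂ (s≤s ()))

per-D-pos : ∀ n l → l < n → (l ≡ 0 ⊎ 3 ≤ n) → 0ℤ <ℤ per (D n l)
per-D-pos n l l<n large = subst (0ℤ <ℤ_) (sym (per-D (n ∸ suc l) l n n≡))
  (ℤ.+<+ (N-positive (n ∸ suc l) l ([ inj₁ , (λ 3≤n → inj₂ (ℕ.s≤s⁻¹ (subst (3 ≤_) n≡ 3≤n))) ]′ large)))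
  where
  n≡ : n ≡ suc (n ∸ suc l) +ℕ l
  n≡ = trans (sym (ℕₚ.m∸n+n≡m l<n)) (ℕₚ.+-suc (n ∸ suc l) l)

per-D-pos′ : ∀ k l → l ≤ 4 +ℕ k → 0ℤ <ℤ per (D (4 +ℕ k) l)
per-D-pos′ k l l≤n with l ℕₚ.≟ 4 +ℕ k
... | no  l≢n  = per-D-pos (4 +ℕ k) l (ℕₚ.≤∧≢⇒< l≤n l≢n) (inj₂ (s≤s (s≤s (s≤s z≤n))))
... | yes refl = full k
  where
  full : ∀ k → 0ℤ <ℤ per (D (4 +ℕ k) (4 +ℕ k))
  full zero    = subst (0ℤ <ℤ_) (sym per-D₄₄) (ℤ.+<+ (s≤s z≤n))
  full (suc k) = case per-D-full-bounds k of λ where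
    (p , per≡p , 0<p , _) → subst (0ℤ <ℤ_) (sym per≡p) (ℤ.+<+ 0<p)

-- The separate singular cases, `(n , r)` equal to (3,1), (4,1), (4,2), (5,3), are those in which
-- `D(n-1,r)` or one of its minors has a nonpositive permanent: `D(1,1)`, `D(2,1)`, `D(3,3)` have
-- permanents -1, 0, -2. In all other singular cases `singular-equality` applies.
equality : ∀ r m → (m ≡ 0 → r ≢ 3) → Equality m r
equality r zero r≢3 = nonsingular-equality (nonsingular r (r≢3 refl))
equality 0 (suc m) _ = singular-equality m 0 (bound 0 m λ _ ()) (smaller 0 m) (equality 0 m λ _ ()) (N-positive m 0 (inj₁ refl)) positive
  where
  positive : ∀ l → l ≤ 0 → l ≤ m +ℕ 0 → 0ℤ <ℤ per (D (m +ℕ 0) l)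
  positive zero _ _ = subst (0ℤ <ℤ_) (sym (per-ones (m +ℕ 0) (D (m +ℕ 0) 0) (D-zero (m +ℕ 0)))) (ℤ.+<+ (ℕₚ.1≤n! (m +ℕ 0)))
equality 1 1 _ = equality₃₁
equality 1 2 _ = equality₄₁
equality 1 (suc (suc (suc m))) _ = singular-equality (2 +ℕ m) 1 (bound 1 (2 +ℕ m) λ _ ()) (smaller 1 (2 +ℕ m)) (equality 1 (suc (suc m)) λ _ ())
  (N-positive (2 +ℕ m) 1 (inj₂ (s≤s (s≤s z≤n))))
  λ l l≤1 _ → subst (λ k → 0ℤ <ℤ per (D k l)) (sym (ℕₚ.+-comm (2 +ℕ m) 1))
    (per-D-pos (3 +ℕ m) l (ℕₚ.≤-trans (s≤s l≤1) (s≤s (s≤s z≤n))) (inj₂ (s≤s (s≤s (s≤s z≤n)))))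
equality 2 1 _ = equality₄₂ (bound 2 0 λ _ ()) (smaller 2 0) (equality 2 0 λ _ ())
equality 2 (suc (suc m)) _ = singular-equality (suc m) 2 (bound 2 (suc m) λ _ ()) (smaller 2 (suc m)) (equality 2 (suc m) λ _ ())
  (N-positive (suc m) 2 (inj₂ (s≤s (ℕₚ.≤-trans (s≤s z≤n) (ℕₚ.m≤n+m 2 m)))))
  λ l l≤2 _ → subst (λ k → 0ℤ <ℤ per (D k l)) (sym (ℕₚ.+-comm (suc m) 2))
    (per-D-pos (3 +ℕ m) l (ℕₚ.≤-trans (s≤s l≤2) (s≤s (s≤s (s≤s z≤n)))) (inj₂ (s≤s (s≤s (s≤s z≤n)))))
equality 3 1 _ = equality₅₃ (bound 2 1 λ ())
equality 3 (suc (suc m)) _ = singular-equality (suc m) 3 (bound 3 (suc m) λ ()) (smaller 3 (suc m)) (equality 3 (suc m) λ ())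
  (N-positive (suc m) 3 (inj₂ (s≤s (ℕₚ.≤-trans (s≤s z≤n) (ℕₚ.m≤n+m 3 m)))))
  λ l l≤3 _ → subst (λ k → 0ℤ <ℤ per (D k l)) (sym (ℕₚ.+-comm (suc m) 3))
    (per-D-pos′ m l (ℕₚ.≤-trans l≤3 (s≤s (s≤s (s≤s z≤n)))))
equality (suc (suc (suc (suc r)))) (suc m) _ = singular-equality m (4 +ℕ r) (bound (4 +ℕ r) m λ _ ()) (smaller (4 +ℕ r) m) (equality (suc (suc (suc (suc r)))) m λ _ ())
  (N-positive m (4 +ℕ r) (inj₂ (ℕₚ.≤-trans (s≤s (s≤s z≤n)) (ℕₚ.m≤n+m (4 +ℕ r) m))))
  λ l _ l≤n → subst (λ k → 0ℤ <ℤ per (D k l)) (ring m r) (per-D-pos′ (m +ℕ r) l (subst (l ≤_) (sym (ring m r)) l≤n))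
  where
  ring : ∀ m r → 4 +ℕ (m +ℕ r) ≡ m +ℕ (4 +ℕ r)
  ring = ℕ-Solver.solve-∀

-- Return to `permanent`, the ground field and elementary transformations

open import Data.Integer.Base using (+_)

module _ (n m r : ℕ) (n≡ : n ≡ suc m +ℕ r) where

  permanent-D : permanent (D n r) ≡ ℤ.+ N m r
  permanent-D = trans (permanent≡per (D n r)) (per-D m r n n≡)

  obtainable-permanent : {A : Matrix n} → ObtainableFrom A (D n r) → ℤ.+ ∣ permanent A ∣ ≡ permanent (D n r)
  obtainable-permanent {A} obtainable = begin
    ℤ.+ ∣ permanent A ∣      ≡⟨ cong (λ z → ℤ.+ ∣ z ∣) (permanent≡per A) ⟩
    ℤ.+ ∣ per A ∣            ≡⟨ cong ℤ.+_ (obtainable-per obtainable) ⟩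
    ℤ.+ ∣ per (D n r) ∣      ≡⟨ cong ℤ.+_ (abs-per-D m r n n≡) ⟩
    ℤ.+ N m r                ≡⟨ permanent-D ⟨
    permanent (D n r)        ∎
    where open ≡-Reasoning

  permanent-≤ : {A : Matrix n} → ∣ per A ∣ ≤ N m r → ℤ.+ ∣ permanent A ∣ ≤ℤ permanent (D n r)
  permanent-≤ {A} bounded = subst₂ _≤ℤ_ (cong (λ z → ℤ.+ ∣ z ∣) (sym (permanent≡per A))) (sym permanent-D) (ℤ.+≤+ bounded)

  permanent-≡ : {A : Matrix n} → ℤ.+ ∣ permanent A ∣ ≡ permanent (D n r) → ∣ per A ∣ ≡ N m r
  permanent-≡ {A} tight = trans (cong ∣_∣ (sym (permanent≡per A))) (ℤₚ.+-injective (trans tight permanent-D))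

equality₄₃ : (A : Matrix 4) → IsSignMatrix A → Independent A → ∣ per A ∣ ≡ 4 → A ≅ D 4 3
equality₄₃ A A-sign ind tight = case trichotomy₄ A A-sign ind of λ where
  (inj₁ small)        → contradiction tight (ℕₚ.<⇒≢ small)
  (inj₂ (inj₁ A≅D₄₃)) → A≅D₄₃
  (inj₂ (inj₂ A≅D₄₄)) → case trans (sym tight) (trans (≅-per A≅D₄₄) abs-per-D₄₄) of λ ()

exception : (A : Matrix 4) → IsSignMatrix A → Independent A →
  (¬ (ℤ.+ ∣ permanent A ∣ ≤ℤ permanent (D 4 3))) ⇔ ObtainableFrom A (D 4 4)
exception A A-sign ind = mk⇔
  (λ exceeds → case trichotomy₄ A A-sign ind of λ where
    (inj₁ small)        → contradiction (permanent-≤ 4 0 3 refl {A} (ℕₚ.<⇒≤ small)) exceeds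
    (inj₂ (inj₁ A≅D₄₃)) → contradiction (permanent-≤ 4 0 3 refl {A} (ℕₚ.≤-reflexive (trans (≅-per A≅D₄₃) (abs-per-D 0 3 4 refl)))) exceeds
    (inj₂ (inj₂ A≅D₄₄)) → ≅⇒obtainable A≅D₄₄)
  -- The bound would say `8 ≤ 4`.
  λ obtainable bounded → ℕₚ.<⇒≱ (ℕₚ.m≤m+n 5 3) (ℤₚ.drop‿+≤+
    (subst₂ _≤ℤ_ (cong ℤ.+_ (trans (cong ∣_∣ (permanent≡per A)) (trans (obtainable-per obtainable) abs-per-D₄₄)))
      (permanent-D 4 0 3 refl) bounded))

corollary8p9 : ∀ {c ℓ₁ ℓ₂} (K : HeytingField c ℓ₁ ℓ₂) → CharacteristicZero K →
    ∀ (n : ℕ) → 2 ≤ n →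
    ∀ (A : Matrix n) → IsSignMatrix A →
    ∀ (r : ℕ) → r ≤ n ∸ 1 → HasRank K A (suc r) →
    ((n , r) ≢ (4 , 3) → + ∣ permanent A ∣ ≤ℤ permanent (D n r))
    × ((n , r) ≡ (4 , 3) →
    (¬ (+ ∣ permanent A ∣ ≤ℤ permanent (D n 3))) ⇔ ObtainableFrom A (D n 4))
    × ((+ ∣ permanent A ∣ ≡ permanent (D n r)) ⇔ ObtainableFrom A (D n r))
    × (5 ≤ n →
    (+ ∣ permanent A ∣ ≤ℤ permanent (D n r))
    × ((+ ∣ permanent A ∣ ≡ permanent (D n r)) ⇔ ObtainableFrom A (D n r)))
corollary8p9 K char0 n 2≤n A A-sign r r≤n∸1 ((s , s-independent) , s-maximal) =
  inequality , exceptional , equal , λ 5≤n → inequality (λ e → ℕₚ.<⇒≱ 5≤n (ℕₚ.≤-reflexive (cong proj₁ e))) , equal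
  where
  corank : ℕ
  corank = n ∸ suc r
  r<n : r < n
  r<n = subst (r <_) (ℕₚ.m+[n∸m]≡n (ℕₚ.≤-trans (s≤s z≤n) 2≤n)) (s≤s r≤n∸1)
  n≡ : n ≡ suc corank +ℕ r
  n≡ = trans (sym (ℕₚ.m∸n+n≡m r<n)) (ℕₚ.+-suc corank r)
  ind : Independent (A ∘ s)
  ind = independentOver⇒independent K char0 (A ∘ s) s-independent
  rank≤ : RankAtMost A (suc r)
  rank≤ t t-ind = s-maximal t (independent⇒independentOver K char0 (A ∘ t) t-ind)
  order : corank ≡ 0 → r ≡ 3 → (n , r) ≡ (4 , 3)
  order m≡0 r≡3 = cong₂ _,_ (trans n≡ (cong₂ (λ m r → suc m +ℕ r) m≡0 r≡3)) r≡3
  inequality : (n , r) ≢ (4 , 3) → ℤ.+ ∣ permanent A ∣ ≤ℤ permanent (D n r)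
  inequality regular = permanent-≤ n corank r n≡ {A} (bound r corank (λ m≡0 r≡3 → regular (order m≡0 r≡3)) n≡ A A-sign s ind)
  exceptional : (n , r) ≡ (4 , 3) → (¬ (ℤ.+ ∣ permanent A ∣ ≤ℤ permanent (D n 3))) ⇔ ObtainableFrom A (D n 4)
  exceptional refl = exception A A-sign (selection-independent {A = A} s ind)
  extremal : ∀ n m r → n ≡ suc m +ℕ r → (A : Matrix n) → IsSignMatrix A → (s : Fin (suc r) → Fin n) → Independent (A ∘ s) →
    RankAtMost A (suc r) → ∣ per A ∣ ≡ N m r → A ≅ D n r
  extremal n m r n≡ A A-sign s ind rank≤ tight with m ℕₚ.≟ 0 | r ℕₚ.≟ 3
  extremal _ _ _ refl A A-sign s ind rank≤ tight | yes refl | yes refl = equality₄₃ A A-sign (selection-independent {A = A} s ind) tight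
  ... | yes _  | no r≢3 = equality r m (λ _ → r≢3) n≡ A A-sign s ind rank≤ tight
  ... | no m≢0 | _      = equality r m (λ m≡0 → contradiction m≡0 m≢0) n≡ A A-sign s ind rank≤ tight
  equal : (ℤ.+ ∣ permanent A ∣ ≡ permanent (D n r)) ⇔ ObtainableFrom A (D n r)
  equal = mk⇔
    (λ tight → ≅⇒obtainable (extremal n corank r n≡ A A-sign s ind rank≤ (permanent-≡ n corank r n≡ {A} tight)))
    (obtainable-permanent n corank r n≡ {A})
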